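{- Let $k \ge t \ge 1$ be fixed integers. For each $v \ge k$, let $\mathcal{C}_v$ be the $(v,k,t)$ covering produced by the random greedy covering algorithm (the greedy algorithm with uniformly random ordering of the $k$-subsets of a $v$-set). Then the expected density of $\mathcal{C}_v$ is $1 + o(1)$ as $v \to \infty$.
   Context: A $(v,k,t)$ covering is a family of $k$-subsets, called blocks, of a fixed $v$-set such that every $t$-subset of the $v$-set is contained in at least one block. Its size is the number of blocks, and its density is the average, over all $t$-subsets, of the number of blocks containing the $t$-subset; equivalently, the density is $(\text{number of blocks}) \cdot \binom{k}{t} / \binom{v}{t}$. Random greedy $(v,k,t)$ covering algorithm: (1) Fix a uniformly random ordering of all $k$-subsets of the $v$-set. (2) Choose the earliest $k$-set in the ordering that contains no already-covered $t$-set (a $t$-set is already covered if it is contained in a previously chosen $k$-set). (3) Repeat step (2) until no $k$-set can be chosen. (4) For each $t$-set that is still uncovered at this point, add one $k$-set containing it. The output is the family of all $k$-sets chosen in steps (2)-(3) together with those added in step (4). The expectation is over the random ordering. -}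

module Defs where

open import Data.Fin.Subset using (Subset; inside; outside; ∣_∣; _⊆_)
open import Data.Fin.Subset.Properties using (_⊆?_; ⊆-refl; s⊆s; out⊆)
open import Data.Integer.Base using (+_)
open import Data.List.Base using
  (List; []; _∷_; _++_; map; concatMap; filter; find; foldr; length)
open import Data.List.Membership.Propositional using (_∈_; lose)
open import Data.List.Membership.Propositional.Properties using
  (∈-++⁺ˡ; ∈-++⁺ʳ; ∈-map⁺; ∈-map⁻; ∈-concatMap⁻; ∈-filter⁺; ∈-filter⁻)
open import Data.List.Properties using (filter-notAll; length-filter)
open import Data.List.Relation.Binary.Permutation.Propositional using
  (_↭_; ↭-refl; ↭-sym; ↭-trans; prep; swap)
open import Data.List.Relation.Binary.Permutation.Propositional.Properties using
  (All-resp-↭)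
open import Data.List.Relation.Unary.All as All using (All; []; _∷_)
open import Data.List.Relation.Unary.All.Properties using
  (all-filter; ++⁺)
open import Data.List.Relation.Unary.Any as Any using (Any; here; there; any?)
open import Data.List.Relation.Unary.Any.Properties using (++⁺ˡ; ++⁺ʳ)
open import Data.Maybe.Base using (just; nothing)
open import Data.Nat.Base using (ℕ; zero; suc; _≤_; _<_; z≤n; s≤s; s≤s⁻¹)
open import Data.Nat.Properties using (_≟_; <-≤-trans; ≤-antisym; ≤∧≢⇒<)
open import Data.Product.Base using (∃-syntax; _×_; _,_; proj₁; proj₂)
open import Data.Rational.Base as ℚ using (ℚ; 0ℚ)
open import Data.Vec.Base using ([]; _∷_)
open import Function.Base using (_∘_)
open import Relation.Binary.PropositionalEquality using
  (_≡_; refl; sym; cong; subst)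
open import Relation.Nullary.Decidable using (yes; no; _×-dec_; ¬?)
open import Relation.Nullary.Negation using (¬_; contradiction)
open import Relation.Unary using (Pred; Decidable)

-- Finite averages

sumℚ : List ℚ → ℚ
sumℚ = foldr ℚ._+_ 0ℚ

-- The value on the empty list is a junk value.
average : ∀ {a} {A : Set a} → (A → ℚ) → List A → ℚ
average f []            = 0ℚ
average f xs@(_ ∷ xs′) = sumℚ (map f xs) ℚ.* (+ 1 ℚ./ suc (length xs′))

-- Subsets and orderings

subsets : ∀ v → List (Subset v)
subsets zero    = [] ∷ []
subsets (suc v) = map (outside ∷_) (subsets v) ++ map (inside ∷_) (subsets v)

subsetsOfSize : ∀ v → ℕ → List (Subset v)
subsetsOfSize v m = filter (λ S → ∣ S ∣ ≟ m) (subsets v)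

insertions : ∀ {a} {A : Set a} → A → List A → List (List A)
insertions x []       = (x ∷ []) ∷ []
insertions x (y ∷ ys) = (x ∷ y ∷ ys) ∷ map (y ∷_) (insertions x ys)

permutations : ∀ {a} {A : Set a} → List A → List (List A)
permutations []       = [] ∷ []
permutations (x ∷ xs) = concatMap (insertions x) (permutations xs)

-- Each ordering of the k-subsets occurs exactly once here, so averaging over
-- this list is expectation for the uniform distribution.
orderings : ∀ v → ℕ → List (List (Subset v))
orderings v k = permutations (subsetsOfSize v k)

-- Coverings.  A family of blocks is a list, so blocks count with multiplicity.

Covered : ∀ {v} → List (Subset v) → Subset v → Set
Covered 𝓑 T = Any (T ⊆_) 𝓑

covered? : ∀ {v} (𝓑 : List (Subset v)) → Decidable (Covered 𝓑)
covered? 𝓑 T = any? (T ⊆?_) 𝓑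

record IsCovering (v k t : ℕ) (𝓑 : List (Subset v)) : Set where
  field
    blockSize : All (λ B → ∣ B ∣ ≡ k) 𝓑
    covers    : ∀ T → ∣ T ∣ ≡ t → Covered 𝓑 T

multiplicity : ∀ {v} → List (Subset v) → Subset v → ℕ
multiplicity 𝓑 T = length (filter (T ⊆?_) 𝓑)

density : ∀ {v} → ℕ → List (Subset v) → ℚ
density {v} t 𝓑 = average (λ T → + multiplicity 𝓑 T ℚ./ 1) (subsetsOfSize v t)

-- The greedy algorithm

module _ {v : ℕ} (t : ℕ) where

  -- B contains no t-set that is covered by the blocks already chosen.
  Selectable : List (Subset v) → Subset v → Set
  Selectable 𝓑 B = ¬ Any (λ T → T ⊆ B × Covered 𝓑 T) (subsetsOfSize v t)

  selectable? : ∀ 𝓑 → Decidable (Selectable 𝓑)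
  selectable? 𝓑 B =
    ¬? (any? (λ T → T ⊆? B ×-dec covered? 𝓑 T) (subsetsOfSize v t))

  -- The first argument bounds the number of iterations; see greedy-maximal
  -- for why length σ iterations always reach the stopping condition.
  greedyLoop : ℕ → List (Subset v) → List (Subset v) → List (Subset v)
  greedyLoop zero    σ 𝓑 = 𝓑
  greedyLoop (suc n) σ 𝓑 with find (selectable? 𝓑) σ
  ... | nothing = 𝓑
  ... | just B  = greedyLoop n σ (B ∷ 𝓑)

  greedy : List (Subset v) → List (Subset v)
  greedy σ = greedyLoop (length σ) σ []

  uncovered : List (Subset v) → List (Subset v)
  uncovered 𝓑 = filter (¬? ∘ covered? 𝓑) (subsetsOfSize v t)

-- A way of picking, for every t-set, some k-set containing it; the pick may
-- depend on the ordering σ.  See completion for existence.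
record Completion (v k t : ℕ) : Set where
  field
    block    : (σ : List (Subset v)) → Subset v → Subset v
    size     : ∀ σ T → ∣ T ∣ ≡ t → ∣ block σ T ∣ ≡ k
    contains : ∀ σ T → ∣ T ∣ ≡ t → T ⊆ block σ T

greedyCovering : ∀ {v k t} → Completion v k t → List (Subset v) → List (Subset v)
greedyCovering {t = t} c σ =
  greedy t σ ++ map (Completion.block c σ) (uncovered t (greedy t σ))

expectedDensity : ∀ {v k t} → Completion v k t → ℚ
expectedDensity {v} {k} {t} c =
  average (λ σ → density t (greedyCovering c σ)) (orderings v k)

-- The loop bound suffices, the output is a covering, and completions exist

∈-subsets : ∀ {v} (S : Subset v) → S ∈ subsets v
∈-subsets []            = here refl
∈-subsets (outside ∷ S) = ∈-++⁺ˡ (∈-map⁺ (outside ∷_) (∈-subsets S))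
∈-subsets {suc v} (inside ∷ S) =
  ∈-++⁺ʳ (map (outside ∷_) (subsets v)) (∈-map⁺ (inside ∷_) (∈-subsets S))

∈-subsetsOfSize : ∀ {v m} (S : Subset v) → ∣ S ∣ ≡ m → S ∈ subsetsOfSize v m
∈-subsetsOfSize S = ∈-filter⁺ (λ S → ∣ S ∣ ≟ _) (∈-subsets S)

∈-insertions⇒↭ : ∀ {a} {A : Set a} (x : A) ys {zs} →
                 zs ∈ insertions x ys → zs ↭ x ∷ ys
∈-insertions⇒↭ x []       (here refl) = ↭-refl
∈-insertions⇒↭ x (y ∷ ys) (here refl) = ↭-refl
∈-insertions⇒↭ x (y ∷ ys) (there z∈) with ∈-map⁻ (y ∷_) z∈
... | _ , w∈ , refl =
  ↭-trans (prep y (∈-insertions⇒↭ x ys w∈)) (swap y x ↭-refl)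

∈-permutations⇒↭ : ∀ {a} {A : Set a} (xs : List A) {σ} →
                   σ ∈ permutations xs → σ ↭ xs
∈-permutations⇒↭ []       (here refl) = ↭-refl
∈-permutations⇒↭ (x ∷ xs) σ∈ =
  go (permutations xs) (λ τ∈ → ∈-permutations⇒↭ xs τ∈)
     (∈-concatMap⁻ (insertions x) σ∈)
  where
  go : ∀ τs {σ} → (∀ {τ} → τ ∈ τs → τ ↭ xs) →
       Any (λ τ → σ ∈ insertions x τ) τs → σ ↭ x ∷ xs
  go (τ ∷ _) ih (here σ∈τ) = ↭-trans (∈-insertions⇒↭ x τ σ∈τ) (prep x (ih (here refl)))
  go (_ ∷ τs) ih (there p) = go τs (ih ∘ there) p

ordering-size : ∀ {v k σ} → σ ∈ orderings v k → All (λ B → ∣ B ∣ ≡ k) σ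
ordering-size {v} {k} σ∈ =
  All-resp-↭ (↭-sym (∈-permutations⇒↭ (subsetsOfSize v k) σ∈))
             (all-filter (λ S → ∣ S ∣ ≟ k) (subsets v))

shrink : ∀ {v} m (S : Subset v) → m ≤ ∣ S ∣ → ∃[ T ] T ⊆ S × ∣ T ∣ ≡ m
shrink {zero}  zero    []            _       = [] , ⊆-refl , refl
shrink         m       (outside ∷ S) m≤      with shrink m S m≤
... | T , T⊆S , eq = outside ∷ T , s⊆s T⊆S , eq
shrink {suc v} zero    (inside ∷ S)  _       with shrink zero S z≤n
... | T , T⊆S , eq = outside ∷ T , out⊆ T⊆S , eq
shrink         (suc m) (inside ∷ S)  (s≤s m≤) with shrink m S m≤
... | T , T⊆S , eq = inside ∷ T , s⊆s T⊆S , cong suc eq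

module _ {a p} {A : Set a} {P : Pred A p} (P? : Decidable P) where

  find-nothing : ∀ xs → find P? xs ≡ nothing → All (¬_ ∘ P) xs
  find-nothing []       _  = []
  find-nothing (x ∷ xs) eq with P? x
  ... | no ¬px = ¬px ∷ find-nothing xs eq

  find-just : ∀ xs {x} → find P? xs ≡ just x → x ∈ xs × P x
  find-just (x ∷ xs) eq with P? x
  find-just (x ∷ xs) refl | yes px = here refl , px
  find-just (x ∷ xs) eq   | no _ with find-just xs eq
  ... | x∈ , px = there x∈ , px

  module _ {q} {Q : Pred A q} (Q? : Decidable Q) (Q⇒P : ∀ {x} → Q x → P x) where

    filter-mono : ∀ xs → filter Q? (filter P? xs) ≡ filter Q? xs
    filter-mono []       = refl
    filter-mono (x ∷ xs) with P? x
    filter-mono (x ∷ xs) | yes px with Q? x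
    ... | yes _ = cong (x ∷_) (filter-mono xs)
    ... | no  _ = filter-mono xs
    filter-mono (x ∷ xs) | no ¬px with Q? x
    ... | yes qx = contradiction (Q⇒P qx) ¬px
    ... | no  _  = filter-mono xs

    filter-< : ∀ xs {x} → x ∈ xs → P x → ¬ Q x →
               length (filter Q? xs) < length (filter P? xs)
    filter-< xs x∈ px ¬qx =
      subst (λ ys → length ys < length (filter P? xs)) (filter-mono xs)
        (filter-notAll Q? (filter P? xs) (lose (∈-filter⁺ P? x∈ px) ¬qx))

module _ {v k t : ℕ} (t≤k : t ≤ k) where

  selectable-∷ : ∀ {B C : Subset v} {𝓑} → Selectable t (B ∷ 𝓑) C → Selectable t 𝓑 C
  selectable-∷ sel = sel ∘ Any.map (λ (T⊆C , cov) → T⊆C , there cov)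

  chosen-unselectable : ∀ {B : Subset v} {𝓑} → ∣ B ∣ ≡ k → ¬ Selectable t (B ∷ 𝓑) B
  chosen-unselectable {B} refl sel with shrink t B t≤k
  ... | T , T⊆B , eq = sel (lose (∈-subsetsOfSize T eq) (T⊆B , here T⊆B))

  loop-maximal : ∀ n σ 𝓑 → All (λ B → ∣ B ∣ ≡ k) σ →
                 length (filter (selectable? {v} t 𝓑) σ) ≤ n →
                 All (λ B → ¬ Selectable t (greedyLoop t n σ 𝓑) B) σ
  loop-maximal zero σ 𝓑 sz len = All.tabulate λ B∈ sel →
    nonempty (∈-filter⁺ (selectable? t 𝓑) B∈ sel) len
    where
    nonempty : ∀ {B : Subset v} {xs} → B ∈ xs → ¬ length xs ≤ 0
    nonempty (here _)  ()
    nonempty (there _) ()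
  loop-maximal (suc n) σ 𝓑 sz len with find (selectable? t 𝓑) σ in eq
  ... | nothing = find-nothing (selectable? t 𝓑) σ eq
  ... | just B with find-just (selectable? t 𝓑) σ eq
  ...   | B∈ , sel = loop-maximal n σ (B ∷ 𝓑) sz (s≤s⁻¹ (<-≤-trans
            (filter-< (selectable? t 𝓑) (selectable? t (B ∷ 𝓑))
              selectable-∷ σ B∈ sel (chosen-unselectable (All.lookup sz B∈)))
            len))

  greedy-maximal : ∀ {σ} → σ ∈ orderings v k →
                   All (λ B → ¬ Selectable t (greedy t σ) B) σ
  greedy-maximal {σ} σ∈ =
    loop-maximal (length σ) σ [] (ordering-size σ∈)
      (length-filter (selectable? t []) σ)

loop-size : ∀ {v k} t n (σ 𝓑 : List (Subset v)) →
            All (λ B → ∣ B ∣ ≡ k) σ → All (λ B → ∣ B ∣ ≡ k) 𝓑 →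
            All (λ B → ∣ B ∣ ≡ k) (greedyLoop t n σ 𝓑)
loop-size t zero    σ 𝓑 szσ sz = sz
loop-size t (suc n) σ 𝓑 szσ sz with find (selectable? t 𝓑) σ in eq
... | nothing = sz
... | just B  = loop-size t n σ (B ∷ 𝓑) szσ
  (All.lookup szσ (proj₁ (find-just (selectable? t 𝓑) σ eq)) ∷ sz)

greedyCovering-isCovering : ∀ {v k t} (c : Completion v k t) {σ} →
  σ ∈ orderings v k → IsCovering v k t (greedyCovering c σ)
greedyCovering-isCovering {v} {k} {t} c {σ} σ∈ = record
  { blockSize = ++⁺ (loop-size t (length σ) σ [] (ordering-size σ∈) [])
                    (All.tabulate added-size)
  ; covers    = covers
  }
  where
  open Completion c
  𝓖 = greedy t σ

  added-size : ∀ {B} → B ∈ map (block σ) (uncovered t 𝓖) → ∣ B ∣ ≡ k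
  added-size B∈ with ∈-map⁻ (block σ) B∈
  ... | T , T∈ , refl = size σ T (proj₂ (∈-filter⁻ (λ S → ∣ S ∣ ≟ t) {xs = subsets v}
    (proj₁ (∈-filter⁻ (¬? ∘ covered? 𝓖) {xs = subsetsOfSize v t} T∈))))

  covers : ∀ T → ∣ T ∣ ≡ t → Covered (greedyCovering c σ) T
  covers T eq with covered? 𝓖 T
  ... | yes cov = ++⁺ˡ cov
  ... | no ¬cov = ++⁺ʳ 𝓖 (lose
    (∈-map⁺ (block σ) (∈-filter⁺ (¬? ∘ covered? 𝓖) (∈-subsetsOfSize T eq) ¬cov))
    (contains σ T eq))

grow : ∀ {v} m (S : Subset v) → ∣ S ∣ ≤ m → m ≤ v → ∃[ B ] S ⊆ B × ∣ B ∣ ≡ m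
grow {zero}  zero    []           _ _ = [] , ⊆-refl , refl
grow {suc v} (suc m) (inside ∷ S) (s≤s S≤) (s≤s m≤) with grow m S S≤ m≤
... | B , S⊆B , eq = inside ∷ B , s⊆s S⊆B , cong suc eq
grow {suc v} m (outside ∷ S) S≤ m≤ with m ≟ ∣ S ∣
... | yes refl = outside ∷ S , ⊆-refl , refl
grow {suc v} zero (outside ∷ S) S≤ m≤ | no m≢ = contradiction (≤-antisym z≤n S≤) m≢
grow {suc v} (suc m) (outside ∷ S) S≤ (s≤s m≤) | no m≢
  with grow m S (s≤s⁻¹ (≤∧≢⇒< S≤ (m≢ ∘ sym))) m≤
... | B , S⊆B , eq = inside ∷ B , out⊆ S⊆B , cong suc eq

completion : ∀ {v k t} → t ≤ k → k ≤ v → Completion v k t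
completion {v} {k} {t} t≤k k≤v = record
  { block    = λ _ T → proj₁ (pick T)
  ; size     = λ _ T eq → proj₂ (proj₂ (pick T) eq)
  ; contains = λ _ T eq → proj₁ (proj₂ (pick T) eq)
  }
  where
  pick : (T : Subset v) → ∃[ B ] (∣ T ∣ ≡ t → T ⊆ B × ∣ B ∣ ≡ k)
  pick T with ∣ T ∣ ≟ t
  ... | no ≢t = T , λ eq → contradiction eq ≢t
  ... | yes refl with grow k T t≤k k≤v
  ...   | B , T⊆B , eq = B , λ _ → T⊆B , eq

{-# OPTIONS --safe #-}
module Submission where

-- View the t-sets as vertices and the k-sets as edges of a hypergraph that is Q-uniform, D-regular
-- and has codegrees at most ρ D with ρ → 0.  At a stage of the greedy process let U be the number of
-- uncovered vertices, A the number of selectable edges and d T the number of selectable edges at T.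
-- If every d T equals τ, selecting a random selectable edge lowers τ by about Q (Q - 1) τ / U.  The
-- deviation W = Σ (d T - τ)², over uncovered T, is therefore tracked against a deterministic target
-- τ that decreases exactly by this amount: on average one step multiplies W by at most 1 + 2D/A, up to
-- an error of order ρ.  As Q A = Σ d T, a large A can fail only if W is large, by Cauchy–Schwarz, so
--   φ = ε + K x^p W / (N D²) + r x,   x = U / N,
-- with N the number of vertices, does not increase on average while x > ε and W is not large, and it
-- bounds x in the other cases.  Hence the expected fraction of t-sets left uncovered is at most the
-- initial value ε + r, and the density exceeds 1 by Q - 1 times that fraction.

open import Defs

-- No concentration of the individual degrees is available; only the mean of one quadratic
-- functional is followed. The obstacle is the terms of first order in H = Σ (d T - τ), over
-- uncovered T, since the sign of H is unknown. They cancel because of the exact rate at which τ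
-- falls: by Q A = U τ + H and Cauchy-Schwarz, what the moving target adds to W is at most what the
-- expected loss of degrees takes away. What is left is a sum of squares of favourable sign and Σ d
-- T (d T - τ)² ≤ D W, the source of the factor 1 + 2D/A. If W is not large, A is at least N D
-- ε^(q+1) / (2Q). As a step lowers x by Q / N, a large power x^p then shrinks fast enough to absorb
-- that factor. Each chosen block covers exactly Q new vertices, so x is determined by the number of
-- blocks chosen, and τ can be lowered deterministically. As φ is affine in W, only the average of W
-- over the selectable edges enters. Expectations are sums over lists of permutations: conditioning
-- is the removal of the first element of the ordering, and stopping is a case of the induction.

module RandomGreedy where

  open import Algebra.Bundles using (CommutativeRing)
  open import Data.Fin.Base using (Fin; zero; suc)
  import Data.Fin.Properties as Fin
  open import Data.Fin.Subset using (Subset; inside; outside; ∣_∣; _⊆_; _∪_; ∁; ⊤)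
  open import Data.Fin.Subset.Properties
  import Data.Integer.Base as ℤ
  import Data.Integer.Properties as ℤ
  open import Data.List.Base
    using (List; []; _∷_; _++_; map; filter; find; length; lookup; concatMap)
  open import Data.List.Membership.Propositional using (_∈_; lose)
  open import Data.List.Membership.Propositional.Properties using (∈-lookup; ∈-map⁻; ∈-filter⁻)
  open import Data.List.Properties using (++-assoc)
  open import Data.List.Relation.Binary.Permutation.Propositional as ↭
    using (_↭_; ↭-refl; ↭-trans; prep; swap)
  open import Data.List.Relation.Binary.Permutation.Propositional.Properties using (All-resp-↭; ↭-length)
  open import Data.List.Relation.Unary.All as All using (All; []; _∷_)
  open import Data.List.Relation.Unary.All.Properties using (all-filter; ++⁺)
  open import Data.List.Relation.Unary.AllPairs using ([]; _∷_)
  open import Data.List.Relation.Unary.Any as Any using (Any; here; there; any?)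
  open import Data.List.Relation.Unary.Any.Properties using (lookup-index)
  open import Data.List.Relation.Unary.Unique.Propositional using (Unique)
  import Data.List.Relation.Unary.Unique.Propositional.Properties as Unique
  open import Data.Maybe.Base using (just; nothing)
  open import Data.Nat.Base as ℕ using (ℕ; zero; suc; z≤n; s≤s; _∸_; _!)
  open import Data.Nat.Combinatorics using (_C_; nCk+nC[k+1]≡[n+1]C[k+1]; nC1≡n; nCn≡1)
  import Data.Nat.Coprimality as ℕ
  import Data.Nat.Properties as ℕ
  open import Data.Nat.Tactic.RingSolver using () renaming (solve-∀ to ℕ-solve-∀)
  open import Data.Product.Base using (_×_; _,_; proj₁; proj₂; ∃-syntax; Σ-syntax)
  open import Data.Rational.Base as ℚ hiding (∣_∣)
  open import Data.Rational.Properties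
  import Data.Rational.Unnormalised.Base as ℚᵘ
  import Data.Rational.Unnormalised.Properties as ℚᵘ
  open import Data.Sum.Base using (_⊎_; inj₁; inj₂; [_,_]′)
  open import Data.Vec.Base as Vec using ([]; _∷_)
  import Data.Vec.Properties as Vec
  open import Data.Empty using (⊥)
  open import Function.Base using (_∘_)
  open import Level using (0ℓ)
  open import Relation.Binary.PropositionalEquality
  open import Relation.Nullary
  open import Relation.Nullary.Decidable using (_×-dec_; ¬?; dec⇒maybe)
  open import Relation.Unary using (Pred; Decidable)
  open import Tactic.RingSolver using (solve-∀)
  open import Tactic.RingSolver.Core.AlmostCommutativeRing using (AlmostCommutativeRing; fromCommutativeRing)

  open import Algebra.Properties.Semiring.Exp (CommutativeRing.semiring +-*-commutativeRing) using (_^_)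
  open import Algebra.Properties.Semiring.Sum (CommutativeRing.semiring +-*-commutativeRing)
    using (sum; sum-syntax; sum-cong-≗; ∑-distrib-+; ∑-comm; *-distribˡ-sum; *-distribʳ-sum)

  -- Ordered field arithmetic and finite sums of rationals

  ringℚ : AlmostCommutativeRing 0ℓ 0ℓ
  ringℚ = fromCommutativeRing +-*-commutativeRing λ x → dec⇒maybe (0ℚ ≟ x)

  2ℚ : ℚ
  2ℚ = 1ℚ + 1ℚ

  6ℚ : ℚ
  6ℚ = 2ℚ * (2ℚ + 1ℚ)

  -- The form in which polynomial inequalities are proved below: the difference of the two sides is
  -- exhibited as a visibly nonnegative `r`, and the remaining identity is left to the ring solver.
  ≤-excess : ∀ {p q} r → p + r ≡ q → 0ℚ ≤ r → p ≤ q
  ≤-excess {p} r refl 0≤r = subst (_≤ p + r) (+-identityʳ p) (+-monoʳ-≤ p 0≤r)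

  difference≥0 : ∀ {p q} → p ≤ q → 0ℚ ≤ q - p
  difference≥0 {p} {q} p≤q = subst (_≤ q - p) (+-inverseʳ p) (+-monoˡ-≤ (- p) p≤q)

  +-nonNeg : ∀ {p q} → 0ℚ ≤ p → 0ℚ ≤ q → 0ℚ ≤ p + q
  +-nonNeg = +-mono-≤

  *-monoˡ-≤ : ∀ {r p q} → 0ℚ ≤ r → p ≤ q → r * p ≤ r * q
  *-monoˡ-≤ {r} 0≤r = *-monoˡ-≤-nonNeg r {{nonNegative 0≤r}}

  *-monoʳ-≤ : ∀ {r p q} → 0ℚ ≤ r → p ≤ q → p * r ≤ q * r
  *-monoʳ-≤ {r} 0≤r = *-monoʳ-≤-nonNeg r {{nonNegative 0≤r}}

  *-nonNeg : ∀ {p q} → 0ℚ ≤ p → 0ℚ ≤ q → 0ℚ ≤ p * q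
  *-nonNeg {p} {q} 0≤p 0≤q = subst (_≤ p * q) (*-zeroʳ p) (*-monoˡ-≤ 0≤p 0≤q)

  *-mono-≤ : ∀ {p q r s} → 0ℚ ≤ p → 0ℚ ≤ s → p ≤ q → r ≤ s → p * r ≤ q * s
  *-mono-≤ 0≤p 0≤s p≤q r≤s = ≤-trans (*-monoˡ-≤ 0≤p r≤s) (*-monoʳ-≤ 0≤s p≤q)

  square-nonNeg : ∀ p → 0ℚ ≤ p * p
  square-nonNeg p with ≤-total 0ℚ p
  ... | inj₁ 0≤p = *-nonNeg 0≤p 0≤p
  ... | inj₂ p≤0 = subst (0ℚ ≤_) (neg*neg p) (*-nonNeg (neg-antimono-≤ p≤0) (neg-antimono-≤ p≤0))
    where
    neg*neg : ∀ p → (- p) * (- p) ≡ p * p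
    neg*neg = solve-∀ ringℚ

  0≤1 : 0ℚ ≤ 1ℚ
  0≤1 = *≤* (ℤ.+≤+ ℕ.z≤n)

  0≤2 : 0ℚ ≤ 2ℚ
  0≤2 = +-nonNeg 0≤1 0≤1

  module _ {n : ℕ} where

    ∑-mono : {f g : Fin n → ℚ} → (∀ i → f i ≤ g i) → sum f ≤ sum g
    ∑-mono = go _
      where
      go : ∀ n {f g : Fin n → ℚ} → (∀ i → f i ≤ g i) → sum f ≤ sum g
      go zero    f≤g = ≤-refl
      go (suc n) f≤g = +-mono-≤ (f≤g zero) (go n (f≤g ∘ suc))

    ∑-zero : ∀ n → ∑[ i < n ] 0ℚ ≡ 0ℚ
    ∑-zero zero    = refl
    ∑-zero (suc n) = trans (+-identityˡ _) (∑-zero n)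

    ∑-nonNeg : {f : Fin n → ℚ} → (∀ i → 0ℚ ≤ f i) → 0ℚ ≤ sum f
    ∑-nonNeg {f} 0≤f = subst (_≤ sum f) (∑-zero n) (∑-mono 0≤f)

    ∑-distrib-- : (f g : Fin n → ℚ) → ∑[ i < n ] (f i - g i) ≡ sum f - sum g
    ∑-distrib-- f g = begin
      ∑[ i < n ] (f i - g i)                   ≡⟨ ∑-distrib-+ f (λ i → - g i) ⟩
      sum f + ∑[ i < n ] (- g i)               ≡⟨ cong (sum f +_) (sum-cong-≗ λ i → neg-* (g i)) ⟩
      sum f + ∑[ i < n ] ((- 1ℚ) * g i)        ≡⟨ cong (sum f +_) (*-distribˡ-sum (- 1ℚ) g) ⟨
      sum f + (- 1ℚ) * sum g                   ≡⟨ cong (sum f +_) (neg-* (sum g)) ⟨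
      sum f - sum g                            ∎
      where
      open ≡-Reasoning
      neg-* : ∀ p → - p ≡ (- 1ℚ) * p
      neg-* = solve-∀ ringℚ

  term≤∑ : ∀ {n} {f : Fin n → ℚ} → (∀ i → 0ℚ ≤ f i) → ∀ i → f i ≤ sum f
  term≤∑ {suc n} {f} 0≤f zero    = ≤-excess _ refl (∑-nonNeg (0≤f ∘ suc))
  term≤∑ {suc n} {f} 0≤f (suc i) =
    ≤-trans (term≤∑ (0≤f ∘ suc) i) (≤-excess _ (+-comm _ (f zero)) (0≤f zero))

  δ : ∀ {n} → Fin n → Fin n → ℚ
  δ zero    zero    = 1ℚ
  δ zero    (suc _) = 0ℚ
  δ (suc _) zero    = 0ℚ
  δ (suc i) (suc j) = δ i j

  ∑-δ : ∀ {n} i (g : Fin n → ℚ) → ∑[ j < n ] (δ i j * g j) ≡ g i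
  ∑-δ {suc n} zero g = begin
    1ℚ * g zero + ∑[ j < n ] (0ℚ * g (suc j)) ≡⟨ cong₂ _+_ (*-identityˡ (g zero)) (sum-cong-≗ λ j → *-zeroˡ (g (suc j))) ⟩
    g zero + ∑[ j < n ] 0ℚ                    ≡⟨ cong (g zero +_) (∑-zero {n} n) ⟩
    g zero + 0ℚ                               ≡⟨ +-identityʳ (g zero) ⟩
    g zero                                    ∎
    where open ≡-Reasoning
  ∑-δ {suc n} (suc i) g = begin
    0ℚ * g zero + ∑[ j < n ] (δ i j * g (suc j)) ≡⟨ cong₂ _+_ (*-zeroˡ (g zero)) (∑-δ i (g ∘ suc)) ⟩
    0ℚ + g (suc i)                               ≡⟨ +-identityˡ (g (suc i)) ⟩
    g (suc i)                                    ∎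
    where open ≡-Reasoning

  Bit : ℚ → Set
  Bit p = p ≡ 0ℚ ⊎ p ≡ 1ℚ

  bit-nonNeg : ∀ {p} → Bit p → 0ℚ ≤ p
  bit-nonNeg (inj₁ refl) = ≤-refl
  bit-nonNeg (inj₂ refl) = 0≤1

  bit≤1 : ∀ {p} → Bit p → p ≤ 1ℚ
  bit≤1 (inj₁ refl) = 0≤1
  bit≤1 (inj₂ refl) = ≤-refl

  bit-idem : ∀ {p} → Bit p → p * p ≡ p
  bit-idem (inj₁ refl) = refl
  bit-idem (inj₂ refl) = refl

  -- The shape of the double counts below: two weights and a kernel, so that exchanging the sums
  -- also moves each weight to where it can be factored out next.
  ∑-swap : ∀ {n m} (c : Fin n → ℚ) (f : Fin m → ℚ) (k : Fin n → Fin m → ℚ) →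
           ∑[ i < n ] (c i * ∑[ j < m ] (f j * k i j)) ≡
           ∑[ j < m ] (f j * ∑[ i < n ] (c i * k i j))
  ∑-swap {n} {m} c f k = begin
    ∑[ i < n ] (c i * ∑[ j < m ] (f j * k i j))
      ≡⟨ sum-cong-≗ (λ i → *-distribˡ-sum (c i) (λ j → f j * k i j)) ⟩
    ∑[ i < n ] ∑[ j < m ] (c i * (f j * k i j))
      ≡⟨ ∑-comm (λ i j → c i * (f j * k i j)) ⟩
    ∑[ j < m ] ∑[ i < n ] (c i * (f j * k i j))
      ≡⟨ sum-cong-≗ (λ j → sum-cong-≗ λ i → comm₃ (c i) (f j) (k i j)) ⟩
    ∑[ j < m ] ∑[ i < n ] (f j * (c i * k i j))
      ≡⟨ sum-cong-≗ (λ j → *-distribˡ-sum (f j) (λ i → c i * k i j)) ⟨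
    ∑[ j < m ] (f j * ∑[ i < n ] (c i * k i j)) ∎
    where
    open ≡-Reasoning
    comm₃ : ∀ x y z → x * (y * z) ≡ y * (x * z)
    comm₃ = solve-∀ ringℚ

  ∑-linear : ∀ {n} c (f g : Fin n → ℚ) → ∑[ i < n ] (f i + c * g i) ≡ sum f + c * sum g
  ∑-linear c f g = trans (∑-distrib-+ f (λ i → c * g i)) (cong (sum f +_) (sym (*-distribˡ-sum c g)))

  δ-refl : ∀ {n} (i : Fin n) → δ i i ≡ 1ℚ
  δ-refl zero    = refl
  δ-refl (suc i) = δ-refl i

  δ-nonNeg : ∀ {n} (i j : Fin n) → 0ℚ ≤ δ i j
  δ-nonNeg zero    zero    = 0≤1
  δ-nonNeg zero    (suc _) = ≤-refl
  δ-nonNeg (suc _) zero    = ≤-refl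
  δ-nonNeg (suc i) (suc j) = δ-nonNeg i j

  -- Indicators and sums over lists

  -- Recursive rather than `+ n / 1`, so that `fromℕ (suc n)` unfolds to `1ℚ + fromℕ n`, as
  -- inductions and the ring solver require.
  fromℕ : ℕ → ℚ
  fromℕ zero    = 0ℚ
  fromℕ (suc n) = 1ℚ + fromℕ n

  fromℕ≡/1 : ∀ n → fromℕ n ≡ ℤ.+ n / 1
  fromℕ≡/1 zero    = refl
  fromℕ≡/1 (suc n) = begin
    1ℚ + fromℕ n                        ≡⟨ cong (1ℚ +_) (fromℕ≡/1 n) ⟩
    1ℚ + ℤ.+ n / 1                      ≡⟨ cong (1ℚ +_) (↥p/↧p≡p (mkℚ (ℤ.+ n) 0 c)) ⟩
    1ℚ + mkℚ (ℤ.+ n) 0 c                ≡⟨ cong (λ m → ((ℤ.+ 1) ℤ.+ m) / 1) (ℤ.*-identityʳ (ℤ.+ n)) ⟩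
    ℤ.+ suc n / 1                       ∎
    where
    open ≡-Reasoning
    c = ℕ.sym (ℕ.1-coprimeTo n)

  fromℕ-+ : ∀ m n → fromℕ (m ℕ.+ n) ≡ fromℕ m + fromℕ n
  fromℕ-+ zero    n = sym (+-identityˡ (fromℕ n))
  fromℕ-+ (suc m) n = trans (cong (1ℚ +_) (fromℕ-+ m n)) (sym (+-assoc 1ℚ (fromℕ m) (fromℕ n)))

  fromℕ-* : ∀ m n → fromℕ (m ℕ.* n) ≡ fromℕ m * fromℕ n
  fromℕ-* zero    n = sym (*-zeroˡ (fromℕ n))
  fromℕ-* (suc m) n = begin
    fromℕ (n ℕ.+ m ℕ.* n)               ≡⟨ fromℕ-+ n (m ℕ.* n) ⟩
    fromℕ n + fromℕ (m ℕ.* n)           ≡⟨ cong (fromℕ n +_) (fromℕ-* m n) ⟩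
    fromℕ n + fromℕ m * fromℕ n         ≡⟨ alg (fromℕ n) (fromℕ m) ⟩
    fromℕ (suc m) * fromℕ n             ∎
    where
    open ≡-Reasoning
    alg : ∀ n m → n + m * n ≡ (1ℚ + m) * n
    alg = solve-∀ ringℚ

  fromℕ-nonNeg : ∀ n → 0ℚ ≤ fromℕ n
  fromℕ-nonNeg zero    = ≤-refl
  fromℕ-nonNeg (suc n) = +-nonNeg 0≤1 (fromℕ-nonNeg n)

  fromℕ-mono : ∀ {m n} → m ℕ.≤ n → fromℕ m ≤ fromℕ n
  fromℕ-mono {n = n} z≤n = fromℕ-nonNeg n
  fromℕ-mono (s≤s m≤n) = +-monoʳ-≤ 1ℚ (fromℕ-mono m≤n)

  ⟦_⟧ : ∀ {p} {P : Set p} → Dec P → ℚ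
  ⟦ yes _ ⟧ = 1ℚ
  ⟦ no  _ ⟧ = 0ℚ

  ⟦⟧-bit : ∀ {p} {P : Set p} (P? : Dec P) → Bit ⟦ P? ⟧
  ⟦⟧-bit (yes _) = inj₂ refl
  ⟦⟧-bit (no  _) = inj₁ refl

  ⟦⟧-nonNeg : ∀ {p} {P : Set p} (P? : Dec P) → 0ℚ ≤ ⟦ P? ⟧
  ⟦⟧-nonNeg P? = bit-nonNeg (⟦⟧-bit P?)

  ⟦⟧-true : ∀ {p} {P : Set p} (P? : Dec P) → P → ⟦ P? ⟧ ≡ 1ℚ
  ⟦⟧-true (yes _) _ = refl
  ⟦⟧-true (no ¬p) p = contradiction p ¬p

  ⟦⟧-false : ∀ {p} {P : Set p} (P? : Dec P) → ¬ P → ⟦ P? ⟧ ≡ 0ℚ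
  ⟦⟧-false (yes p) ¬p = contradiction p ¬p
  ⟦⟧-false (no  _) _  = refl

  ⟦⟧-mono : ∀ {p q} {P : Set p} {Q : Set q} (P? : Dec P) (Q? : Dec Q) → (P → Q) → ⟦ P? ⟧ ≤ ⟦ Q? ⟧
  ⟦⟧-mono (yes p) Q? f = ≤-reflexive (sym (⟦⟧-true Q? (f p)))
  ⟦⟧-mono (no _)  Q? f = ⟦⟧-nonNeg Q?

  ⟦⟧-cong : ∀ {p q} {P : Set p} {Q : Set q} (P? : Dec P) (Q? : Dec Q) →
            (P → Q) → (Q → P) → ⟦ P? ⟧ ≡ ⟦ Q? ⟧
  ⟦⟧-cong P? Q? f g = ≤-antisym (⟦⟧-mono P? Q? f) (⟦⟧-mono Q? P? g)

  ⟦⟧-* : ∀ {p q r} {P : Set p} {Q : Set q} {R : Set r} (P? : Dec P) (Q? : Dec Q) (R? : Dec R) →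
         (P → Q → R) → (R → P × Q) → ⟦ P? ⟧ * ⟦ Q? ⟧ ≡ ⟦ R? ⟧
  ⟦⟧-* (yes p) (yes q) R? f g = sym (⟦⟧-true R? (f p q))
  ⟦⟧-* (yes p) (no ¬q) R? f g = sym (⟦⟧-false R? (¬q ∘ proj₂ ∘ g))
  ⟦⟧-* (no ¬p) (yes _) R? f g = sym (⟦⟧-false R? (¬p ∘ proj₁ ∘ g))
  ⟦⟧-* (no ¬p) (no _)  R? f g = sym (⟦⟧-false R? (¬p ∘ proj₁ ∘ g))

  ⟦⟧≡1⇒ : ∀ {p} {P : Set p} (P? : Dec P) → ⟦ P? ⟧ ≡ 1ℚ → P
  ⟦⟧≡1⇒ (yes p) _ = p

  ⟦⟧≡0⇒ : ∀ {p} {P : Set p} (P? : Dec P) → ⟦ P? ⟧ ≡ 0ℚ → ¬ P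
  ⟦⟧≡0⇒ (no ¬p) _ = ¬p

  module _ {a} {A : Set a} where

    ∑ₗ : List A → (A → ℚ) → ℚ
    ∑ₗ xs f = sumℚ (map f xs)

    ∑ₗ-cong : ∀ xs {f g : A → ℚ} → (∀ x → f x ≡ g x) → ∑ₗ xs f ≡ ∑ₗ xs g
    ∑ₗ-cong []       f≡g = refl
    ∑ₗ-cong (x ∷ xs) f≡g = cong₂ _+_ (f≡g x) (∑ₗ-cong xs f≡g)

    ∑ₗ-zero : ∀ xs {f : A → ℚ} → (∀ x → f x ≡ 0ℚ) → ∑ₗ xs f ≡ 0ℚ
    ∑ₗ-zero []       f≡0 = refl
    ∑ₗ-zero (x ∷ xs) f≡0 = cong₂ _+_ (f≡0 x) (∑ₗ-zero xs f≡0)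

    ∑ₗ-mono : ∀ xs {f g : A → ℚ} → (∀ {x} → x ∈ xs → f x ≤ g x) → ∑ₗ xs f ≤ ∑ₗ xs g
    ∑ₗ-mono []       f≤g = ≤-refl
    ∑ₗ-mono (x ∷ xs) f≤g = +-mono-≤ (f≤g (here refl)) (∑ₗ-mono xs (f≤g ∘ there))

    ∑ₗ-++ : ∀ xs ys (f : A → ℚ) → ∑ₗ (xs ++ ys) f ≡ ∑ₗ xs f + ∑ₗ ys f
    ∑ₗ-++ []       ys f = sym (+-identityˡ (∑ₗ ys f))
    ∑ₗ-++ (x ∷ xs) ys f = trans (cong (f x +_) (∑ₗ-++ xs ys f)) (sym (+-assoc (f x) (∑ₗ xs f) (∑ₗ ys f)))

    ∑ₗ-filter : ∀ {p} {P : Pred A p} (P? : Decidable P) xs (f : A → ℚ) →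
                ∑ₗ (filter P? xs) f ≡ ∑ₗ xs (λ x → ⟦ P? x ⟧ * f x)
    ∑ₗ-filter P? []       f = refl
    ∑ₗ-filter P? (x ∷ xs) f with P? x
    ... | yes _ = cong₂ _+_ (sym (*-identityˡ (f x))) (∑ₗ-filter P? xs f)
    ... | no  _ = trans (∑ₗ-filter P? xs f)
      (trans (sym (+-identityˡ _)) (cong (_+ ∑ₗ xs (λ x → ⟦ P? x ⟧ * f x)) (sym (*-zeroˡ (f x)))))

    ∑ₗ-lookup : ∀ xs (f : A → ℚ) → ∑ₗ xs f ≡ ∑[ i < length xs ] f (lookup xs i)
    ∑ₗ-lookup []       f = refl
    ∑ₗ-lookup (x ∷ xs) f = cong (f x +_) (∑ₗ-lookup xs f)

    ∑ₗ-const : ∀ (xs : List A) c → ∑ₗ xs (λ _ → c) ≡ fromℕ (length xs) * c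
    ∑ₗ-const []       c = sym (*-zeroˡ c)
    ∑ₗ-const (x ∷ xs) c = begin
      c + ∑ₗ xs (λ _ → c)           ≡⟨ cong (c +_) (∑ₗ-const xs c) ⟩
      c + fromℕ (length xs) * c     ≡⟨ alg c (fromℕ (length xs)) ⟩
      fromℕ (suc (length xs)) * c   ∎
      where
      open ≡-Reasoning
      alg : ∀ c x → c + x * c ≡ (1ℚ + x) * c
      alg = solve-∀ ringℚ

  ∑ₗ-map : ∀ {a b} {A : Set a} {B : Set b} (g : A → B) xs (f : B → ℚ) → ∑ₗ (map g xs) f ≡ ∑ₗ xs (f ∘ g)
  ∑ₗ-map g []       f = refl
  ∑ₗ-map g (x ∷ xs) f = cong (f (g x) +_) (∑ₗ-map g xs f)

  ∑ₗ-subsets : ∀ v {x y} (f : Subset (suc v) → ℚ) →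
               ∑ₗ (subsets v) (f ∘ (outside ∷_)) ≡ x → ∑ₗ (subsets v) (f ∘ (inside ∷_)) ≡ y →
               ∑ₗ (subsets (suc v)) f ≡ x + y
  ∑ₗ-subsets v f refl refl = trans (∑ₗ-++ (map (outside ∷_) (subsets v)) (map (inside ∷_) (subsets v)) f)
    (cong₂ _+_ (∑ₗ-map (outside ∷_) (subsets v) f) (∑ₗ-map (inside ∷_) (subsets v) f))

  -- Counting the subsets and supersets of a given set

  private
    ≟-suc : ∀ m n → ⟦ suc m ℕ.≟ suc n ⟧ ≡ ⟦ m ℕ.≟ n ⟧
    ≟-suc m n = ⟦⟧-cong (suc m ℕ.≟ suc n) (m ℕ.≟ n) ℕ.suc-injective (cong suc)

  count-subsets : ∀ {v} (S : Subset v) t →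
    ∑ₗ (subsets v) (λ T → ⟦ ∣ T ∣ ℕ.≟ t ⟧ * ⟦ T ⊆? S ⟧) ≡ fromℕ (∣ S ∣ C t)
  count-subsets [] zero    = refl
  count-subsets [] (suc t) = refl
  count-subsets {suc v} (outside ∷ S) t = begin
    ∑ₗ (subsets (suc v)) (λ T → ⟦ ∣ T ∣ ℕ.≟ t ⟧ * ⟦ T ⊆? outside ∷ S ⟧)
      ≡⟨ ∑ₗ-subsets v (λ T → ⟦ ∣ T ∣ ℕ.≟ t ⟧ * ⟦ T ⊆? outside ∷ S ⟧)
        (trans (∑ₗ-cong (subsets v) λ T → cong (⟦ ∣ T ∣ ℕ.≟ t ⟧ *_)
                 (⟦⟧-cong (outside ∷ T ⊆? outside ∷ S) (T ⊆? S) drop-∷-⊆ s⊆s))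
               (count-subsets S t))
        (∑ₗ-zero (subsets v) λ T → *-zeroʳ ⟦ suc ∣ T ∣ ℕ.≟ t ⟧) ⟩
    fromℕ (∣ S ∣ C t) + 0ℚ                    ≡⟨ +-identityʳ _ ⟩
    fromℕ (∣ S ∣ C t)                         ∎
    where open ≡-Reasoning
  count-subsets {suc v} (inside ∷ S) t = begin
    ∑ₗ (subsets (suc v)) (λ T → ⟦ ∣ T ∣ ℕ.≟ t ⟧ * ⟦ T ⊆? inside ∷ S ⟧)
      ≡⟨ ∑ₗ-subsets v (λ T → ⟦ ∣ T ∣ ℕ.≟ t ⟧ * ⟦ T ⊆? inside ∷ S ⟧)
        (trans (∑ₗ-cong (subsets v) λ T → cong (⟦ ∣ T ∣ ℕ.≟ t ⟧ *_)
                 (⟦⟧-cong (outside ∷ T ⊆? inside ∷ S) (T ⊆? S) drop-∷-⊆ out⊆))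
               (count-subsets S t))
        refl ⟩
    fromℕ (∣ S ∣ C t) + ∑ₗ (subsets v) (λ T → ⟦ suc ∣ T ∣ ℕ.≟ t ⟧ * ⟦ inside ∷ T ⊆? inside ∷ S ⟧) ≡⟨ go t ⟩
    fromℕ (suc ∣ S ∣ C t)                     ∎
    where
    open ≡-Reasoning
    go : ∀ t → fromℕ (∣ S ∣ C t) + ∑ₗ (subsets v) (λ T → ⟦ suc ∣ T ∣ ℕ.≟ t ⟧ * ⟦ inside ∷ T ⊆? inside ∷ S ⟧) ≡
               fromℕ (suc ∣ S ∣ C t)
    go zero    = trans (cong (1ℚ +_) (∑ₗ-zero (subsets v) λ T → *-zeroˡ ⟦ inside ∷ T ⊆? inside ∷ S ⟧)) refl
    go (suc t) = begin
      fromℕ (∣ S ∣ C suc t) + ∑ₗ (subsets v) (λ T → ⟦ suc ∣ T ∣ ℕ.≟ suc t ⟧ * ⟦ inside ∷ T ⊆? inside ∷ S ⟧)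
        ≡⟨ cong (fromℕ (∣ S ∣ C suc t) +_) (trans (∑ₗ-cong (subsets v) λ T →
             cong₂ _*_ (≟-suc ∣ T ∣ t) (⟦⟧-cong (inside ∷ T ⊆? inside ∷ S) (T ⊆? S) drop-∷-⊆ s⊆s)) (count-subsets S t)) ⟩
      fromℕ (∣ S ∣ C suc t) + fromℕ (∣ S ∣ C t)
        ≡⟨ +-comm (fromℕ (∣ S ∣ C suc t)) (fromℕ (∣ S ∣ C t)) ⟩
      fromℕ (∣ S ∣ C t) + fromℕ (∣ S ∣ C suc t)
        ≡⟨ fromℕ-+ (∣ S ∣ C t) (∣ S ∣ C suc t) ⟨
      fromℕ (∣ S ∣ C t ℕ.+ ∣ S ∣ C suc t)
        ≡⟨ cong fromℕ (nCk+nC[k+1]≡[n+1]C[k+1] ∣ S ∣ t) ⟩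
      fromℕ (suc ∣ S ∣ C suc t) ∎

  -- The size is written as `∣ S ∣ ℕ.+ j` because only the j elements taken from the complement are
  -- free; Pascal's rule then applies to `∣ ∁ S ∣ C j` along S.
  count-supersets : ∀ {v} (S : Subset v) j →
    ∑ₗ (subsets v) (λ B → ⟦ ∣ B ∣ ℕ.≟ ∣ S ∣ ℕ.+ j ⟧ * ⟦ S ⊆? B ⟧) ≡ fromℕ (∣ ∁ S ∣ C j)
  count-supersets [] zero    = refl
  count-supersets [] (suc j) = refl
  count-supersets {suc v} (inside ∷ S) j = begin
    ∑ₗ (subsets (suc v)) (λ B → ⟦ ∣ B ∣ ℕ.≟ suc (∣ S ∣ ℕ.+ j) ⟧ * ⟦ inside ∷ S ⊆? B ⟧)
      ≡⟨ ∑ₗ-subsets v (λ B → ⟦ ∣ B ∣ ℕ.≟ suc (∣ S ∣ ℕ.+ j) ⟧ * ⟦ inside ∷ S ⊆? B ⟧)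
        (∑ₗ-zero (subsets v) λ T → *-zeroʳ ⟦ ∣ T ∣ ℕ.≟ suc (∣ S ∣ ℕ.+ j) ⟧)
        (trans (∑ₗ-cong (subsets v) λ T → cong₂ _*_ (≟-suc ∣ T ∣ (∣ S ∣ ℕ.+ j))
                 (⟦⟧-cong (inside ∷ S ⊆? inside ∷ T) (S ⊆? T) drop-∷-⊆ s⊆s))
               (count-supersets S j)) ⟩
    0ℚ + fromℕ (∣ ∁ S ∣ C j)                  ≡⟨ +-identityˡ _ ⟩
    fromℕ (∣ ∁ S ∣ C j)                       ∎
    where open ≡-Reasoning
  count-supersets {suc v} (outside ∷ S) j = begin
    ∑ₗ (subsets (suc v)) (λ B → ⟦ ∣ B ∣ ℕ.≟ ∣ S ∣ ℕ.+ j ⟧ * ⟦ outside ∷ S ⊆? B ⟧)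
      ≡⟨ ∑ₗ-subsets v (λ B → ⟦ ∣ B ∣ ℕ.≟ ∣ S ∣ ℕ.+ j ⟧ * ⟦ outside ∷ S ⊆? B ⟧)
        (trans (∑ₗ-cong (subsets v) λ T → cong (⟦ ∣ T ∣ ℕ.≟ ∣ S ∣ ℕ.+ j ⟧ *_)
                 (⟦⟧-cong (outside ∷ S ⊆? outside ∷ T) (S ⊆? T) drop-∷-⊆ s⊆s))
               (count-supersets S j))
        (∑ₗ-cong (subsets v) λ T → cong (⟦ suc ∣ T ∣ ℕ.≟ ∣ S ∣ ℕ.+ j ⟧ *_)
                 (⟦⟧-cong (outside ∷ S ⊆? inside ∷ T) (S ⊆? T) drop-∷-⊆ out⊆)) ⟩
    fromℕ (∣ ∁ S ∣ C j) + ∑ₗ (subsets v) (λ T → ⟦ suc ∣ T ∣ ℕ.≟ ∣ S ∣ ℕ.+ j ⟧ * ⟦ S ⊆? T ⟧)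
      ≡⟨ go j ⟩
    fromℕ (suc ∣ ∁ S ∣ C j)                   ∎
    where
    open ≡-Reasoning
    go : ∀ j → fromℕ (∣ ∁ S ∣ C j) + ∑ₗ (subsets v) (λ T → ⟦ suc ∣ T ∣ ℕ.≟ ∣ S ∣ ℕ.+ j ⟧ * ⟦ S ⊆? T ⟧) ≡
               fromℕ (suc ∣ ∁ S ∣ C j)
    go zero    = trans (cong (1ℚ +_) (∑ₗ-zero (subsets v) λ T → none T (suc ∣ T ∣ ℕ.≟ ∣ S ∣ ℕ.+ 0) (S ⊆? T))) refl
      where
      none : ∀ T (p : Dec (suc ∣ T ∣ ≡ ∣ S ∣ ℕ.+ 0)) (q : Dec (S ⊆ T)) → ⟦ p ⟧ * ⟦ q ⟧ ≡ 0ℚ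
      none T (no _)   q         = *-zeroˡ ⟦ q ⟧
      none T (yes _)  (no _)    = refl
      none T (yes eq) (yes S⊆T) = contradiction (trans eq (ℕ.+-identityʳ ∣ S ∣))
        (ℕ.<⇒≢ (s≤s (p⊆q⇒∣p∣≤∣q∣ S⊆T)) ∘ sym)
    go (suc j) = begin
      fromℕ (∣ ∁ S ∣ C suc j) + ∑ₗ (subsets v) (λ T → ⟦ suc ∣ T ∣ ℕ.≟ ∣ S ∣ ℕ.+ suc j ⟧ * ⟦ S ⊆? T ⟧)
        ≡⟨ cong (fromℕ (∣ ∁ S ∣ C suc j) +_) (trans (∑ₗ-cong (subsets v) λ T →
             cong (_* ⟦ S ⊆? T ⟧) (trans (cong (λ m → ⟦ suc ∣ T ∣ ℕ.≟ m ⟧) (ℕ.+-suc ∣ S ∣ j)) (≟-suc ∣ T ∣ (∣ S ∣ ℕ.+ j))))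
             (count-supersets S j)) ⟩
      fromℕ (∣ ∁ S ∣ C suc j) + fromℕ (∣ ∁ S ∣ C j)
        ≡⟨ +-comm (fromℕ (∣ ∁ S ∣ C suc j)) (fromℕ (∣ ∁ S ∣ C j)) ⟩
      fromℕ (∣ ∁ S ∣ C j) + fromℕ (∣ ∁ S ∣ C suc j)
        ≡⟨ fromℕ-+ (∣ ∁ S ∣ C j) (∣ ∁ S ∣ C suc j) ⟨
      fromℕ (∣ ∁ S ∣ C j ℕ.+ ∣ ∁ S ∣ C suc j)
        ≡⟨ cong fromℕ (nCk+nC[k+1]≡[n+1]C[k+1] ∣ ∁ S ∣ j) ⟩
      fromℕ (suc ∣ ∁ S ∣ C suc j) ∎

  -- The hypergraph of t-sets and k-sets

  subsets-unique : ∀ v → Unique (subsets v)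
  subsets-unique zero    = All.[] ∷ []
  subsets-unique (suc v) = Unique.++⁺ (Unique.map⁺ Vec.∷-injectiveʳ (subsets-unique v))
    (Unique.map⁺ Vec.∷-injectiveʳ (subsets-unique v)) disjoint
    where
    disjoint : ∀ {S} → S ∈ map (outside ∷_) (subsets v) × S ∈ map (inside ∷_) (subsets v) → ⊥
    disjoint (p , q) with ∈-map⁻ (outside ∷_) p | ∈-map⁻ (inside ∷_) q
    ... | _ , _ , refl | _ , _ , ()

  subsetsOfSize-unique : ∀ v m → Unique (subsetsOfSize v m)
  subsetsOfSize-unique v m = Unique.filter⁺ (λ S → ∣ S ∣ ℕ.≟ m) (subsets-unique v)

  lookup-injective : ∀ {a} {A : Set a} {xs : List A} → Unique xs → ∀ i j → lookup xs i ≡ lookup xs j → i ≡ j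
  lookup-injective (_  ∷ _) zero    zero    _  = refl
  lookup-injective (x≢ ∷ _) zero    (suc j) eq = contradiction eq (All.lookup x≢ (∈-lookup j))
  lookup-injective (x≢ ∷ _) (suc i) zero    eq = contradiction (sym eq) (All.lookup x≢ (∈-lookup i))
  lookup-injective (_  ∷ u) (suc i) (suc j) eq = cong suc (lookup-injective u i j eq)

  subsetsOfSize-size : ∀ v m {S} → S ∈ subsetsOfSize v m → ∣ S ∣ ≡ m
  subsetsOfSize-size v m = All.lookup (all-filter (λ S → ∣ S ∣ ℕ.≟ m) (subsets v))

  ⊆∧∣∣≤⇒≡ : ∀ {v} (p q : Subset v) → p ⊆ q → ∣ q ∣ ℕ.≤ ∣ p ∣ → p ≡ q
  ⊆∧∣∣≤⇒≡ []            []            _   _ = refl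
  ⊆∧∣∣≤⇒≡ (outside ∷ p) (outside ∷ q) p⊆q l = cong (outside ∷_) (⊆∧∣∣≤⇒≡ p q (drop-∷-⊆ p⊆q) l)
  ⊆∧∣∣≤⇒≡ (inside  ∷ p) (inside  ∷ q) p⊆q (s≤s l) = cong (inside ∷_) (⊆∧∣∣≤⇒≡ p q (drop-∷-⊆ p⊆q) l)
  ⊆∧∣∣≤⇒≡ (outside ∷ p) (inside  ∷ q) p⊆q l =
    contradiction (ℕ.≤-trans l (p⊆q⇒∣p∣≤∣q∣ (drop-∷-⊆ p⊆q))) (ℕ.n≮n ∣ q ∣)
  ⊆∧∣∣≤⇒≡ (inside  ∷ p) (outside ∷ q) p⊆q l with p⊆q Vec.here
  ... | ()

  -- Supplies the ratio (j + 1) / (w + 1) of codegree to degree, in a form without division.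
  absorption : ∀ n k → suc n ℕ.* (n C k) ≡ suc k ℕ.* (suc n C suc k)
  absorption zero    zero    = refl
  absorption zero    (suc k) = sym (ℕ.*-zeroʳ (suc (suc k)))
  absorption (suc m) zero    = trans (ℕ.*-identityʳ (suc (suc m))) (trans (sym (nC1≡n (suc (suc m)))) (sym (ℕ.+-identityʳ _)))
  absorption (suc m) (suc j) = begin
    suc (suc m) ℕ.* (suc m C suc j)
      ≡⟨ cong (suc (suc m) ℕ.*_) (nCk+nC[k+1]≡[n+1]C[k+1] m j) ⟨
    suc (suc m) ℕ.* (a ℕ.+ b)
      ≡⟨ alg₁ m a b ⟩
    suc m ℕ.* a ℕ.+ suc m ℕ.* b ℕ.+ (a ℕ.+ b)
      ≡⟨ cong₂ (λ x y → x ℕ.+ y ℕ.+ (a ℕ.+ b)) (trans (absorption m j) (cong (suc j ℕ.*_) (sym (nCk+nC[k+1]≡[n+1]C[k+1] m j))))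
           (trans (absorption m (suc j)) (cong (suc (suc j) ℕ.*_) (sym (nCk+nC[k+1]≡[n+1]C[k+1] m (suc j))))) ⟩
    suc j ℕ.* (a ℕ.+ b) ℕ.+ suc (suc j) ℕ.* (b ℕ.+ c) ℕ.+ (a ℕ.+ b)
      ≡⟨ alg₂ j a b c ⟩
    suc (suc j) ℕ.* ((a ℕ.+ b) ℕ.+ (b ℕ.+ c))
      ≡⟨ cong (suc (suc j) ℕ.*_) (trans (cong₂ ℕ._+_ (nCk+nC[k+1]≡[n+1]C[k+1] m j) (nCk+nC[k+1]≡[n+1]C[k+1] m (suc j)))
           (nCk+nC[k+1]≡[n+1]C[k+1] (suc m) (suc j))) ⟩
    suc (suc j) ℕ.* (suc (suc m) C suc (suc j)) ∎
    where
    open ≡-Reasoning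
    a = m C j
    b = m C suc j
    c = m C suc (suc j)
    alg₁ : ∀ m a b → suc (suc m) ℕ.* (a ℕ.+ b) ≡ suc m ℕ.* a ℕ.+ suc m ℕ.* b ℕ.+ (a ℕ.+ b)
    alg₁ = ℕ-solve-∀
    alg₂ : ∀ j a b c → suc j ℕ.* (a ℕ.+ b) ℕ.+ suc (suc j) ℕ.* (b ℕ.+ c) ℕ.+ (a ℕ.+ b) ≡
           suc (suc j) ℕ.* ((a ℕ.+ b) ℕ.+ (b ℕ.+ c))
    alg₂ = ℕ-solve-∀

  C-pos : ∀ {n k} → k ℕ.≤ n → 1 ℕ.≤ n C k
  C-pos {n}     {zero}  _         = ℕ.≤-refl
  C-pos {suc n} {suc k} (s≤s k≤n) = subst (1 ℕ.≤_) (nCk+nC[k+1]≡[n+1]C[k+1] n k)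
    (ℕ.≤-trans (C-pos k≤n) (ℕ.m≤m+n (n C k) (n C suc k)))

  ∑ₗ-subsetsOf : ∀ {v} (S : Subset v) t → ∑ₗ (subsetsOfSize v t) (λ T → ⟦ T ⊆? S ⟧) ≡ fromℕ (∣ S ∣ C t)
  ∑ₗ-subsetsOf {v} S t = trans (∑ₗ-filter (λ T → ∣ T ∣ ℕ.≟ t) (subsets v) (λ T → ⟦ T ⊆? S ⟧)) (count-subsets S t)

  -- Here j = k - t - 1 and w = v - t - 1. A t-set then lies in C(w+1, j+1) edges and a (t+1)-set in
  -- C(w, j), a fraction (j+1)/(w+1) of the degree that tends to 0 with growing v.
  module Hypergraph (v k t j w : ℕ) (k≡t+1+j : k ≡ t ℕ.+ suc j) (v≡t+1+w : v ≡ t ℕ.+ suc w) where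

    n M : ℕ
    n = length (subsetsOfSize v t)
    M = length (subsetsOfSize v k)

    vertex : Fin n → Subset v
    vertex = lookup (subsetsOfSize v t)

    edge : Fin M → Subset v
    edge = lookup (subsetsOfSize v k)

    ∣vertex∣ : ∀ T → ∣ vertex T ∣ ≡ t
    ∣vertex∣ T = subsetsOfSize-size v t (∈-lookup T)

    ∣edge∣ : ∀ e → ∣ edge e ∣ ≡ k
    ∣edge∣ e = subsetsOfSize-size v k (∈-lookup e)

    b : Fin n → Fin M → ℚ
    b T e = ⟦ vertex T ⊆? edge e ⟧

    Q D : ℚ
    Q = fromℕ (k C t)
    D = fromℕ (suc w C suc j)

    b-bit : ∀ T e → Bit (b T e)
    b-bit T e = ⟦⟧-bit (vertex T ⊆? edge e)

    ∑-⊆ : ∀ (S : Subset v) → ∑[ T < n ] ⟦ vertex T ⊆? S ⟧ ≡ fromℕ (∣ S ∣ C t)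
    ∑-⊆ S = trans (sym (∑ₗ-lookup (subsetsOfSize v t) (λ T → ⟦ T ⊆? S ⟧))) (∑ₗ-subsetsOf S t)

    ∑-⊇ : ∀ (S : Subset v) i → k ≡ ∣ S ∣ ℕ.+ i → ∑[ e < M ] ⟦ S ⊆? edge e ⟧ ≡ fromℕ ((v ∸ ∣ S ∣) C i)
    ∑-⊇ S i k≡ = begin
      ∑[ e < M ] ⟦ S ⊆? edge e ⟧                                       ≡⟨ ∑ₗ-lookup (subsetsOfSize v k) (λ B → ⟦ S ⊆? B ⟧) ⟨
      ∑ₗ (subsetsOfSize v k) (λ B → ⟦ S ⊆? B ⟧)                        ≡⟨ ∑ₗ-filter (λ B → ∣ B ∣ ℕ.≟ k) (subsets v) (λ B → ⟦ S ⊆? B ⟧) ⟩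
      ∑ₗ (subsets v) (λ B → ⟦ ∣ B ∣ ℕ.≟ k ⟧ * ⟦ S ⊆? B ⟧)              ≡⟨ cong (λ m → ∑ₗ (subsets v) (λ B → ⟦ ∣ B ∣ ℕ.≟ m ⟧ * ⟦ S ⊆? B ⟧)) k≡ ⟩
      ∑ₗ (subsets v) (λ B → ⟦ ∣ B ∣ ℕ.≟ ∣ S ∣ ℕ.+ i ⟧ * ⟦ S ⊆? B ⟧)    ≡⟨ count-supersets S i ⟩
      fromℕ (∣ ∁ S ∣ C i)                                              ≡⟨ cong (λ m → fromℕ (m C i)) (∣∁p∣≡n∸∣p∣ S) ⟩
      fromℕ ((v ∸ ∣ S ∣) C i)                                          ∎
      where open ≡-Reasoning

    edge-size : ∀ e → ∑[ T < n ] b T e ≡ Q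
    edge-size e = trans (∑-⊆ (edge e)) (cong (λ m → fromℕ (m C t)) (∣edge∣ e))

    v∸t : ∀ {m} → m ≡ t → v ∸ m ≡ suc w
    v∸t refl = trans (cong (_∸ t) v≡t+1+w) (ℕ.m+n∸m≡n t (suc w))

    degree : ∀ T → ∑[ e < M ] b T e ≡ D
    degree T = trans (∑-⊇ (vertex T) (suc j) (trans k≡t+1+j (cong (ℕ._+ suc j) (sym (∣vertex∣ T)))))
      (cong (λ m → fromℕ (m C suc j)) (v∸t (∣vertex∣ T)))

    pair-count : ∀ (S : Subset v) → ∣ S ∣ ≡ suc t → ∑[ e < M ] ⟦ S ⊆? edge e ⟧ ≡ fromℕ (w C j)
    pair-count S eq = trans (∑-⊇ S j (trans k≡t+1+j (trans (ℕ.+-suc t j) (cong (ℕ._+ j) (sym eq)))))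
      (cong (λ m → fromℕ (m C j)) (trans (cong₂ _∸_ (trans v≡t+1+w (ℕ.+-suc t w)) eq) (ℕ.m+n∸m≡n t w)))


    vertex-injective : ∀ {T T′} → vertex T ≡ vertex T′ → T ≡ T′
    vertex-injective = lookup-injective (subsetsOfSize-unique v t) _ _

    -- If the union had at most t elements, both t-sets would be equal to it. Passing from the
    -- union, whose size varies, to a (t+1)-subset bounds all codegrees by a single count.
    distinct-pair : ∀ {T T′} → T ≢ T′ → ∃[ S ] ∣ S ∣ ≡ suc t × (∀ {B} → vertex T ⊆ B → vertex T′ ⊆ B → S ⊆ B)
    distinct-pair {T} {T′} T≢T′ with shrink (suc t) (p ∪ q) large
      where
      p = vertex T
      q = vertex T′
      large : suc t ℕ.≤ ∣ p ∪ q ∣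
      large = ℕ.≰⇒> λ small → T≢T′ (vertex-injective (trans
        (⊆∧∣∣≤⇒≡ p (p ∪ q) (p⊆p∪q q) (ℕ.≤-trans small (ℕ.≤-reflexive (sym (∣vertex∣ T)))))
        (sym (⊆∧∣∣≤⇒≡ q (p ∪ q) (q⊆p∪q p q) (ℕ.≤-trans small (ℕ.≤-reflexive (sym (∣vertex∣ T′))))))))
    ... | S , S⊆p∪q , ∣S∣ = S , ∣S∣ , λ p⊆B q⊆B x∈S → [ p⊆B , q⊆B ]′ (x∈p∪q⁻ (vertex T) (vertex T′) (S⊆p∪q x∈S))

    1≤D : w ℕ.≥ j → 1ℚ ≤ D
    1≤D j≤w = fromℕ-mono (C-pos (s≤s j≤w))

    -- The term with `δ` admits the diagonal, where the codegree is the degree, so that later sums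
    -- over all pairs of vertices need no case distinction.
    codegree : ∀ ρ → fromℕ (suc j) ≤ ρ * fromℕ (suc w) → 0ℚ ≤ ρ →
               ∀ T T′ → ∑[ e < M ] (b T e * b T′ e) ≤ ρ * D + D * δ T T′
    codegree ρ j≤ρw 0≤ρ T T′ with T Fin.≟ T′
    ... | yes refl = begin
      ∑[ e < M ] (b T e * b T e)   ≡⟨ sum-cong-≗ (λ e → bit-idem (b-bit T e)) ⟩
      ∑[ e < M ] b T e             ≡⟨ degree T ⟩
      D                            ≤⟨ ≤-excess (ρ * D) (alg D (ρ * D)) (*-nonNeg 0≤ρ (fromℕ-nonNeg (suc w C suc j))) ⟩
      ρ * D + D * 1ℚ               ≡⟨ cong (λ x → ρ * D + D * x) (δ-refl T) ⟨
      ρ * D + D * δ T T            ∎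
      where
      open ≤-Reasoning
      alg : ∀ D x → D + x ≡ x + D * 1ℚ
      alg = solve-∀ ringℚ
    ... | no T≢T′ with distinct-pair T≢T′
    ...   | S , ∣S∣ , S⊆ = begin
      ∑[ e < M ] (b T e * b T′ e)  ≤⟨ ∑-mono (λ e → both (vertex T ⊆? edge e) (vertex T′ ⊆? edge e) (S ⊆? edge e) S⊆) ⟩
      ∑[ e < M ] ⟦ S ⊆? edge e ⟧   ≡⟨ pair-count S ∣S∣ ⟩
      fromℕ (w C j)                ≤⟨ *-cancelˡ-≤-pos (fromℕ (suc w)) {{positive 0<w}} (begin
          fromℕ (suc w) * fromℕ (w C j)                ≡⟨ fromℕ-* (suc w) (w C j) ⟨
          fromℕ (suc w ℕ.* (w C j))                    ≡⟨ cong fromℕ (absorption w j) ⟩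
          fromℕ (suc j ℕ.* (suc w C suc j))            ≡⟨ fromℕ-* (suc j) (suc w C suc j) ⟩
          fromℕ (suc j) * D                            ≤⟨ *-monoʳ-≤ (fromℕ-nonNeg (suc w C suc j)) j≤ρw ⟩
          ρ * fromℕ (suc w) * D                        ≡⟨ alg ρ (fromℕ (suc w)) D ⟩
          fromℕ (suc w) * (ρ * D)                      ∎) ⟩
      ρ * D                        ≤⟨ ≤-excess (D * δ T T′) refl (*-nonNeg (fromℕ-nonNeg (suc w C suc j)) (δ-nonNeg T T′)) ⟩
      ρ * D + D * δ T T′           ∎
      where
      open ≤-Reasoning
      alg : ∀ r w D → r * w * D ≡ w * (r * D)
      alg = solve-∀ ringℚ
      0<w : 0ℚ < fromℕ (suc w)
      0<w = <-≤-trans (positive⁻¹ 1ℚ) (≤-excess (fromℕ w) refl (fromℕ-nonNeg w))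
      both : ∀ {P Q R : Set} (P? : Dec P) (Q? : Dec Q) (R? : Dec R) → (P → Q → R) → ⟦ P? ⟧ * ⟦ Q? ⟧ ≤ ⟦ R? ⟧
      both (yes p) (yes q) R? f = ≤-reflexive (sym (⟦⟧-true R? (f p q)))
      both (yes _) (no _)  R? f = ⟦⟧-nonNeg R?
      both (no _)  (yes _) R? f = ⟦⟧-nonNeg R?
      both (no _)  (no _)  R? f = ⟦⟧-nonNeg R?

  -- One step of the greedy process in a regular hypergraph

  record RegularHypergraph (n M : ℕ) : Set where
    field
      b         : Fin n → Fin M → ℚ
      Q D κ     : ℚ
      b-bit     : ∀ T e → Bit (b T e)
      1≤Q       : 1ℚ ≤ Q
      0≤D       : 0ℚ ≤ D
      0≤κ       : 0ℚ ≤ κ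
      edge-size : ∀ e → ∑[ T < n ] b T e ≡ Q
      degree    : ∀ T → ∑[ e < M ] b T e ≡ D
      codegree  : ∀ T T′ → ∑[ e < M ] (b T e * b T′ e) ≤ κ + D * δ T T′

  -- u marks the vertices not yet covered, a the edges all of whose vertices are uncovered, and m the
  -- pairs of edges that share a vertex.
  record State {n M : ℕ} (𝓗 : RegularHypergraph n M) : Set where
    open RegularHypergraph 𝓗
    field
      u     : Fin n → ℚ
      a     : Fin M → ℚ
      m     : Fin M → Fin M → ℚ
      u-bit : ∀ T → Bit (u T)
      a-bit : ∀ e → Bit (a e)
      m-bit : ∀ f e → Bit (m f e)
      a⇒u   : ∀ T f → a f * b T f ≡ a f * b T f * u T
      apart : ∀ f e → m f e ≡ 0ℚ → ∀ T → b T f * b T e ≡ 0ℚ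
      meet  : ∀ f e → m f e ≡ 1ℚ → ∃[ T ] b T f * b T e ≡ 1ℚ

  module Regular {n M : ℕ} (𝓗 : RegularHypergraph n M) where

    open RegularHypergraph 𝓗

    private
      0≤Q : 0ℚ ≤ Q
      0≤Q = ≤-trans 0≤1 1≤Q

      0≤b : ∀ T e → 0ℚ ≤ b T e
      0≤b T e = bit-nonNeg (b-bit T e)

    common : Fin M → Fin M → ℚ
    common f e = ∑[ T < n ] (b T f * b T e)

    ∑-codegree : ∀ T′ f → ∑[ T < n ] (b T f * ∑[ e < M ] (b T e * b T′ e)) ≤ Q * κ + D * b T′ f
    ∑-codegree T′ f = begin
      ∑[ T < n ] (b T f * ∑[ e < M ] (b T e * b T′ e))
        ≤⟨ ∑-mono (λ T → *-monoˡ-≤ (0≤b T f) (≤-trans (≤-reflexive (sum-cong-≗ λ e → *-comm (b T e) (b T′ e))) (codegree T′ T))) ⟩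
      ∑[ T < n ] (b T f * (κ + D * δ T′ T))
        ≡⟨ sum-cong-≗ (λ T → alg (b T f) κ D (δ T′ T)) ⟩
      ∑[ T < n ] (b T f * κ + D * (δ T′ T * b T f))
        ≡⟨ ∑-linear D (λ T → b T f * κ) (λ T → δ T′ T * b T f) ⟩
      ∑[ T < n ] (b T f * κ) + D * ∑[ T < n ] (δ T′ T * b T f)
        ≡⟨ cong₂ (λ x y → x + D * y) (sym (*-distribʳ-sum κ (λ T → b T f))) (∑-δ T′ (λ T → b T f)) ⟩
      (∑[ T < n ] b T f) * κ + D * b T′ f
        ≡⟨ cong (λ x → x * κ + D * b T′ f) (edge-size f) ⟩
      Q * κ + D * b T′ f ∎
      where
      open ≤-Reasoning
      alg : ∀ x k d e → x * (k + d * e) ≡ x * k + d * (e * x)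
      alg = solve-∀ ringℚ

    ∑-common : ∀ f → ∑[ e < M ] common f e ≡ Q * D
    ∑-common f = begin
      ∑[ e < M ] ∑[ T < n ] (b T f * b T e) ≡⟨ ∑-comm (λ e T → b T f * b T e) ⟩
      ∑[ T < n ] ∑[ e < M ] (b T f * b T e) ≡⟨ sum-cong-≗ (λ T → trans (sym (*-distribˡ-sum (b T f) (b T))) (cong (b T f *_) (degree T))) ⟩
      ∑[ T < n ] (b T f * D)                ≡⟨ *-distribʳ-sum D (λ T → b T f) ⟨
      (∑[ T < n ] b T f) * D                ≡⟨ cong (_* D) (edge-size f) ⟩
      Q * D ∎
      where open ≡-Reasoning

    ∑-common² : ∀ f → ∑[ e < M ] (common f e * common f e) ≤ Q * (Q * κ) + Q * D
    ∑-common² f = begin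
      ∑[ e < M ] (common f e * common f e)
        ≡⟨ ∑-swap (common f) (λ T → b T f) (λ e T → b T e) ⟩
      ∑[ T < n ] (b T f * ∑[ e < M ] (common f e * b T e))
        ≤⟨ ∑-mono (λ T → *-monoˡ-≤ (0≤b T f) (inner T)) ⟩
      ∑[ T < n ] (b T f * (Q * κ + D * 1ℚ))
        ≡⟨ *-distribʳ-sum (Q * κ + D * 1ℚ) (λ T → b T f) ⟨
      (∑[ T < n ] b T f) * (Q * κ + D * 1ℚ)
        ≡⟨ cong (_* (Q * κ + D * 1ℚ)) (edge-size f) ⟩
      Q * (Q * κ + D * 1ℚ)
        ≡⟨ alg Q κ D ⟩
      Q * (Q * κ) + Q * D ∎
      where
      open ≤-Reasoning
      alg : ∀ q k d → q * (q * k + d * 1ℚ) ≡ q * (q * k) + q * d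
      alg = solve-∀ ringℚ
      inner : ∀ T → ∑[ e < M ] (common f e * b T e) ≤ Q * κ + D * 1ℚ
      inner T = begin
        ∑[ e < M ] (common f e * b T e)
          ≡⟨ sum-cong-≗ (λ e → *-comm (common f e) (b T e)) ⟩
        ∑[ e < M ] (b T e * common f e)
          ≡⟨ ∑-swap (b T) (λ T′ → b T′ f) (λ e T′ → b T′ e) ⟩
        ∑[ T′ < n ] (b T′ f * ∑[ e < M ] (b T e * b T′ e))
          ≡⟨ sum-cong-≗ (λ T′ → cong (b T′ f *_) (sum-cong-≗ λ e → *-comm (b T e) (b T′ e))) ⟩
        ∑[ T′ < n ] (b T′ f * ∑[ e < M ] (b T′ e * b T e))
          ≤⟨ ∑-codegree T f ⟩
        Q * κ + D * b T f
          ≤⟨ +-monoʳ-≤ (Q * κ) (*-monoˡ-≤ 0≤D (bit≤1 (b-bit T f))) ⟩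
        Q * κ + D * 1ℚ ∎

    -- `∑-common²` counts pairs of vertices of f together with the edges through both. The diagonal
    -- pairs contribute Q D, which is exactly the sum of `common f`. Only distinct pairs are left,
    -- so edges meeting f in two or more vertices are rare.
    ∑-excess : ∀ f → ∑[ e < M ] (common f e * common f e - common f e) ≤ Q * (Q * κ)
    ∑-excess f = begin
      ∑[ e < M ] (common f e * common f e - common f e)
        ≡⟨ ∑-distrib-- (λ e → common f e * common f e) (common f) ⟩
      ∑[ e < M ] (common f e * common f e) - sum (common f)
        ≤⟨ +-mono-≤ (∑-common² f) (≤-reflexive (cong -_ (∑-common f))) ⟩
      Q * (Q * κ) + Q * D - Q * D
        ≡⟨ alg (Q * (Q * κ)) (Q * D) ⟩
      Q * (Q * κ) ∎
      where
      open ≤-Reasoning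
      alg : ∀ x y → x + y - y ≡ x
      alg = solve-∀ ringℚ

    -- Counts the incidences of the edges at T in two ways. It bounds N from below, which is what
    -- makes both the decrease of the target and the fraction covered by a single block of order ρ.
    degree≤ : Fin n → (Q - 1ℚ) * D ≤ (∑[ T < n ] 1ℚ) * κ
    degree≤ T = ≤-excess (N * κ - (Q - 1ℚ) * D) (alg ((Q - 1ℚ) * D) (N * κ)) (≤-trans (difference≥0 le) (≤-reflexive (alg₂ N κ D Q)))
      where
      N = ∑[ T < n ] 1ℚ
      open ≤-Reasoning
      alg : ∀ x y → x + (y - x) ≡ y
      alg = solve-∀ ringℚ
      alg₂ : ∀ N κ d q → N * κ + d * 1ℚ - d * q ≡ N * κ - (q - 1ℚ) * d
      alg₂ = solve-∀ ringℚ
      alg₃ : ∀ k d e → k + d * e ≡ 1ℚ * k + d * (e * 1ℚ)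
      alg₃ = solve-∀ ringℚ
      le : D * Q ≤ N * κ + D * 1ℚ
      le = begin
        D * Q ≡⟨ cong (_* Q) (degree T) ⟨
        (∑[ e < M ] b T e) * Q
          ≡⟨ *-distribʳ-sum Q (b T) ⟩
        ∑[ e < M ] (b T e * Q)
          ≡⟨ sum-cong-≗ (λ e → cong (b T e *_) (trans (sym (edge-size e)) (sum-cong-≗ λ T′ → sym (*-identityˡ (b T′ e))))) ⟩
        ∑[ e < M ] (b T e * ∑[ T′ < n ] (1ℚ * b T′ e))
          ≡⟨ ∑-swap (b T) (λ _ → 1ℚ) (λ e T′ → b T′ e) ⟩
        ∑[ T′ < n ] (1ℚ * ∑[ e < M ] (b T e * b T′ e))
          ≡⟨ sum-cong-≗ (λ T′ → *-identityˡ (∑[ e < M ] (b T e * b T′ e))) ⟩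
        ∑[ T′ < n ] (∑[ e < M ] (b T e * b T′ e))
          ≤⟨ ∑-mono (codegree T) ⟩
        ∑[ T′ < n ] (κ + D * δ T T′)
          ≡⟨ sum-cong-≗ (λ T′ → alg₃ κ D (δ T T′)) ⟩
        ∑[ T′ < n ] (1ℚ * κ + D * (δ T T′ * 1ℚ))
          ≡⟨ ∑-linear D (λ _ → 1ℚ * κ) (λ T′ → δ T T′ * 1ℚ) ⟩
        ∑[ T′ < n ] (1ℚ * κ) + D * ∑[ T′ < n ] (δ T T′ * 1ℚ)
          ≡⟨ cong₂ (λ x y → x + D * y) (sym (*-distribʳ-sum {n} κ (λ _ → 1ℚ))) (∑-δ T (λ _ → 1ℚ)) ⟩
        N * κ + D * 1ℚ ∎

    -- Edges lost when a selectable edge is chosen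

    module Step (𝓢 : State 𝓗) where

      open State 𝓢

      private
        0≤a : ∀ f → 0ℚ ≤ a f
        0≤a f = bit-nonNeg (a-bit f)
        0≤u : ∀ T → 0ℚ ≤ u T
        0≤u T = bit-nonNeg (u-bit T)
        0≤bb : ∀ f e T → 0ℚ ≤ b T f * b T e
        0≤bb f e T = *-nonNeg (0≤b T f) (0≤b T e)

      A U : ℚ
      A = sum a
      U = sum u

      d : Fin n → ℚ
      d T = ∑[ f < M ] (b T f * a f)

      lost : Fin n → Fin M → ℚ
      lost T e = ∑[ f < M ] (b T f * a f * ((1ℚ - b T e) * m f e))

      -- A linear substitute for `lost`: the indicator of meeting e becomes the number of common
      -- vertices, so that the sum over e factors into degrees. Subtracting `b T e` leaves out T
      -- itself.
      lost′ : Fin n → Fin M → ℚ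
      lost′ T e = ∑[ f < M ] (b T f * a f * (common f e - b T e))

      common-apart : ∀ {f e} → m f e ≡ 0ℚ → common f e ≡ 0ℚ
      common-apart {f} {e} m≡0 = trans (sum-cong-≗ (apart f e m≡0)) (∑-zero {n} n)

      common-meet : ∀ {f e} → m f e ≡ 1ℚ → 1ℚ ≤ common f e
      common-meet {f} {e} m≡1 with meet f e m≡1
      ... | T , eq = ≤-trans (≤-reflexive (sym eq)) (term≤∑ (0≤bb f e) T)

      excess≥0 : ∀ f e → 0ℚ ≤ common f e * common f e - common f e
      excess≥0 f e with m-bit f e
      ... | inj₁ m≡0 rewrite common-apart {f} {e} m≡0 = ≤-refl
      ... | inj₂ m≡1 = subst (0ℚ ≤_) (alg (common f e))
            (*-nonNeg (≤-trans 0≤1 1≤s) (difference≥0 1≤s))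
        where
        1≤s = common-meet {f} {e} m≡1
        alg : ∀ s → s * (s - 1ℚ) ≡ s * s - s
        alg = solve-∀ ringℚ

      -- For T outside e, edges that meet share at least one vertex. For T in both edges the left
      -- side is 0 and T itself makes `common f e` at least 1.
      lost-upper : ∀ T f e → b T f * ((1ℚ - b T e) * m f e) ≤ b T f * (common f e - b T e)
      lost-upper T f e = go (b-bit T f) (b-bit T e) (m-bit f e) common-apart common-meet (term≤∑ (0≤bb f e) T)
        where
        go : ∀ {c b m s} → Bit c → Bit b → Bit m → (m ≡ 0ℚ → s ≡ 0ℚ) → (m ≡ 1ℚ → 1ℚ ≤ s) →
             c * b ≤ s → c * ((1ℚ - b) * m) ≤ c * (s - b)
        go {b = b} {m} {s} (inj₁ refl) _ _ _ _ _ =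
          ≤-reflexive (trans (*-zeroˡ ((1ℚ - b) * m)) (sym (*-zeroˡ (s - b))))
        go {s = s} (inj₂ refl) (inj₁ refl) (inj₁ refl) z _ _ rewrite z refl = ≤-refl
        go {s = s} (inj₂ refl) (inj₁ refl) (inj₂ refl) _ o _ = ≤-excess (s - 1ℚ) (alg s) (difference≥0 (o refl))
          where
          alg : ∀ s → 1ℚ * ((1ℚ - 0ℚ) * 1ℚ) + (s - 1ℚ) ≡ 1ℚ * (s - 0ℚ)
          alg = solve-∀ ringℚ
        go {m = m} {s} (inj₂ refl) (inj₂ refl) _ _ _ l = ≤-excess (s - 1ℚ) (alg s m) (difference≥0 l)
          where
          alg : ∀ s m → 1ℚ * ((1ℚ - 1ℚ) * m) + (s - 1ℚ) ≡ 1ℚ * (s - 1ℚ)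
          alg = solve-∀ ringℚ

      -- The defect s² - s bounds the multiple counting of edges meeting f in several vertices;
      -- in each case the inequality reduces to (s - 1)² ≥ 0.
      lost-lower : ∀ T f e → b T f * (common f e - b T e) ≤
                   b T f * ((1ℚ - b T e) * m f e) + b T f * (common f e * common f e - common f e)
      lost-lower T f e = go (b-bit T f) (b-bit T e) (m-bit f e) common-apart (term≤∑ (0≤bb f e) T)
        where
        go : ∀ {c b m s} → Bit c → Bit b → Bit m → (m ≡ 0ℚ → s ≡ 0ℚ) →
             c * b ≤ s → c * (s - b) ≤ c * ((1ℚ - b) * m) + c * (s * s - s)
        go {b = b} {m} {s} (inj₁ refl) _ _ _ _ = ≤-reflexive (alg b m s)
          where
          alg : ∀ b m s → 0ℚ * (s - b) ≡ 0ℚ * ((1ℚ - b) * m) + 0ℚ * (s * s - s)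
          alg = solve-∀ ringℚ
        go {m = m} {s} (inj₂ refl) (inj₂ refl) _ _ _ = ≤-excess ((s - 1ℚ) * (s - 1ℚ)) (alg m s) (square-nonNeg (s - 1ℚ))
          where
          alg : ∀ m s → 1ℚ * (s - 1ℚ) + (s - 1ℚ) * (s - 1ℚ) ≡ 1ℚ * ((1ℚ - 1ℚ) * m) + 1ℚ * (s * s - s)
          alg = solve-∀ ringℚ
        go {m = m} {s} (inj₂ refl) (inj₁ refl) (inj₂ refl) _ _ = ≤-excess ((s - 1ℚ) * (s - 1ℚ)) (alg s) (square-nonNeg (s - 1ℚ))
          where
          alg : ∀ s → 1ℚ * (s - 0ℚ) + (s - 1ℚ) * (s - 1ℚ) ≡ 1ℚ * ((1ℚ - 0ℚ) * 1ℚ) + 1ℚ * (s * s - s)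
          alg = solve-∀ ringℚ
        go {s = s} (inj₂ refl) (inj₁ refl) (inj₁ refl) z _ rewrite z refl = ≤-refl

      d-nonNeg : ∀ T → 0ℚ ≤ d T
      d-nonNeg T = ∑-nonNeg λ f → *-nonNeg (0≤b T f) (0≤a f)

      d≤D : ∀ T → d T ≤ D
      d≤D T = ≤-trans (∑-mono λ f → ≤-trans (*-monoˡ-≤ (0≤b T f) (bit≤1 (a-bit f))) (≤-reflexive (*-identityʳ (b T f))))
                      (≤-reflexive (degree T))

      A-nonNeg : 0ℚ ≤ A
      A-nonNeg = ∑-nonNeg 0≤a

      lost-nonNeg : ∀ T e → 0ℚ ≤ lost T e
      lost-nonNeg T e = ∑-nonNeg λ f → *-nonNeg (*-nonNeg (0≤b T f) (0≤a f))
        (*-nonNeg (difference≥0 (bit≤1 (b-bit T e))) (bit-nonNeg (m-bit f e)))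

      -- An edge counted here joins T to one of the Q vertices of e. When T lies in e, the
      -- subtracted `b T e` of `lost-upper` cancels the diagonal term D of the codegree bound. A
      -- single step thus changes a degree by little, which makes squares of losses an error term.
      lost≤ : ∀ T e → lost T e ≤ Q * κ
      lost≤ T e = begin
        lost T e
          ≤⟨ ∑-mono pointwise ⟩
        ∑[ f < M ] (b T f * common f e - b T e * b T f)
          ≡⟨ ∑-distrib-- (λ f → b T f * common f e) (λ f → b T e * b T f) ⟩
        ∑[ f < M ] (b T f * common f e) - ∑[ f < M ] (b T e * b T f)
          ≡⟨ cong₂ _-_ (trans (sum-cong-≗ λ f → cong (b T f *_) (sum-cong-≗ λ T′ → *-comm (b T′ f) (b T′ e)))
                              (∑-swap (b T) (λ T′ → b T′ e) (λ f T′ → b T′ f)))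
                       (trans (sym (*-distribˡ-sum (b T e) (b T))) (cong (b T e *_) (degree T))) ⟩
        ∑[ T′ < n ] (b T′ e * ∑[ f < M ] (b T f * b T′ f)) - b T e * D
          ≡⟨ cong (_- b T e * D) (sum-cong-≗ λ T′ → cong (b T′ e *_) (sum-cong-≗ λ f → *-comm (b T f) (b T′ f))) ⟩
        ∑[ T′ < n ] (b T′ e * ∑[ f < M ] (b T′ f * b T f)) - b T e * D
          ≤⟨ +-monoˡ-≤ (- (b T e * D)) (∑-codegree T e) ⟩
        Q * κ + D * b T e - b T e * D
          ≡⟨ alg (Q * κ) D (b T e) ⟩
        Q * κ ∎
        where
        open ≤-Reasoning
        alg : ∀ x y z → x + y * z - z * y ≡ x
        alg = solve-∀ ringℚ
        alg₁ : ∀ x a y → x * a * y ≡ a * (x * y)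
        alg₁ = solve-∀ ringℚ
        alg₂ : ∀ x s y → 1ℚ * (x * (s - y)) ≡ x * s - y * x
        alg₂ = solve-∀ ringℚ
        pointwise : ∀ f → b T f * a f * ((1ℚ - b T e) * m f e) ≤ b T f * common f e - b T e * b T f
        pointwise f = begin
          b T f * a f * ((1ℚ - b T e) * m f e)
            ≡⟨ alg₁ (b T f) (a f) _ ⟩
          a f * (b T f * ((1ℚ - b T e) * m f e))
            ≤⟨ *-monoʳ-≤ (*-nonNeg (0≤b T f) (*-nonNeg (difference≥0 (bit≤1 (b-bit T e))) (bit-nonNeg (m-bit f e)))) (bit≤1 (a-bit f)) ⟩
          1ℚ * (b T f * ((1ℚ - b T e) * m f e))
            ≤⟨ *-monoˡ-≤ 0≤1 (lost-upper T f e) ⟩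
          1ℚ * (b T f * (common f e - b T e))
            ≡⟨ alg₂ (b T f) (common f e) (b T e) ⟩
          b T f * common f e - b T e * b T f ∎

      -- X counts the edges lost at T over all selectable e; Y counts each of them once for every
      -- vertex it shares with e.
      X Y : Fin n → ℚ
      X T = ∑[ e < M ] (a e * lost T e)
      Y T = ∑[ f < M ] (b T f * a f * (∑[ T′ < n ] (b T′ f * d T′) - d T))

      ∑-lost′ : ∀ T → ∑[ e < M ] (a e * lost′ T e) ≡ Y T
      ∑-lost′ T = begin
        ∑[ e < M ] (a e * lost′ T e)
          ≡⟨ ∑-swap a (λ f → b T f * a f) (λ e f → common f e - b T e) ⟩
        ∑[ f < M ] (b T f * a f * ∑[ e < M ] (a e * (common f e - b T e)))
          ≡⟨ sum-cong-≗ (λ f → cong (b T f * a f *_) (inner f)) ⟩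
        Y T ∎
        where
        open ≡-Reasoning
        alg : ∀ x y z → x * (y - z) ≡ x * y - z * x
        alg = solve-∀ ringℚ
        inner : ∀ f → ∑[ e < M ] (a e * (common f e - b T e)) ≡ ∑[ T′ < n ] (b T′ f * d T′) - d T
        inner f = begin
          ∑[ e < M ] (a e * (common f e - b T e))
            ≡⟨ sum-cong-≗ (λ e → alg (a e) (common f e) (b T e)) ⟩
          ∑[ e < M ] (a e * common f e - b T e * a e)
            ≡⟨ ∑-distrib-- (λ e → a e * common f e) (λ e → b T e * a e) ⟩
          ∑[ e < M ] (a e * common f e) - d T
            ≡⟨ cong (_- d T) (∑-swap a (λ T′ → b T′ f) (λ e T′ → b T′ e)) ⟩
          ∑[ T′ < n ] (b T′ f * ∑[ e < M ] (a e * b T′ e)) - d T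
            ≡⟨ cong (_- d T) (sum-cong-≗ λ T′ → cong (b T′ f *_) (sum-cong-≗ λ e → *-comm (a e) (b T′ e))) ⟩
          ∑[ T′ < n ] (b T′ f * d T′) - d T ∎

      X≤Y : ∀ T → X T ≤ Y T
      X≤Y T = ≤-trans (∑-mono λ e → *-monoˡ-≤ (0≤a e) (∑-mono λ f → pointwise f e)) (≤-reflexive (∑-lost′ T))
        where
        alg : ∀ x a y → x * a * y ≡ a * (x * y)
        alg = solve-∀ ringℚ
        pointwise : ∀ f e → b T f * a f * ((1ℚ - b T e) * m f e) ≤ b T f * a f * (common f e - b T e)
        pointwise f e = subst₂ _≤_ (sym (alg (b T f) (a f) _)) (sym (alg (b T f) (a f) _))
          (*-monoˡ-≤ (0≤a f) (lost-upper T f e))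

      -- The overcount of an edge f at T is at most the excess of f over all edges e; discarding the
      -- weights `a e ≤ 1` leaves the bound `∑-excess`.
      Y≤X : ∀ T → Y T ≤ X T + d T * (Q * (Q * κ))
      Y≤X T = begin
        Y T
          ≡⟨ ∑-lost′ T ⟨
        ∑[ e < M ] (a e * lost′ T e)
          ≤⟨ ∑-mono (λ e → *-monoˡ-≤ (0≤a e) (∑-mono λ f → pointwise f e)) ⟩
        ∑[ e < M ] (a e * ∑[ f < M ] (b T f * a f * ((1ℚ - b T e) * m f e) + b T f * a f * excess f e))
          ≡⟨ sum-cong-≗ (λ e → trans (cong (a e *_) (∑-distrib-+ (λ f → b T f * a f * ((1ℚ - b T e) * m f e)) (λ f → b T f * a f * excess f e)))
                                     (*-distribˡ-+ (a e) (lost T e) (∑[ f < M ] (b T f * a f * excess f e)))) ⟩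
        ∑[ e < M ] (a e * lost T e + a e * ∑[ f < M ] (b T f * a f * excess f e))
          ≡⟨ ∑-distrib-+ (λ e → a e * lost T e) (λ e → a e * ∑[ f < M ] (b T f * a f * excess f e)) ⟩
        X T + ∑[ e < M ] (a e * ∑[ f < M ] (b T f * a f * excess f e))
          ≡⟨ cong (X T +_) (∑-swap a (λ f → b T f * a f) (λ e f → excess f e)) ⟩
        X T + ∑[ f < M ] (b T f * a f * ∑[ e < M ] (a e * excess f e))
          ≤⟨ +-monoʳ-≤ (X T) (∑-mono λ f → *-monoˡ-≤ (*-nonNeg (0≤b T f) (0≤a f)) (bounded f)) ⟩
        X T + ∑[ f < M ] (b T f * a f * (Q * (Q * κ)))
          ≡⟨ cong (X T +_) (*-distribʳ-sum (Q * (Q * κ)) (λ f → b T f * a f)) ⟨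
        X T + d T * (Q * (Q * κ)) ∎
        where
        open ≤-Reasoning
        excess : Fin M → Fin M → ℚ
        excess f e = common f e * common f e - common f e
        alg : ∀ x a y → x * a * y ≡ a * (x * y)
        alg = solve-∀ ringℚ
        alg₂ : ∀ x a y z → a * (x * y + x * z) ≡ x * a * y + x * a * z
        alg₂ = solve-∀ ringℚ
        pointwise : ∀ f e → b T f * a f * (common f e - b T e) ≤
                            b T f * a f * ((1ℚ - b T e) * m f e) + b T f * a f * excess f e
        pointwise f e = subst₂ _≤_ (sym (alg (b T f) (a f) _)) (alg₂ (b T f) (a f) _ (excess f e))
          (*-monoˡ-≤ (0≤a f) (lost-lower T f e))
        bounded : ∀ f → ∑[ e < M ] (a e * excess f e) ≤ Q * (Q * κ)
        bounded f = ≤-trans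
          (∑-mono λ e → ≤-trans (*-monoʳ-≤ (excess≥0 f e) (bit≤1 (a-bit e))) (≤-reflexive (*-identityˡ (excess f e))))
          (∑-excess f)

      Y≤ : ∀ T → Y T ≤ Q * D * D
      Y≤ T = begin
        Y T
          ≤⟨ ∑-mono (λ f → *-monoˡ-≤ (*-nonNeg (0≤b T f) (0≤a f)) (inner f)) ⟩
        ∑[ f < M ] (b T f * a f * (Q * D))
          ≡⟨ *-distribʳ-sum (Q * D) (λ f → b T f * a f) ⟨
        d T * (Q * D)
          ≤⟨ *-monoʳ-≤ (*-nonNeg 0≤Q 0≤D) (d≤D T) ⟩
        D * (Q * D)
          ≡⟨ *-comm D (Q * D) ⟩
        Q * D * D ∎
        where
        open ≤-Reasoning
        alg : ∀ x y → x - y + y ≡ x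
        alg = solve-∀ ringℚ
        inner : ∀ f → ∑[ T′ < n ] (b T′ f * d T′) - d T ≤ Q * D
        inner f = begin
          ∑[ T′ < n ] (b T′ f * d T′) - d T ≤⟨ ≤-excess (d T) (alg (∑[ T′ < n ] (b T′ f * d T′)) (d T)) (d-nonNeg T) ⟩
          ∑[ T′ < n ] (b T′ f * d T′)       ≤⟨ ∑-mono (λ T′ → *-monoˡ-≤ (0≤b T′ f) (d≤D T′)) ⟩
          ∑[ T′ < n ] (b T′ f * D)          ≡⟨ *-distribʳ-sum D (λ T′ → b T′ f) ⟨
          (∑[ T′ < n ] b T′ f) * D          ≡⟨ cong (_* D) (edge-size f) ⟩
          Q * D                             ∎

      d-uncovered : ∀ T → u T * d T ≡ d T
      d-uncovered T = trans (*-distribˡ-sum (u T) (λ f → b T f * a f))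
        (sum-cong-≗ λ f → trans (alg (u T) (b T f) (a f)) (trans (sym (a⇒u T f)) (*-comm (a f) (b T f))))
        where
        alg : ∀ u b a → u * (b * a) ≡ a * b * u
        alg = solve-∀ ringℚ

      QA≡∑d : Q * A ≡ ∑[ T < n ] (u T * d T)
      QA≡∑d = begin
        Q * A                                            ≡⟨ *-distribˡ-sum Q a ⟩
        ∑[ f < M ] (Q * a f)                             ≡⟨ sum-cong-≗ (λ f → cong (_* a f) (edge-size f)) ⟨
        ∑[ f < M ] ((∑[ T < n ] b T f) * a f)            ≡⟨ sum-cong-≗ (λ f → *-distribʳ-sum (a f) (λ T → b T f)) ⟩
        ∑[ f < M ] ∑[ T < n ] (b T f * a f)              ≡⟨ ∑-comm (λ f T → b T f * a f) ⟩
        ∑[ T < n ] d T                                   ≡⟨ sum-cong-≗ d-uncovered ⟨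
        ∑[ T < n ] (u T * d T)                           ∎
        where open ≡-Reasoning

      QA≤UD : Q * A ≤ U * D
      QA≤UD = begin
        Q * A                  ≡⟨ QA≡∑d ⟩
        ∑[ T < n ] (u T * d T) ≤⟨ ∑-mono (λ T → *-monoˡ-≤ (0≤u T) (d≤D T)) ⟩
        ∑[ T < n ] (u T * D)   ≡⟨ *-distribʳ-sum D u ⟨
        U * D                  ∎
        where open ≤-Reasoning

      -- First and second moments of the deviation from the target

      module Deviation (τ : ℚ) (0≤τ : 0ℚ ≤ τ) (τ≤D : τ ≤ D) (0<U : 0ℚ < U) where

        η : Fin n → ℚ
        η T = d T - τ

        H W : ℚ
        H = ∑[ T < n ] (u T * η T)
        W = ∑[ T < n ] (u T * (η T * η T))

        η≤D : ∀ T → η T ≤ D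
        η≤D T = ≤-trans (≤-excess τ (alg (d T) τ) 0≤τ) (d≤D T)
          where
          alg : ∀ x y → x - y + y ≡ x
          alg = solve-∀ ringℚ

        0≤D+η : ∀ T → 0ℚ ≤ D + η T
        0≤D+η T = ≤-trans (+-nonNeg (d-nonNeg T) (difference≥0 τ≤D)) (≤-reflexive (alg (d T) τ D))
          where
          alg : ∀ x y z → x + (z - y) ≡ z + (x - y)
          alg = solve-∀ ringℚ

        QA≡Uτ+H : Q * A ≡ U * τ + H
        QA≡Uτ+H = begin
          Q * A                               ≡⟨ QA≡∑d ⟩
          ∑[ T < n ] (u T * d T)              ≡⟨ sum-cong-≗ (λ T → alg (u T) (d T) τ) ⟩
          ∑[ T < n ] (u T * η T + τ * u T)    ≡⟨ ∑-linear τ (λ T → u T * η T) u ⟩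
          H + τ * U                           ≡⟨ alg′ H τ U ⟩
          U * τ + H                           ∎
          where
          open ≡-Reasoning
          alg : ∀ u d t → u * d ≡ u * (d - t) + t * u
          alg = solve-∀ ringℚ
          alg′ : ∀ h t u → h + t * u ≡ u * t + h
          alg′ = solve-∀ ringℚ

        -- The nonnegative sum of `u T * (U * η T - H)²` equals U (U W - H²); one factor U is
        -- cancelled.
        cauchy : H * H ≤ U * W
        cauchy = *-cancelˡ-≤-pos U {{positive 0<U}} (≤-excess _ (alg U H W) (subst (0ℚ ≤_) expand
          (∑-nonNeg λ T → *-nonNeg (0≤u T) (square-nonNeg (U * η T - H)))))
          where
          alg : ∀ U H W → U * (H * H) + (U * (U * W) + (- (2ℚ * U * H)) * H + H * H * U) ≡ U * (U * W)
          alg = solve-∀ ringℚ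
          alg′ : ∀ u e U H → u * ((U * e - H) * (U * e - H)) ≡
                 U * U * (u * (e * e)) + (- (2ℚ * U * H)) * (u * e) + H * H * u
          alg′ = solve-∀ ringℚ
          open ≡-Reasoning
          expand : ∑[ T < n ] (u T * ((U * η T - H) * (U * η T - H))) ≡
                   U * (U * W) + (- (2ℚ * U * H)) * H + H * H * U
          expand = begin
            ∑[ T < n ] (u T * ((U * η T - H) * (U * η T - H)))
              ≡⟨ sum-cong-≗ (λ T → alg′ (u T) (η T) U H) ⟩
            ∑[ T < n ] (U * U * (u T * (η T * η T)) + (- (2ℚ * U * H)) * (u T * η T) + H * H * u T)
              ≡⟨ ∑-linear (H * H) (λ T → U * U * (u T * (η T * η T)) + (- (2ℚ * U * H)) * (u T * η T)) u ⟩
            ∑[ T < n ] (U * U * (u T * (η T * η T)) + (- (2ℚ * U * H)) * (u T * η T)) + H * H * U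
              ≡⟨ cong (_+ H * H * U) (∑-linear (- (2ℚ * U * H)) (λ T → U * U * (u T * (η T * η T))) (λ T → u T * η T)) ⟩
            ∑[ T < n ] (U * U * (u T * (η T * η T))) + (- (2ℚ * U * H)) * H + H * H * U
              ≡⟨ cong (λ x → x + (- (2ℚ * U * H)) * H + H * H * U)
                      (trans (sym (*-distribˡ-sum (U * U) (λ T → u T * (η T * η T)))) (*-assoc U U W)) ⟩
            U * (U * W) + (- (2ℚ * U * H)) * H + H * H * U ∎

        ∑uηd : ∑[ T < n ] (η T * d T) ≡ W + τ * H
        ∑uηd = begin
          ∑[ T < n ] (η T * d T)                                     ≡⟨ sum-cong-≗ (λ T → cong (η T *_) (sym (d-uncovered T))) ⟩
          ∑[ T < n ] (η T * (u T * d T))                             ≡⟨ sum-cong-≗ (λ T → alg (u T) (d T) τ) ⟩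
          ∑[ T < n ] (u T * (η T * η T) + τ * (u T * η T))           ≡⟨ ∑-linear τ (λ T → u T * (η T * η T)) (λ T → u T * η T) ⟩
          W + τ * H                                                  ∎
          where
          open ≡-Reasoning
          alg : ∀ u d t → (d - t) * (u * d) ≡ u * ((d - t) * (d - t)) + t * (u * (d - t))
          alg = solve-∀ ringℚ

        h : Fin M → ℚ
        h f = ∑[ T < n ] (b T f * η T)

        G R : ℚ
        G = ∑[ f < M ] (a f * (h f * h f))
        R = ∑[ T < n ] (d T * (η T * η T))

        G-nonNeg : 0ℚ ≤ G
        G-nonNeg = ∑-nonNeg λ f → *-nonNeg (0≤a f) (square-nonNeg (h f))

        R≤DW : R ≤ D * W
        R≤DW = begin
          R                                      ≡⟨ sum-cong-≗ (λ T → cong (_* (η T * η T)) (sym (d-uncovered T))) ⟩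
          ∑[ T < n ] (u T * d T * (η T * η T))   ≡⟨ sum-cong-≗ (λ T → alg (u T) (d T) (η T * η T)) ⟩
          ∑[ T < n ] (d T * (u T * (η T * η T))) ≤⟨ ∑-mono (λ T → *-monoʳ-≤ (*-nonNeg (0≤u T) (square-nonNeg (η T))) (d≤D T)) ⟩
          ∑[ T < n ] (D * (u T * (η T * η T)))   ≡⟨ *-distribˡ-sum D (λ T → u T * (η T * η T)) ⟨
          D * W                                  ∎
          where
          open ≤-Reasoning
          alg : ∀ u d x → u * d * x ≡ d * (u * x)
          alg = solve-∀ ringℚ

        ∑ah : ∑[ f < M ] (a f * h f) ≡ W + τ * H
        ∑ah = begin
          ∑[ f < M ] (a f * h f)                             ≡⟨ sum-cong-≗ (λ f → cong (a f *_) (sum-cong-≗ λ T → *-comm (b T f) (η T))) ⟩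
          ∑[ f < M ] (a f * ∑[ T < n ] (η T * b T f))        ≡⟨ ∑-swap a η (λ f T → b T f) ⟩
          ∑[ T < n ] (η T * ∑[ f < M ] (a f * b T f))        ≡⟨ sum-cong-≗ (λ T → cong (η T *_) (sum-cong-≗ λ f → *-comm (a f) (b T f))) ⟩
          ∑[ T < n ] (η T * d T)                             ≡⟨ ∑uηd ⟩
          W + τ * H                                          ∎
          where open ≡-Reasoning

        ∑bd : ∀ f → ∑[ T < n ] (b T f * d T) ≡ h f + τ * Q
        ∑bd f = begin
          ∑[ T < n ] (b T f * d T)                   ≡⟨ sum-cong-≗ (λ T → alg (b T f) (d T) τ) ⟩
          ∑[ T < n ] (b T f * η T + τ * b T f)       ≡⟨ ∑-linear τ (λ T → b T f * η T) (λ T → b T f) ⟩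
          h f + τ * ∑[ T < n ] b T f                 ≡⟨ cong (λ x → h f + τ * x) (edge-size f) ⟩
          h f + τ * Q                                ∎
          where
          open ≡-Reasoning
          alg : ∀ b d t → b * d ≡ b * (d - t) + t * b
          alg = solve-∀ ringℚ

        ∑uηY : ∑[ T < n ] (u T * (η T * Y T)) ≡ G + τ * Q * (W + τ * H) - (R + τ * (W + τ * H))
        ∑uηY = begin
          ∑[ T < n ] (u T * (η T * Y T))
            ≡⟨ sum-cong-≗ uY ⟩
          ∑[ T < n ] (η T * ∑[ f < M ] (a f * ((h f + τ * Q) * b T f)) - η T * d T * d T)
            ≡⟨ ∑-distrib-- (λ T → η T * ∑[ f < M ] (a f * ((h f + τ * Q) * b T f))) (λ T → η T * d T * d T) ⟩
          ∑[ T < n ] (η T * ∑[ f < M ] (a f * ((h f + τ * Q) * b T f))) - ∑[ T < n ] (η T * d T * d T)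
            ≡⟨ cong₂ _-_ first second ⟩
          G + τ * Q * (W + τ * H) - (R + τ * (W + τ * H)) ∎
          where
          open ≡-Reasoning
          alg₁ : ∀ u b a x → u * (b * a * x) ≡ (a * b * u) * x
          alg₁ = solve-∀ ringℚ
          alg₂ : ∀ a b x d → a * b * (x - d) ≡ a * (x * b) + (- d) * (b * a)
          alg₂ = solve-∀ ringℚ
          alg₃ : ∀ u e s → u * (e * s) ≡ e * (u * s)
          alg₃ = solve-∀ ringℚ
          alg₄ : ∀ e s d → e * (s + (- d) * d) ≡ e * s - e * d * d
          alg₄ = solve-∀ ringℚ
          uY : ∀ T → u T * (η T * Y T) ≡ η T * ∑[ f < M ] (a f * ((h f + τ * Q) * b T f)) - η T * d T * d T
          uY T = begin
            u T * (η T * Y T)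
              ≡⟨ alg₃ (u T) (η T) (Y T) ⟩
            η T * (u T * Y T)
              ≡⟨ cong (η T *_) (*-distribˡ-sum (u T) (λ f → b T f * a f * (∑[ T′ < n ] (b T′ f * d T′) - d T))) ⟩
            η T * ∑[ f < M ] (u T * (b T f * a f * (∑[ T′ < n ] (b T′ f * d T′) - d T)))
              ≡⟨ cong (η T *_) (sum-cong-≗ λ f → trans (cong (λ x → u T * (b T f * a f * (x - d T))) (∑bd f))
                   (trans (alg₁ (u T) (b T f) (a f) (h f + τ * Q - d T))
                   (trans (cong (_* (h f + τ * Q - d T)) (sym (a⇒u T f)))
                   (alg₂ (a f) (b T f) (h f + τ * Q) (d T))))) ⟩
            η T * ∑[ f < M ] (a f * ((h f + τ * Q) * b T f) + (- d T) * (b T f * a f))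
              ≡⟨ cong (η T *_) (∑-linear (- d T) (λ f → a f * ((h f + τ * Q) * b T f)) (λ f → b T f * a f)) ⟩
            η T * (∑[ f < M ] (a f * ((h f + τ * Q) * b T f)) + (- d T) * d T)
              ≡⟨ alg₄ (η T) _ (d T) ⟩
            η T * ∑[ f < M ] (a f * ((h f + τ * Q) * b T f)) - η T * d T * d T ∎
          alg₅ : ∀ e x b → e * (x * b) ≡ x * (b * e)
          alg₅ = solve-∀ ringℚ
          alg₆ : ∀ a h t → a * ((h + t) * h) ≡ a * (h * h) + t * (a * h)
          alg₆ = solve-∀ ringℚ
          first : ∑[ T < n ] (η T * ∑[ f < M ] (a f * ((h f + τ * Q) * b T f))) ≡ G + τ * Q * (W + τ * H)
          first = begin
            ∑[ T < n ] (η T * ∑[ f < M ] (a f * ((h f + τ * Q) * b T f)))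
              ≡⟨ ∑-swap η a (λ T f → (h f + τ * Q) * b T f) ⟩
            ∑[ f < M ] (a f * ∑[ T < n ] (η T * ((h f + τ * Q) * b T f)))
              ≡⟨ sum-cong-≗ (λ f → cong (a f *_) (trans (sum-cong-≗ λ T → alg₅ (η T) (h f + τ * Q) (b T f))
                   (sym (*-distribˡ-sum (h f + τ * Q) (λ T → b T f * η T))))) ⟩
            ∑[ f < M ] (a f * ((h f + τ * Q) * h f))
              ≡⟨ sum-cong-≗ (λ f → alg₆ (a f) (h f) (τ * Q)) ⟩
            ∑[ f < M ] (a f * (h f * h f) + τ * Q * (a f * h f))
              ≡⟨ ∑-linear (τ * Q) (λ f → a f * (h f * h f)) (λ f → a f * h f) ⟩
            G + τ * Q * ∑[ f < M ] (a f * h f)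
              ≡⟨ cong (λ x → G + τ * Q * x) ∑ah ⟩
            G + τ * Q * (W + τ * H) ∎
          alg₇ : ∀ d t → (d - t) * d * d ≡ d * ((d - t) * (d - t)) + t * ((d - t) * d)
          alg₇ = solve-∀ ringℚ
          second : ∑[ T < n ] (η T * d T * d T) ≡ R + τ * (W + τ * H)
          second = begin
            ∑[ T < n ] (η T * d T * d T)
              ≡⟨ sum-cong-≗ (λ T → alg₇ (d T) τ) ⟩
            ∑[ T < n ] (d T * (η T * η T) + τ * (η T * d T))
              ≡⟨ ∑-linear τ (λ T → d T * (η T * η T)) (λ T → η T * d T) ⟩
            R + τ * ∑[ T < n ] (η T * d T)
              ≡⟨ cong (λ x → R + τ * x) ∑uηd ⟩
            R + τ * (W + τ * H) ∎

        -- The mean change of the deviation in one step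

        module Drift (Δ N : ℚ) (0≤Δ : 0ℚ ≤ Δ) (ΔU : Δ * U ≡ Q * ((Q - 1ℚ) * τ))
          (U≤N : U ≤ N) (N-large : (Q - 1ℚ) * D ≤ N * κ) where

          d′ : Fin n → Fin M → ℚ
          d′ T e = ∑[ f < M ] (b T f * (a f * (1ℚ - m f e)))

          W′ : Fin M → ℚ
          W′ e = ∑[ T < n ] (u T * ((1ℚ - b T e) * ((d′ T e - (τ - Δ)) * (d′ T e - (τ - Δ)))))

          private
            0≤Qκ : 0ℚ ≤ Q * κ
            0≤Qκ = *-nonNeg 0≤Q 0≤κ
            0≤Q-1 : 0ℚ ≤ Q - 1ℚ
            0≤Q-1 = difference≥0 1≤Q
            0≤U : 0ℚ ≤ U
            0≤U = <⇒≤ 0<U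

          lost-d : ∀ T e → lost T e ≡ (1ℚ - b T e) * (d T - d′ T e)
          lost-d T e = begin
            lost T e
              ≡⟨ sum-cong-≗ (λ f → alg (b T f) (a f) (b T e) (m f e)) ⟩
            ∑[ f < M ] ((1ℚ - b T e) * (b T f * a f - b T f * (a f * (1ℚ - m f e))))
              ≡⟨ *-distribˡ-sum (1ℚ - b T e) (λ f → b T f * a f - b T f * (a f * (1ℚ - m f e))) ⟨
            (1ℚ - b T e) * ∑[ f < M ] (b T f * a f - b T f * (a f * (1ℚ - m f e)))
              ≡⟨ cong ((1ℚ - b T e) *_) (∑-distrib-- (λ f → b T f * a f) (λ f → b T f * (a f * (1ℚ - m f e)))) ⟩
            (1ℚ - b T e) * (d T - d′ T e) ∎
            where
            open ≡-Reasoning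
            alg : ∀ x y z w → x * y * ((1ℚ - z) * w) ≡ (1ℚ - z) * (x * y - x * (y * (1ℚ - w)))
            alg = solve-∀ ringℚ

          -- For T outside e the new deviation is η - lost + Δ, and only the term -2 Δ lost of its
          -- square is given away. For T in e the left side vanishes; the term with `b T e` then
          -- cancels the cross term 2 η Δ, so that the right side is η² + Δ².
          square-upper : ∀ T e →
            (1ℚ - b T e) * ((d′ T e - (τ - Δ)) * (d′ T e - (τ - Δ))) ≤
            (η T * η T + 2ℚ * (η T * Δ) + Δ * Δ) + (- (2ℚ * η T)) * lost T e
              + (- (2ℚ * (η T * Δ))) * b T e + lost T e * lost T e
          square-upper T e = go {d = d T} {d′ T e} (b-bit T e) (lost-d T e) (lost-nonNeg T e)
            where
            go : ∀ {b l d d′} → Bit b → l ≡ (1ℚ - b) * (d - d′) → 0ℚ ≤ l →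
                 (1ℚ - b) * ((d′ - (τ - Δ)) * (d′ - (τ - Δ))) ≤
                 ((d - τ) * (d - τ) + 2ℚ * ((d - τ) * Δ) + Δ * Δ) + (- (2ℚ * (d - τ))) * l
                   + (- (2ℚ * ((d - τ) * Δ))) * b + l * l
            go {d = d} {d′} (inj₁ refl) refl 0≤l =
              ≤-excess _ (alg d d′ τ Δ) (*-nonNeg (*-nonNeg 0≤2 0≤l) 0≤Δ)
              where
              alg : ∀ d d′ τ Δ →
                (1ℚ - 0ℚ) * ((d′ - (τ - Δ)) * (d′ - (τ - Δ))) + 2ℚ * ((1ℚ - 0ℚ) * (d - d′)) * Δ ≡
                ((d - τ) * (d - τ) + 2ℚ * ((d - τ) * Δ) + Δ * Δ) + (- (2ℚ * (d - τ))) * ((1ℚ - 0ℚ) * (d - d′))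
                  + (- (2ℚ * ((d - τ) * Δ))) * 0ℚ + (1ℚ - 0ℚ) * (d - d′) * ((1ℚ - 0ℚ) * (d - d′))
              alg = solve-∀ ringℚ
            go {d = d} {d′} (inj₂ refl) refl 0≤l =
              ≤-excess _ (alg d d′ τ Δ) (+-nonNeg (square-nonNeg (d - τ)) (square-nonNeg Δ))
              where
              alg : ∀ d d′ τ Δ →
                (1ℚ - 1ℚ) * ((d′ - (τ - Δ)) * (d′ - (τ - Δ))) + ((d - τ) * (d - τ) + Δ * Δ) ≡
                ((d - τ) * (d - τ) + 2ℚ * ((d - τ) * Δ) + Δ * Δ) + (- (2ℚ * (d - τ))) * ((1ℚ - 1ℚ) * (d - d′))
                  + (- (2ℚ * ((d - τ) * Δ))) * 1ℚ + (1ℚ - 1ℚ) * (d - d′) * ((1ℚ - 1ℚ) * (d - d′))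
              alg = solve-∀ ringℚ

          X₂ : Fin n → ℚ
          X₂ T = ∑[ e < M ] (a e * (lost T e * lost T e))

          X₂≤ : ∀ T → X₂ T ≤ Q * κ * (Q * D * D)
          X₂≤ T = begin
            X₂ T                                    ≤⟨ ∑-mono (λ e → *-monoˡ-≤ (0≤a e) (*-monoʳ-≤ (lost-nonNeg T e) (lost≤ T e))) ⟩
            ∑[ e < M ] (a e * (Q * κ * lost T e))   ≡⟨ sum-cong-≗ (λ e → alg (a e) (Q * κ) (lost T e)) ⟩
            ∑[ e < M ] (Q * κ * (a e * lost T e))   ≡⟨ *-distribˡ-sum (Q * κ) (λ e → a e * lost T e) ⟨
            Q * κ * X T                             ≤⟨ *-monoˡ-≤ 0≤Qκ (≤-trans (X≤Y T) (Y≤ T)) ⟩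
            Q * κ * (Q * D * D)                     ∎
            where
            open ≤-Reasoning
            alg : ∀ a k l → a * (k * l) ≡ k * (a * l)
            alg = solve-∀ ringℚ

          -- In order: the replacement of `X` by `Y`, the correction for vertices covered by the
          -- chosen edge, the squares of the losses, and the square of the decrease of the target.
          err : ℚ
          err = 2ℚ * (D * (D * (Q * (Q * κ)))) + 2ℚ * (D * D * Δ) + Q * κ * (Q * D * D) + A * (Δ * Δ)

          -- The cross term -2 η X is -2 η Y + 2 η (Y - X). As Y - X is nonnegative, the upper bound
          -- η ≤ D controls this although the sign of η is unknown. Similarly D² + η d ≥ 0 controls
          -- the term -2 η Δ d.
          vertex-drift : ∀ T →
            ∑[ e < M ] (a e * ((1ℚ - b T e) * ((d′ T e - (τ - Δ)) * (d′ T e - (τ - Δ))))) ≤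
            A * (η T * η T) - 2ℚ * (η T * Y T) + 2ℚ * (A * Δ) * η T + err
          vertex-drift T = begin
            ∑[ e < M ] (a e * ((1ℚ - b T e) * ((d′ T e - (τ - Δ)) * (d′ T e - (τ - Δ)))))
              ≤⟨ ∑-mono (λ e → *-monoˡ-≤ (0≤a e) (square-upper T e)) ⟩
            ∑[ e < M ] (a e * (c₀ + c₁ * lost T e + c₂ * b T e + lost T e * lost T e))
              ≡⟨ sum-cong-≗ (λ e → expand (a e) c₀ c₁ c₂ (lost T e) (b T e)) ⟩
            ∑[ e < M ] (c₀ * a e + c₁ * (a e * lost T e) + c₂ * (b T e * a e) + a e * (lost T e * lost T e))
              ≡⟨ ∑-distrib-+ (λ e → c₀ * a e + c₁ * (a e * lost T e) + c₂ * (b T e * a e)) (λ e → a e * (lost T e * lost T e)) ⟩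
            ∑[ e < M ] (c₀ * a e + c₁ * (a e * lost T e) + c₂ * (b T e * a e)) + X₂ T
              ≡⟨ cong (_+ X₂ T) (∑-linear c₂ (λ e → c₀ * a e + c₁ * (a e * lost T e)) (λ e → b T e * a e)) ⟩
            ∑[ e < M ] (c₀ * a e + c₁ * (a e * lost T e)) + c₂ * d T + X₂ T
              ≡⟨ cong (λ x → x + c₂ * d T + X₂ T) (trans (∑-linear c₁ (λ e → c₀ * a e) (λ e → a e * lost T e))
                   (cong (_+ c₁ * X T) (sym (*-distribˡ-sum c₀ a)))) ⟩
            c₀ * A + c₁ * X T + c₂ * d T + X₂ T
              ≤⟨ ≤-excess _ (regroup D (Q * (Q * κ)) (η T) (Y T) (X T) Δ (d T) (Q * κ * (Q * D * D)) (X₂ T) A)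
                   (+-nonNeg (+-nonNeg (*-nonNeg 0≤2 (difference≥0 excess)) (*-nonNeg 0≤2 (*-nonNeg 0≤Δ sign)))
                     (difference≥0 (X₂≤ T))) ⟩
            A * (η T * η T) - 2ℚ * (η T * Y T) + 2ℚ * (A * Δ) * η T + err ∎
            where
            open ≤-Reasoning
            c₀ = η T * η T + 2ℚ * (η T * Δ) + Δ * Δ
            c₁ = - (2ℚ * η T)
            c₂ = - (2ℚ * (η T * Δ))
            expand : ∀ a c₀ c₁ c₂ l b → a * (c₀ + c₁ * l + c₂ * b + l * l) ≡
                     c₀ * a + c₁ * (a * l) + c₂ * (b * a) + a * (l * l)
            expand = solve-∀ ringℚ
            regroup : ∀ D K η Y X Δ d k x A →
              (η * η + 2ℚ * (η * Δ) + Δ * Δ) * A + (- (2ℚ * η)) * X + (- (2ℚ * (η * Δ))) * d + x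
                + (2ℚ * (D * (D * K) - η * (Y - X)) + 2ℚ * (Δ * (D * D + η * d)) + (k - x)) ≡
              A * (η * η) - 2ℚ * (η * Y) + 2ℚ * (A * Δ) * η
                + (2ℚ * (D * (D * K)) + 2ℚ * (D * D * Δ) + k + A * (Δ * Δ))
            regroup = solve-∀ ringℚ
            alg₁ : ∀ x y → x + y - x ≡ y
            alg₁ = solve-∀ ringℚ
            0≤K : 0ℚ ≤ Q * (Q * κ)
            0≤K = *-nonNeg 0≤Q 0≤Qκ
            excess : η T * (Y T - X T) ≤ D * (D * (Q * (Q * κ)))
            excess = begin
              η T * (Y T - X T)             ≤⟨ *-monoʳ-≤ (difference≥0 (X≤Y T)) (η≤D T) ⟩
              D * (Y T - X T)               ≤⟨ *-monoˡ-≤ 0≤D (+-monoˡ-≤ (- X T) (Y≤X T)) ⟩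
              D * (X T + d T * (Q * (Q * κ)) - X T) ≡⟨ cong (D *_) (alg₁ (X T) (d T * (Q * (Q * κ)))) ⟩
              D * (d T * (Q * (Q * κ)))     ≤⟨ *-monoˡ-≤ 0≤D (*-monoʳ-≤ 0≤K (d≤D T)) ⟩
              D * (D * (Q * (Q * κ)))       ∎
            alg₂ : ∀ D d e → D * (D - d) + (D + e) * d ≡ D * D + e * d
            alg₂ = solve-∀ ringℚ
            sign : 0ℚ ≤ D * D + η T * d T
            sign = subst (0ℚ ≤_) (alg₂ D (d T) (η T))
              (+-nonNeg (*-nonNeg 0≤D (difference≥0 (d≤D T))) (*-nonNeg (0≤D+η T) (d-nonNeg T)))

          ∑-drift : ∑[ e < M ] (a e * W′ e) ≤
                    U * err + A * W - 2ℚ * ∑[ T < n ] (u T * (η T * Y T)) + 2ℚ * (A * Δ) * H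
          ∑-drift = begin
            ∑[ e < M ] (a e * W′ e)
              ≡⟨ ∑-swap a u (λ e T → (1ℚ - b T e) * ((d′ T e - (τ - Δ)) * (d′ T e - (τ - Δ)))) ⟩
            ∑[ T < n ] (u T * ∑[ e < M ] (a e * ((1ℚ - b T e) * ((d′ T e - (τ - Δ)) * (d′ T e - (τ - Δ))))))
              ≤⟨ ∑-mono (λ T → *-monoˡ-≤ (0≤u T) (vertex-drift T)) ⟩
            ∑[ T < n ] (u T * (A * (η T * η T) - 2ℚ * (η T * Y T) + 2ℚ * (A * Δ) * η T + err))
              ≡⟨ sum-cong-≗ (λ T → alg (u T) A (η T) (Y T) Δ err) ⟩
            ∑[ T < n ] (u T * err + A * (u T * (η T * η T)) + (- 2ℚ) * (u T * (η T * Y T)) + 2ℚ * (A * Δ) * (u T * η T))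
              ≡⟨ ∑-linear (2ℚ * (A * Δ)) (λ T → u T * err + A * (u T * (η T * η T)) + (- 2ℚ) * (u T * (η T * Y T))) (λ T → u T * η T) ⟩
            ∑[ T < n ] (u T * err + A * (u T * (η T * η T)) + (- 2ℚ) * (u T * (η T * Y T))) + 2ℚ * (A * Δ) * H
              ≡⟨ cong (_+ 2ℚ * (A * Δ) * H) (∑-linear (- 2ℚ) (λ T → u T * err + A * (u T * (η T * η T))) (λ T → u T * (η T * Y T))) ⟩
            ∑[ T < n ] (u T * err + A * (u T * (η T * η T))) + (- 2ℚ) * S + 2ℚ * (A * Δ) * H
              ≡⟨ cong (λ x → x + (- 2ℚ) * S + 2ℚ * (A * Δ) * H)
                   (trans (∑-linear A (λ T → u T * err) (λ T → u T * (η T * η T)))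
                          (cong (_+ A * W) (sym (*-distribʳ-sum err u)))) ⟩
            U * err + A * W + (- 2ℚ) * S + 2ℚ * (A * Δ) * H
              ≡⟨ alg′ (U * err + A * W) S (2ℚ * (A * Δ) * H) ⟩
            U * err + A * W - 2ℚ * S + 2ℚ * (A * Δ) * H ∎
            where
            open ≤-Reasoning
            S = ∑[ T < n ] (u T * (η T * Y T))
            alg : ∀ u A e Y Δ r → u * (A * (e * e) - 2ℚ * (e * Y) + 2ℚ * (A * Δ) * e + r) ≡
                  u * r + A * (u * (e * e)) + (- 2ℚ) * (u * (e * Y)) + 2ℚ * (A * Δ) * (u * e)
            alg = solve-∀ ringℚ
            alg′ : ∀ x s y → x + (- 2ℚ) * s + y ≡ x - 2ℚ * s + y
            alg′ = solve-∀ ringℚ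

          -- After multiplication by Q, the factor Q A is U τ + H. The resulting H² is bounded by
          -- Cauchy-Schwarz, and then Δ appears only through Δ U. The choice of Δ makes the right
          -- side equal to the part of `∑uηY` that depends on H, so the first-order terms cancel in
          -- `drift`.
          AΔH≤ : A * Δ * H ≤ (Q - 1ℚ) * (τ * (τ * H + W))
          AΔH≤ = *-cancelˡ-≤-pos Q {{positive (<-≤-trans 0<1 1≤Q)}} (begin
            Q * (A * Δ * H)                                 ≡⟨ alg₁ Q A Δ H ⟩
            (Q * A) * (Δ * H)                               ≡⟨ cong (_* (Δ * H)) QA≡Uτ+H ⟩
            (U * τ + H) * (Δ * H)                           ≡⟨ alg₂ U τ H Δ ⟩
            Δ * U * (τ * H) + Δ * (H * H)                   ≤⟨ +-monoʳ-≤ (Δ * U * (τ * H)) (*-monoˡ-≤ 0≤Δ cauchy) ⟩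
            Δ * U * (τ * H) + Δ * (U * W)                   ≡⟨ alg₃ (Δ) U τ H W ⟩
            Δ * U * (τ * H + W)                             ≡⟨ cong (_* (τ * H + W)) ΔU ⟩
            Q * ((Q - 1ℚ) * τ) * (τ * H + W)                ≡⟨ alg₄ Q τ (τ * H + W) ⟩
            Q * ((Q - 1ℚ) * (τ * (τ * H + W)))              ∎)
            where
            open ≤-Reasoning
            0<1 : 0ℚ < 1ℚ
            0<1 = positive⁻¹ 1ℚ
            alg₁ : ∀ Q A Δ H → Q * (A * Δ * H) ≡ (Q * A) * (Δ * H)
            alg₁ = solve-∀ ringℚ
            alg₂ : ∀ U τ H Δ → (U * τ + H) * (Δ * H) ≡ Δ * U * (τ * H) + Δ * (H * H)
            alg₂ = solve-∀ ringℚ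
            alg₃ : ∀ Δ U τ H W → Δ * U * (τ * H) + Δ * (U * W) ≡ Δ * U * (τ * H + W)
            alg₃ = solve-∀ ringℚ
            alg₄ : ∀ Q τ x → Q * ((Q - 1ℚ) * τ) * x ≡ Q * ((Q - 1ℚ) * (τ * x))
            alg₄ = solve-∀ ringℚ

          -- All terms are multiples of N Q² κ D²: the losses give 2 + 1 of them, the correction for
          -- covered vertices 2, and Δ² gives 1. For the last two, `N-large` turns (Q - 1) τ into N
          -- κ.
          U*err≤ : U * err ≤ 6ℚ * (N * (Q * (Q * κ)) * (D * D))
          U*err≤ = begin
            U * err
              ≡⟨ alg₁ U D Q κ Δ A ⟩
            U * (Q * (Q * κ)) * (D * D) * (2ℚ + 1ℚ) + 2ℚ * (D * D) * (Δ * U) + Δ * U * (A * Δ)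
              ≤⟨ +-mono-≤ (+-mono-≤ (*-monoʳ-≤ (+-nonNeg 0≤2 0≤1) (*-monoʳ-≤ 0≤DD (*-monoʳ-≤ 0≤K U≤N)))
                                    (*-monoˡ-≤ (*-nonNeg 0≤2 0≤DD) ΔU≤))
                          ΔUAΔ≤ ⟩
            N * (Q * (Q * κ)) * (D * D) * (2ℚ + 1ℚ) + 2ℚ * (D * D) * (Q * (N * κ)) + D * (Q * (N * κ)) * (Q * D)
              ≤⟨ +-monoˡ-≤ (D * (Q * (N * κ)) * (Q * D)) (+-monoʳ-≤ (N * (Q * (Q * κ)) * (D * D) * (2ℚ + 1ℚ)) weaken) ⟩
            N * (Q * (Q * κ)) * (D * D) * (2ℚ + 1ℚ) + 2ℚ * (D * D) * (Q * (Q * (N * κ))) + D * (Q * (N * κ)) * (Q * D)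
              ≡⟨ alg₂ N Q κ D ⟩
            6ℚ * (N * (Q * (Q * κ)) * (D * D)) ∎
            where
            open ≤-Reasoning
            0≤DD = *-nonNeg 0≤D 0≤D
            0≤K = *-nonNeg 0≤Q 0≤Qκ
            0≤N = ≤-trans 0≤U U≤N
            0≤QNκ = *-nonNeg 0≤Q (*-nonNeg 0≤N 0≤κ)
            alg₁ : ∀ U D Q κ Δ A →
              U * (2ℚ * (D * (D * (Q * (Q * κ)))) + 2ℚ * (D * D * Δ) + Q * κ * (Q * D * D) + A * (Δ * Δ)) ≡
              U * (Q * (Q * κ)) * (D * D) * (2ℚ + 1ℚ) + 2ℚ * (D * D) * (Δ * U) + Δ * U * (A * Δ)
            alg₁ = solve-∀ ringℚ
            alg₂ : ∀ N Q κ D →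
              N * (Q * (Q * κ)) * (D * D) * (2ℚ + 1ℚ) + 2ℚ * (D * D) * (Q * (Q * (N * κ))) + D * (Q * (N * κ)) * (Q * D) ≡
              2ℚ * (2ℚ + 1ℚ) * (N * (Q * (Q * κ)) * (D * D))
            alg₂ = solve-∀ ringℚ
            Qτ≤ : (Q - 1ℚ) * τ ≤ N * κ
            Qτ≤ = ≤-trans (*-monoˡ-≤ 0≤Q-1 τ≤D) N-large
            ΔU≤ : Δ * U ≤ Q * (N * κ)
            ΔU≤ = ≤-trans (≤-reflexive ΔU) (*-monoˡ-≤ 0≤Q Qτ≤)
            weaken : 2ℚ * (D * D) * (Q * (N * κ)) ≤ 2ℚ * (D * D) * (Q * (Q * (N * κ)))
            weaken = *-monoˡ-≤ (*-nonNeg 0≤2 0≤DD) (≤-trans (≤-reflexive (sym (*-identityˡ (Q * (N * κ)))))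
              (*-monoʳ-≤ 0≤QNκ 1≤Q))
            alg₃ : ∀ Q τ A Δ → Q * ((Q - 1ℚ) * τ) * (A * Δ) ≡ Q * A * (Δ * ((Q - 1ℚ) * τ))
            alg₃ = solve-∀ ringℚ
            alg₄ : ∀ U D Δ x → U * D * (Δ * x) ≡ D * (Δ * U) * x
            alg₄ = solve-∀ ringℚ
            alg₅ : ∀ Q → Q - 1ℚ + 1ℚ ≡ Q
            alg₅ = solve-∀ ringℚ
            0≤[Q-1]τ = *-nonNeg 0≤Q-1 0≤τ
            ΔUAΔ≤ : Δ * U * (A * Δ) ≤ D * (Q * (N * κ)) * (Q * D)
            ΔUAΔ≤ = begin
              Δ * U * (A * Δ)                     ≡⟨ cong (_* (A * Δ)) ΔU ⟩
              Q * ((Q - 1ℚ) * τ) * (A * Δ)        ≡⟨ alg₃ Q τ A Δ ⟩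
              Q * A * (Δ * ((Q - 1ℚ) * τ))        ≤⟨ *-monoʳ-≤ (*-nonNeg 0≤Δ 0≤[Q-1]τ) QA≤UD ⟩
              U * D * (Δ * ((Q - 1ℚ) * τ))        ≡⟨ alg₄ U D Δ ((Q - 1ℚ) * τ) ⟩
              D * (Δ * U) * ((Q - 1ℚ) * τ)        ≤⟨ *-mono-≤ (*-nonNeg 0≤D (*-nonNeg 0≤Δ 0≤U)) (*-nonNeg 0≤Q 0≤D) (*-monoˡ-≤ 0≤D ΔU≤)
                                                       (*-mono-≤ 0≤Q-1 0≤D (≤-excess 1ℚ (alg₅ Q) 0≤1) τ≤D) ⟩
              D * (Q * (N * κ)) * (Q * D)         ∎

          drift : ∑[ e < M ] (a e * W′ e) ≤ (A + 2ℚ * D) * W + 6ℚ * (N * (Q * (Q * κ)) * (D * D))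
          drift = begin
            ∑[ e < M ] (a e * W′ e)
              ≤⟨ ∑-drift ⟩
            U * err + A * W - 2ℚ * ∑[ T < n ] (u T * (η T * Y T)) + 2ℚ * (A * Δ) * H
              ≡⟨ cong (λ x → U * err + A * W - 2ℚ * x + 2ℚ * (A * Δ) * H) ∑uηY ⟩
            U * err + A * W - 2ℚ * (G + τ * Q * (W + τ * H) - (R + τ * (W + τ * H))) + 2ℚ * (A * Δ) * H
              -- Twice the sum of `G`, D W - R and the slack of `AΔH≤` is given away; no term with
              -- `H` survives.
              ≤⟨ ≤-excess _ (alg (U * err) A W G τ Q H R Δ D)
                   (*-nonNeg 0≤2 (+-nonNeg (+-nonNeg G-nonNeg (difference≥0 R≤DW)) (difference≥0 AΔH≤))) ⟩
            (A + 2ℚ * D) * W + U * err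
              ≤⟨ +-monoʳ-≤ ((A + 2ℚ * D) * W) U*err≤ ⟩
            (A + 2ℚ * D) * W + 6ℚ * (N * (Q * (Q * κ)) * (D * D)) ∎
            where
            open ≤-Reasoning
            alg : ∀ x A W G τ Q H R Δ D →
              x + A * W - 2ℚ * (G + τ * Q * (W + τ * H) - (R + τ * (W + τ * H))) + 2ℚ * (A * Δ) * H
                + 2ℚ * (G + (D * W - R) + ((Q - 1ℚ) * (τ * (τ * H + W)) - A * Δ * H)) ≡
              (A + 2ℚ * D) * W + x
            alg = solve-∀ ringℚ

  -- The potential function

  ^-nonNeg : ∀ {x} n → 0ℚ ≤ x → 0ℚ ≤ x ^ n
  ^-nonNeg zero    0≤x = 0≤1
  ^-nonNeg (suc n) 0≤x = *-nonNeg 0≤x (^-nonNeg n 0≤x)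

  ^-mono : ∀ {x y} n → 0ℚ ≤ x → x ≤ y → x ^ n ≤ y ^ n
  ^-mono zero    0≤x x≤y = ≤-refl
  ^-mono (suc n) 0≤x x≤y = *-mono-≤ 0≤x (^-nonNeg n (≤-trans 0≤x x≤y)) x≤y (^-mono n 0≤x x≤y)

  ^≤1 : ∀ {x} n → 0ℚ ≤ x → x ≤ 1ℚ → x ^ n ≤ 1ℚ
  ^≤1 zero    0≤x x≤1 = ≤-refl
  ^≤1 (suc n) 0≤x x≤1 = *-mono-≤ 0≤x 0≤1 x≤1 (^≤1 n 0≤x x≤1)

  ^-pos : ∀ {x} n → 0ℚ < x → 0ℚ < x ^ n
  ^-pos zero    0<x = positive⁻¹ 1ℚ
  ^-pos {x} (suc n) 0<x = positive⁻¹ (x * x ^ n) {{pos*pos⇒pos x {{positive 0<x}} (x ^ n) {{positive (^-pos n 0<x)}}}}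

  1^ : ∀ n → 1ℚ ^ n ≡ 1ℚ
  1^ zero    = refl
  1^ (suc n) = trans (*-identityˡ (1ℚ ^ n)) (1^ n)

  -- Bernoulli's inequality for (1 + y / x)^n, cleared of denominators; the increment y / x is
  -- weakened to y, which is where x ≤ 1 is used.
  bernoulli : ∀ {x y} n → 0ℚ ≤ x → x ≤ 1ℚ → 0ℚ ≤ y → (1ℚ + fromℕ n * y) * x ^ n ≤ (x + y) ^ n
  bernoulli {x} {y} zero    0≤x x≤1 0≤y = ≤-reflexive (alg y)
    where
    alg : ∀ y → (1ℚ + 0ℚ * y) * 1ℚ ≡ 1ℚ
    alg = solve-∀ ringℚ
  bernoulli {x} {y} (suc n) 0≤x x≤1 0≤y = begin
    (1ℚ + (1ℚ + fromℕ n) * y) * (x * x ^ n)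
      ≤⟨ ≤-excess _ (alg (fromℕ n) x y (x ^ n)) (*-nonNeg (*-nonNeg 0≤y (^-nonNeg n 0≤x)) (+-nonNeg (difference≥0 x≤1) (*-nonNeg (fromℕ-nonNeg n) 0≤y))) ⟩
    (x + y) * ((1ℚ + fromℕ n * y) * x ^ n)
      ≤⟨ *-monoˡ-≤ (+-nonNeg 0≤x 0≤y) (bernoulli n 0≤x x≤1 0≤y) ⟩
    (x + y) * (x + y) ^ n ∎
    where
    open ≤-Reasoning
    alg : ∀ n x y p → (1ℚ + (1ℚ + n) * y) * (x * p) + y * p * ((1ℚ - x) + n * y) ≡ (x + y) * ((1ℚ + n * y) * p)
    alg = solve-∀ ringℚ

  -- p absorbs the growth of the deviation, q keeps the target above D x^q, K makes φ at least 1 when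
  -- the deviation is large, and r pays for the error of order ρ.
  record Constants (Q : ℚ) : Set where
    field
      ε K r ρ : ℚ
      p q     : ℕ
      0<ε     : 0ℚ < ε
      0≤K     : 0ℚ ≤ K
      0≤r     : 0ℚ ≤ r
      0<ρ     : 0ℚ < ρ
      p-large : 2ℚ * 2ℚ ≤ fromℕ p * ε ^ suc q
      q-large : 2ℚ * Q ≤ fromℕ q * ε
      K-large : 2ℚ * 2ℚ ≤ K * (ε ^ p * (ε * (ε ^ q * ε ^ q)))
      r-large : 2ℚ * (K * (6ℚ * (Q * (Q * ρ)))) ≤ r * ε ^ suc q
      ρ-small : 2ℚ * (Q * (Q * ρ)) ≤ ε

  -- `ν` and `∂` are the reciprocals of N and D. Giving them by equations keeps every estimate
  -- polynomial, hence within reach of the ring solver.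
  record Scale {Q : ℚ} (constants : Constants Q) : Set where
    field
      N D ν ∂ : ℚ
      νN≡1    : ν * N ≡ 1ℚ
      ∂D≡1    : ∂ * D ≡ 1ℚ
      0≤ν     : 0ℚ ≤ ν
      0≤∂     : 0ℚ ≤ ∂
      0<D     : 0ℚ < D
      ν≤ρ     : ν ≤ Constants.ρ constants

  module Potential {Q : ℚ} (1≤Q : 1ℚ ≤ Q) {constants : Constants Q} (scale : Scale constants) where

    open Constants constants
    open Scale scale

    φ : ℚ → ℚ → ℚ
    φ U W = ε + K * ((U * ν) ^ p * (W * (ν * (∂ * ∂)))) + r * (U * ν)

    private
      0≤ρ : 0ℚ ≤ ρ
      0≤ρ = <⇒≤ 0<ρ
      0≤ε : 0ℚ ≤ ε
      0≤ε = <⇒≤ 0<ε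
      0≤D : 0ℚ ≤ D
      0≤D = <⇒≤ 0<D
      0≤Q : 0ℚ ≤ Q
      0≤Q = ≤-trans 0≤1 1≤Q
      0≤scale : 0ℚ ≤ ν * (∂ * ∂)
      0≤scale = *-nonNeg 0≤ν (*-nonNeg 0≤∂ 0≤∂)
      2QQν≤ε : 2ℚ * (Q * (Q * ν)) ≤ ε
      2QQν≤ε = ≤-trans (*-monoˡ-≤ 0≤2 (*-monoˡ-≤ 0≤Q (*-monoˡ-≤ 0≤Q ν≤ρ))) ρ-small
      0≤Qν : 0ℚ ≤ Q * ν
      0≤Qν = *-nonNeg 0≤Q 0≤ν

    ε≤φ : ∀ {U W} → 0ℚ ≤ U → 0ℚ ≤ W → ε ≤ φ U W
    ε≤φ {U} {W} 0≤U 0≤W = ≤-excess (K * ((U * ν) ^ p * (W * (ν * (∂ * ∂)))) + r * (U * ν)) (sym (+-assoc ε _ (r * (U * ν))))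
      (+-nonNeg (*-nonNeg 0≤K (*-nonNeg (^-nonNeg p (*-nonNeg 0≤U 0≤ν)) (*-nonNeg 0≤W 0≤scale))) (*-nonNeg 0≤r (*-nonNeg 0≤U 0≤ν)))

    module _ {U τ : ℚ} (0<U : 0ℚ < U) (ε≤x : ε ≤ U * ν) (U≤N : U ≤ N) (0≤τ : 0ℚ ≤ τ) (τ-large : D * (U * ν) ^ q ≤ τ) where

      private
        x y x′ : ℚ
        x = U * ν
        y = Q * ν
        x′ = (U - Q) * ν
        0≤U : 0ℚ ≤ U
        0≤U = <⇒≤ 0<U
        0<x : 0ℚ < x
        0<x = <-≤-trans 0<ε ε≤x
        0≤x : 0ℚ ≤ x
        0≤x = <⇒≤ 0<x
        x≤1 : x ≤ 1ℚ
        x≤1 = ≤-trans (*-monoʳ-≤ 0≤ν U≤N) (≤-reflexive (trans (*-comm N ν) νN≡1))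
        x′+y : x′ + y ≡ x
        x′+y = alg U Q ν
          where
          alg : ∀ U Q ν → (U - Q) * ν + Q * ν ≡ U * ν
          alg = solve-∀ ringℚ
        y≤x : y ≤ x
        y≤x = begin
          Q * ν                 ≡⟨ *-identityˡ (Q * ν) ⟨
          1ℚ * (Q * ν)          ≤⟨ *-monoʳ-≤ 0≤Qν 1≤Q ⟩
          Q * (Q * ν)           ≤⟨ ≤-excess (Q * (Q * ν)) (alg (Q * (Q * ν))) (*-nonNeg 0≤Q 0≤Qν) ⟩
          2ℚ * (Q * (Q * ν))    ≤⟨ 2QQν≤ε ⟩
          ε                     ≤⟨ ε≤x ⟩
          x                     ∎
          where
          open ≤-Reasoning
          alg : ∀ z → z + z ≡ 2ℚ * z
          alg = solve-∀ ringℚ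
        0≤x′ : 0ℚ ≤ x′
        0≤x′ = ≤-trans (difference≥0 y≤x) (≤-reflexive (alg U Q ν))
          where
          alg : ∀ U Q ν → U * ν - Q * ν ≡ (U - Q) * ν
          alg = solve-∀ ringℚ
        x′≤1 : x′ ≤ 1ℚ
        x′≤1 = ≤-trans (≤-excess y x′+y 0≤Qν) x≤1
        drop : ∀ m → (1ℚ + fromℕ m * y) * x′ ^ m ≤ x ^ m
        drop m = subst (λ z → (1ℚ + fromℕ m * y) * x′ ^ m ≤ z ^ m) x′+y (bernoulli m 0≤x′ x′≤1 0≤Qν)

      -- Write x for U / N and y for Q / N. A step multiplies τ by 1 - (Q - 1) y / x, while by
      -- Bernoulli x^q loses at least a factor 1 + q y. Since 2Q ≤ q ε ≤ q x, the power falls at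
      -- least as fast as the target. Any such q serves: τ has only to stay above a fixed positive
      -- multiple of D as long as x ≥ ε.
      target-step : ∀ {Δ} → 0ℚ ≤ Δ → Δ * U ≡ Q * ((Q - 1ℚ) * τ) → D * x′ ^ q ≤ τ - Δ
      target-step {Δ} 0≤Δ ΔU = *-cancelˡ-≤-pos x {{positive 0<x}} (begin
        x * (D * x′ ^ q)
          ≤⟨ *-monoʳ-≤ (*-nonNeg 0≤D (^-nonNeg q 0≤x′)) key ⟩
        (x - y * (Q - 1ℚ)) * (1ℚ + fromℕ q * y) * (D * x′ ^ q)
          ≡⟨ alg₁ (x - y * (Q - 1ℚ)) (1ℚ + fromℕ q * y) D (x′ ^ q) ⟩
        (x - y * (Q - 1ℚ)) * (D * ((1ℚ + fromℕ q * y) * x′ ^ q))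
          ≤⟨ *-monoˡ-≤ 0≤x-y′ (*-monoˡ-≤ 0≤D (drop q)) ⟩
        (x - y * (Q - 1ℚ)) * (D * x ^ q)
          ≤⟨ *-monoˡ-≤ 0≤x-y′ τ-large ⟩
        (x - y * (Q - 1ℚ)) * τ
          ≡⟨ alg₂ U ν Q τ ⟩
        x * τ - Q * ((Q - 1ℚ) * τ) * ν
          ≡⟨ cong (λ z → x * τ - z * ν) (sym ΔU) ⟩
        x * τ - Δ * U * ν
          ≡⟨ alg₃ U ν τ Δ ⟩
        x * (τ - Δ) ∎)
        where
        open ≤-Reasoning
        alg₁ : ∀ a b D p → a * b * (D * p) ≡ a * (D * (b * p))
        alg₁ = solve-∀ ringℚ
        alg₂ : ∀ U ν Q τ → (U * ν - Q * ν * (Q - 1ℚ)) * τ ≡ U * ν * τ - Q * ((Q - 1ℚ) * τ) * ν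
        alg₂ = solve-∀ ringℚ
        alg₃ : ∀ U ν τ Δ → U * ν * τ - Δ * U * ν ≡ U * ν * (τ - Δ)
        alg₃ = solve-∀ ringℚ
        z = y * (Q - 1ℚ)
        Q-1≤Q : Q - 1ℚ ≤ Q
        Q-1≤Q = ≤-excess 1ℚ (alg Q) 0≤1
          where
          alg : ∀ Q → Q - 1ℚ + 1ℚ ≡ Q
          alg = solve-∀ ringℚ
        0≤z : 0ℚ ≤ z
        0≤z = *-nonNeg 0≤Qν (difference≥0 1≤Q)
        z≤yQ : z ≤ y * Q
        z≤yQ = *-monoˡ-≤ 0≤Qν Q-1≤Q
        2z≤x : 2ℚ * z ≤ x
        2z≤x = ≤-trans (*-monoˡ-≤ 0≤2 z≤yQ) (≤-trans (≤-reflexive (alg Q ν)) (≤-trans 2QQν≤ε ε≤x))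
          where
          alg : ∀ Q ν → 2ℚ * (Q * ν * Q) ≡ 2ℚ * (Q * (Q * ν))
          alg = solve-∀ ringℚ
        0≤x-y′ : 0ℚ ≤ x - z
        0≤x-y′ = ≤-trans (+-nonNeg (difference≥0 2z≤x) 0≤z) (≤-reflexive (alg x z))
          where
          alg : ∀ x z → x - 2ℚ * z + z ≡ x - z
          alg = solve-∀ ringℚ
        2z≤qyx : 2ℚ * z ≤ fromℕ q * y * x
        2z≤qyx = begin
          2ℚ * z               ≤⟨ *-monoˡ-≤ 0≤2 z≤yQ ⟩
          2ℚ * (y * Q)         ≡⟨ alg y Q ⟩
          2ℚ * Q * y           ≤⟨ *-monoʳ-≤ 0≤Qν (≤-trans q-large (*-monoˡ-≤ (fromℕ-nonNeg q) ε≤x)) ⟩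
          fromℕ q * x * y      ≡⟨ alg′ (fromℕ q) x y ⟩
          fromℕ q * y * x      ∎
          where
          alg : ∀ y Q → 2ℚ * (y * Q) ≡ 2ℚ * Q * y
          alg = solve-∀ ringℚ
          alg′ : ∀ q x y → q * x * y ≡ q * y * x
          alg′ = solve-∀ ringℚ
        key : x ≤ (x - z) * (1ℚ + fromℕ q * y)
        key = *-cancelˡ-≤-pos 2ℚ (≤-excess _ (alg x z (fromℕ q * y))
          (+-nonNeg (difference≥0 2z≤qyx) (*-nonNeg (*-nonNeg (fromℕ-nonNeg q) 0≤Qν) (difference≥0 2z≤x))))
          where
          alg : ∀ x z w → 2ℚ * x + ((w * x - 2ℚ * z) + w * (x - 2ℚ * z)) ≡ 2ℚ * ((x - z) * (1ℚ + w))
          alg = solve-∀ ringℚ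

      module _ {A W H : ℚ} (0≤A : 0ℚ ≤ A) (0≤W : 0ℚ ≤ W) (QA≡Uτ+H : Q * A ≡ U * τ + H) where

        -- If H ≤ - U τ / 2, Cauchy-Schwarz gives W ≥ U τ² / 4. With τ ≥ D x^q and x ≥ ε the
        -- constant K was chosen so that the middle term of `φ` alone is then at least 1, hence at
        -- least x.
        φ-large : H * H ≤ U * W → U * τ + 2ℚ * H ≤ 0ℚ → U * ν ≤ φ U W
        φ-large H²≤UW bad = ≤-trans x≤1 (≤-trans 1≤Φ (≤-excess (ε + r * x) (alg′ ε Φ (r * x)) (+-nonNeg 0≤ε (*-nonNeg 0≤r 0≤x))))
          where
          open ≤-Reasoning
          Φ = K * (x ^ p * (W * (ν * (∂ * ∂))))
          alg′ : ∀ e f g → f + (e + g) ≡ e + f + g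
          alg′ = solve-∀ ringℚ
          0≤Uτ = *-nonNeg 0≤U 0≤τ
          Uτ≤-2H : U * τ ≤ - (2ℚ * H)
          Uτ≤-2H = ≤-trans (≤-excess (- (U * τ + 2ℚ * H)) refl (neg-antimono-≤ bad)) (≤-reflexive (alg (U * τ) H))
            where
            alg : ∀ a H → a + (- (a + 2ℚ * H)) ≡ - (2ℚ * H)
            alg = solve-∀ ringℚ
          Uττ≤4W : U * (τ * τ) ≤ 2ℚ * 2ℚ * W
          Uττ≤4W = *-cancelˡ-≤-pos U {{positive 0<U}} (begin
            U * (U * (τ * τ))              ≡⟨ alg U τ ⟩
            U * τ * (U * τ)                ≤⟨ *-mono-≤ 0≤Uτ (≤-trans 0≤Uτ Uτ≤-2H) Uτ≤-2H Uτ≤-2H ⟩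
            (- (2ℚ * H)) * (- (2ℚ * H))    ≡⟨ alg₁ H ⟩
            2ℚ * 2ℚ * (H * H)              ≤⟨ *-monoˡ-≤ (*-nonNeg 0≤2 0≤2) H²≤UW ⟩
            2ℚ * 2ℚ * (U * W)              ≡⟨ alg₂ U W ⟩
            U * (2ℚ * 2ℚ * W)              ∎)
            where
            alg : ∀ U τ → U * (U * (τ * τ)) ≡ U * τ * (U * τ)
            alg = solve-∀ ringℚ
            alg₁ : ∀ H → (- (2ℚ * H)) * (- (2ℚ * H)) ≡ 2ℚ * 2ℚ * (H * H)
            alg₁ = solve-∀ ringℚ
            alg₂ : ∀ U W → 2ℚ * 2ℚ * (U * W) ≡ U * (2ℚ * 2ℚ * W)
            alg₂ = solve-∀ ringℚ
          εq≤∂τ : ε ^ q ≤ ∂ * τ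
          εq≤∂τ = begin
            ε ^ q                ≤⟨ ^-mono q 0≤ε ε≤x ⟩
            x ^ q                ≡⟨ *-identityˡ (x ^ q) ⟨
            1ℚ * x ^ q           ≡⟨ cong (_* x ^ q) (sym ∂D≡1) ⟩
            ∂ * D * x ^ q        ≡⟨ *-assoc ∂ D (x ^ q) ⟩
            ∂ * (D * x ^ q)      ≤⟨ *-monoˡ-≤ 0≤∂ τ-large ⟩
            ∂ * τ                ∎
          0≤εq = ^-nonNeg q 0≤ε
          0≤∂τ = *-nonNeg 0≤∂ 0≤τ
          1≤Φ : 1ℚ ≤ Φ
          1≤Φ = *-cancelˡ-≤-pos (2ℚ * 2ℚ) (begin
            2ℚ * 2ℚ * 1ℚ                                            ≡⟨ *-identityʳ (2ℚ * 2ℚ) ⟩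
            2ℚ * 2ℚ                                                 ≤⟨ K-large ⟩
            K * (ε ^ p * (ε * (ε ^ q * ε ^ q)))
              ≤⟨ *-monoˡ-≤ 0≤K (*-mono-≤ (^-nonNeg p 0≤ε) (*-nonNeg 0≤x (*-nonNeg 0≤∂τ 0≤∂τ)) (^-mono p 0≤ε ε≤x)
                   (*-mono-≤ 0≤ε (*-nonNeg 0≤∂τ 0≤∂τ) ε≤x (*-mono-≤ 0≤εq 0≤∂τ εq≤∂τ εq≤∂τ))) ⟩
            K * (x ^ p * (x * (∂ * τ * (∂ * τ))))                   ≡⟨ alg₁ K (x ^ p) U ν ∂ τ ⟩
            K * (x ^ p * (U * (τ * τ) * (ν * (∂ * ∂))))             ≤⟨ *-monoˡ-≤ 0≤K (*-monoˡ-≤ (^-nonNeg p 0≤x) (*-monoʳ-≤ 0≤scale Uττ≤4W)) ⟩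
            K * (x ^ p * (2ℚ * 2ℚ * W * (ν * (∂ * ∂))))             ≡⟨ alg₂ K (x ^ p) W (ν * (∂ * ∂)) ⟩
            2ℚ * 2ℚ * Φ                                             ∎)
            where
            alg₁ : ∀ K p U ν ∂ τ → K * (p * (U * ν * (∂ * τ * (∂ * τ)))) ≡ K * (p * (U * (τ * τ) * (ν * (∂ * ∂))))
            alg₁ = solve-∀ ringℚ
            alg₂ : ∀ K p W s → K * (p * (2ℚ * 2ℚ * W * s)) ≡ 2ℚ * 2ℚ * (K * (p * (W * s)))
            alg₂ = solve-∀ ringℚ

        module _ (good : 0ℚ ≤ U * τ + 2ℚ * H) where

          -- In the good case 2 Q A = 2 U τ + 2 H is at least U τ; the target bound τ ≥ D x^q and x
          -- ≥ ε then give the lower bound on A on which the remaining estimates rest.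
          DE≤2QAν : D * ε ^ suc q ≤ 2ℚ * (Q * A * ν)
          DE≤2QAν = begin
            D * (ε * ε ^ q)               ≤⟨ *-monoˡ-≤ 0≤D (*-mono-≤ 0≤ε (^-nonNeg q 0≤x) ε≤x (^-mono q 0≤ε ε≤x)) ⟩
            D * (x * x ^ q)               ≡⟨ alg₁ D x (x ^ q) ⟩
            x * (D * x ^ q)               ≤⟨ *-monoˡ-≤ 0≤x τ-large ⟩
            x * τ                         ≤⟨ ≤-excess ((U * τ + 2ℚ * H) * ν) (alg₂ U ν τ H) (*-nonNeg good 0≤ν) ⟩
            2ℚ * ((U * τ + H) * ν)        ≡⟨ cong (λ z → 2ℚ * (z * ν)) QA≡Uτ+H ⟨
            2ℚ * (Q * A * ν)              ∎
            where
            open ≤-Reasoning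
            alg₁ : ∀ D x p → D * (x * p) ≡ x * (D * p)
            alg₁ = solve-∀ ringℚ
            alg₂ : ∀ U ν τ H → U * ν * τ + (U * τ + 2ℚ * H) * ν ≡ 2ℚ * ((U * τ + H) * ν)
            alg₂ = solve-∀ ringℚ

          A-pos : 0ℚ < A
          A-pos with A ≤? 0ℚ
          ... | no A≰0 = ≰⇒> A≰0
          ... | yes A≤0 = contradiction refl (<⇒≢ (<-≤-trans (positive⁻¹ (D * ε ^ suc q)
                  {{pos*pos⇒pos D {{positive 0<D}} (ε ^ suc q) {{positive (^-pos (suc q) 0<ε)}}}}) DE≤0))
            where
            alg : ∀ Q ν → 2ℚ * (Q * 0ℚ * ν) ≡ 0ℚ
            alg = solve-∀ ringℚ
            DE≤0 : D * ε ^ suc q ≤ 0ℚ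
            DE≤0 = ≤-trans DE≤2QAν (≤-reflexive (trans (cong (λ a → 2ℚ * (Q * a * ν)) (≤-antisym A≤0 0≤A)) (alg Q ν)))

          -- The factor 1 + 2D/A is at most 1 + p y with y = Q / N, by the lower bound on A and the
          -- choice of p; Bernoulli absorbs it in the passage from x to x′.
          growth : x′ ^ p * (A + 2ℚ * D) ≤ A * x ^ p
          growth = begin
            x′ ^ p * (A + 2ℚ * D)              ≤⟨ *-monoˡ-≤ (^-nonNeg p 0≤x′) (+-monoʳ-≤ A 2D≤) ⟩
            x′ ^ p * (A + fromℕ p * y * A)     ≡⟨ alg (x′ ^ p) A (fromℕ p * y) ⟩
            A * ((1ℚ + fromℕ p * y) * x′ ^ p)  ≤⟨ *-monoˡ-≤ 0≤A (drop p) ⟩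
            A * x ^ p                          ∎
            where
            open ≤-Reasoning
            alg : ∀ a A z → a * (A + z * A) ≡ A * ((1ℚ + z) * a)
            alg = solve-∀ ringℚ
            alg₁ : ∀ p e D → p * e * D ≡ p * (D * e)
            alg₁ = solve-∀ ringℚ
            alg₂ : ∀ p Q A ν → p * (2ℚ * (Q * A * ν)) ≡ 2ℚ * (p * (Q * ν) * A)
            alg₂ = solve-∀ ringℚ
            2D≤ : 2ℚ * D ≤ fromℕ p * y * A
            2D≤ = *-cancelˡ-≤-pos 2ℚ (begin
              2ℚ * (2ℚ * D)                       ≡⟨ *-assoc 2ℚ 2ℚ D ⟨
              2ℚ * 2ℚ * D                         ≤⟨ *-monoʳ-≤ 0≤D p-large ⟩
              fromℕ p * ε ^ suc q * D             ≡⟨ alg₁ (fromℕ p) (ε ^ suc q) D ⟩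
              fromℕ p * (D * ε ^ suc q)           ≤⟨ *-monoˡ-≤ (fromℕ-nonNeg p) DE≤2QAν ⟩
              fromℕ p * (2ℚ * (Q * A * ν))        ≡⟨ alg₂ (fromℕ p) Q A ν ⟩
              2ℚ * (fromℕ p * y * A)              ∎)

          -- Each step lowers the term r x of `φ` by r Q / N. Over the A selectable edges this
          -- amounts to `A * (r * y)`, which pays for the additive error of the drift.
          error : K * (x′ ^ p * (6ℚ * (N * (Q * (Q * (ρ * D))) * (D * D)) * (ν * (∂ * ∂)))) ≤ A * (r * y)
          error = begin
            K * (x′ ^ p * (6ℚ * (N * (Q * (Q * (ρ * D))) * (D * D)) * (ν * (∂ * ∂))))
              ≡⟨ alg₁ K (x′ ^ p) N Q ρ D ν ∂ ⟩
            x′ ^ p * (K * (6ℚ * (Q * (Q * ρ))) * D * (ν * N) * (∂ * D * (∂ * D)))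
              ≡⟨ cong₂ (λ a b → x′ ^ p * (K * (6ℚ * (Q * (Q * ρ))) * D * a * (b * b))) νN≡1 ∂D≡1 ⟩
            x′ ^ p * (K * (6ℚ * (Q * (Q * ρ))) * D * 1ℚ * (1ℚ * 1ℚ))
              ≤⟨ *-monoʳ-≤ 0≤z (^≤1 p 0≤x′ x′≤1) ⟩
            1ℚ * (K * (6ℚ * (Q * (Q * ρ))) * D * 1ℚ * (1ℚ * 1ℚ))
              ≡⟨ alg₂ (K * (6ℚ * (Q * (Q * ρ)))) D ⟩
            K * (6ℚ * (Q * (Q * ρ))) * D
              ≤⟨ half ⟩
            A * (r * y) ∎
            where
            open ≤-Reasoning
            alg₁ : ∀ K x N Q ρ D ν ∂ → K * (x * (6ℚ * (N * (Q * (Q * (ρ * D))) * (D * D)) * (ν * (∂ * ∂)))) ≡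
                   x * (K * (6ℚ * (Q * (Q * ρ))) * D * (ν * N) * (∂ * D * (∂ * D)))
            alg₁ = solve-∀ ringℚ
            alg₂ : ∀ c D → 1ℚ * (c * D * 1ℚ * (1ℚ * 1ℚ)) ≡ c * D
            alg₂ = solve-∀ ringℚ
            alg₃ : ∀ c D → 2ℚ * (c * D) ≡ 2ℚ * c * D
            alg₃ = solve-∀ ringℚ
            alg₄ : ∀ r e D → r * e * D ≡ r * (D * e)
            alg₄ = solve-∀ ringℚ
            alg₅ : ∀ r Q A ν → r * (2ℚ * (Q * A * ν)) ≡ 2ℚ * (A * (r * (Q * ν)))
            alg₅ = solve-∀ ringℚ
            0≤6 : 0ℚ ≤ 6ℚ
            0≤6 = *-nonNeg 0≤2 (+-nonNeg 0≤2 0≤1)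
            0≤z : 0ℚ ≤ K * (6ℚ * (Q * (Q * ρ))) * D * 1ℚ * (1ℚ * 1ℚ)
            0≤z = *-nonNeg (*-nonNeg (*-nonNeg (*-nonNeg 0≤K (*-nonNeg 0≤6 (*-nonNeg 0≤Q (*-nonNeg 0≤Q 0≤ρ)))) 0≤D) 0≤1) 0≤1
            half : K * (6ℚ * (Q * (Q * ρ))) * D ≤ A * (r * y)
            half = *-cancelˡ-≤-pos 2ℚ (begin
              2ℚ * (K * (6ℚ * (Q * (Q * ρ))) * D)      ≡⟨ alg₃ (K * (6ℚ * (Q * (Q * ρ)))) D ⟩
              2ℚ * (K * (6ℚ * (Q * (Q * ρ)))) * D      ≤⟨ *-monoʳ-≤ 0≤D r-large ⟩
              r * ε ^ suc q * D                        ≡⟨ alg₄ r (ε ^ suc q) D ⟩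
              r * (D * ε ^ suc q)                      ≤⟨ *-monoˡ-≤ 0≤r DE≤2QAν ⟩
              r * (2ℚ * (Q * A * ν))                   ≡⟨ alg₅ r Q A ν ⟩
              2ℚ * (A * (r * y))                       ∎)

          -- `S` stands for the sum of the new deviations over all selectable edges. Since `φ` is
          -- affine in the deviation, the left side is the sum of the new values of `φ`, in a form
          -- free of division by A.
          φ-supermartingale : ∀ {S} → S ≤ (A + 2ℚ * D) * W + 6ℚ * (N * (Q * (Q * (ρ * D))) * (D * D)) →
            A * ε + K * (x′ ^ p * (S * (ν * (∂ * ∂)))) + A * (r * x′) ≤ A * φ U W
          φ-supermartingale {S} S≤ = begin
            A * ε + K * (x′ ^ p * (S * s)) + A * (r * x′)
              ≤⟨ +-monoˡ-≤ (A * (r * x′)) (+-monoʳ-≤ (A * ε) (*-monoˡ-≤ 0≤K (*-monoˡ-≤ (^-nonNeg p 0≤x′) (*-monoʳ-≤ 0≤scale S≤)))) ⟩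
            A * ε + K * (x′ ^ p * (((A + 2ℚ * D) * W + B) * s)) + A * (r * x′)
              ≡⟨ alg₁ A ε K (x′ ^ p) D W B s (r * x′) ⟩
            A * ε + K * (W * s) * (x′ ^ p * (A + 2ℚ * D)) + K * (x′ ^ p * (B * s)) + A * (r * x′)
              ≤⟨ +-monoˡ-≤ (A * (r * x′)) (+-mono-≤ (+-monoʳ-≤ (A * ε) (*-monoˡ-≤ (*-nonNeg 0≤K (*-nonNeg 0≤W 0≤scale)) growth)) error) ⟩
            A * ε + K * (W * s) * (A * x ^ p) + A * (r * y) + A * (r * x′)
              ≡⟨ alg₂ A ε K W s (x ^ p) r U Q ν ⟩
            A * φ U W ∎
            where
            open ≤-Reasoning
            s = ν * (∂ * ∂)
            B = 6ℚ * (N * (Q * (Q * (ρ * D))) * (D * D))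
            alg₁ : ∀ A ε K z D W B s r → A * ε + K * (z * (((A + 2ℚ * D) * W + B) * s)) + A * r ≡
                   A * ε + K * (W * s) * (z * (A + 2ℚ * D)) + K * (z * (B * s)) + A * r
            alg₁ = solve-∀ ringℚ
            alg₂ : ∀ A ε K W s z r U Q ν → A * ε + K * (W * s) * (A * z) + A * (r * (Q * ν)) + A * (r * ((U - Q) * ν)) ≡
                   A * (ε + K * (z * (W * s)) + r * (U * ν))
            alg₂ = solve-∀ ringℚ

  -- Conditioning on the first element of a random ordering

  module _ {a} {A : Set a} where

    ∑ₗ-distrib-+ : ∀ xs (f g : A → ℚ) → ∑ₗ xs (λ x → f x + g x) ≡ ∑ₗ xs f + ∑ₗ xs g
    ∑ₗ-distrib-+ []       f g = refl
    ∑ₗ-distrib-+ (x ∷ xs) f g = trans (cong (f x + g x +_) (∑ₗ-distrib-+ xs f g)) (alg (f x) (g x) (∑ₗ xs f) (∑ₗ xs g))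
      where
      alg : ∀ a b c d → a + b + (c + d) ≡ a + c + (b + d)
      alg = solve-∀ ringℚ

    ∑ₗ-*ˡ : ∀ xs c (f : A → ℚ) → ∑ₗ xs (λ x → c * f x) ≡ c * ∑ₗ xs f
    ∑ₗ-*ˡ []       c f = sym (*-zeroʳ c)
    ∑ₗ-*ˡ (x ∷ xs) c f = trans (cong (c * f x +_) (∑ₗ-*ˡ xs c f)) (sym (*-distribˡ-+ c (f x) (∑ₗ xs f)))

    ∑ₗ-↭ : ∀ {xs ys} (f : A → ℚ) → xs ↭ ys → ∑ₗ xs f ≡ ∑ₗ ys f
    ∑ₗ-↭ f ↭.refl        = refl
    ∑ₗ-↭ f (prep x p)    = cong (f x +_) (∑ₗ-↭ f p)
    ∑ₗ-↭ f (swap {xs} {ys} x y p)  = trans (cong (λ s → f x + (f y + s)) (∑ₗ-↭ f p)) (alg (f x) (f y) (∑ₗ ys f))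
      where
      alg : ∀ a b c → a + (b + c) ≡ b + (a + c)
      alg = solve-∀ ringℚ
    ∑ₗ-↭ f (↭.trans p q) = trans (∑ₗ-↭ f p) (∑ₗ-↭ f q)

    ∑ₗ-concatMap : ∀ {b} {B : Set b} (h : B → List A) xs (f : A → ℚ) →
                   ∑ₗ (concatMap h xs) f ≡ ∑ₗ xs (λ x → ∑ₗ (h x) f)
    ∑ₗ-concatMap h []       f = refl
    ∑ₗ-concatMap h (x ∷ xs) f = trans (∑ₗ-++ (h x) (concatMap h xs) f) (cong (∑ₗ (h x) f +_) (∑ₗ-concatMap h xs f))

  module _ {a} {A : Set a} where

    picks : List A → List (A × List A)
    picks []       = []
    picks (x ∷ xs) = (x , xs) ∷ map (λ (y , ys) → y , x ∷ ys) (picks xs)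

    picks-↭ : ∀ xs {z zs} → (z , zs) ∈ picks xs → xs ↭ z ∷ zs
    picks-↭ (x ∷ xs) (here refl) = ↭-refl
    picks-↭ (x ∷ xs) (there p) with ∈-map⁻ (λ (y , ys) → y , x ∷ ys) p
    ... | _ , q , refl = ↭-trans (prep x (picks-↭ xs q)) (swap x _ ↭-refl)

    ∑ₗ-picks : ∀ xs (f : A → ℚ) → ∑ₗ (picks xs) (f ∘ proj₁) ≡ ∑ₗ xs f
    ∑ₗ-picks []       f = refl
    ∑ₗ-picks (x ∷ xs) f = cong (f x +_) (trans (∑ₗ-map (λ (y , ys) → y , x ∷ ys) (picks xs) (f ∘ proj₁)) (∑ₗ-picks xs f))

    -- This conditions on the first element of the permutation; the definition of permutations
    -- conditions on the position of x.
    ∑ₗ-permutations : ∀ x xs (g : List A → ℚ) → ∑ₗ (permutations (x ∷ xs)) g ≡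
      ∑ₗ (picks (x ∷ xs)) (λ (z , zs) → ∑ₗ (permutations zs) (λ σ → g (z ∷ σ)))
    ∑ₗ-permutations x xs g = begin
      ∑ₗ (permutations (x ∷ xs)) g
        ≡⟨ ∑ₗ-concatMap (insertions x) (permutations xs) g ⟩
      ∑ₗ (permutations xs) (λ σ → ∑ₗ (insertions x σ) g)
        ≡⟨ ∑ₗ-cong (permutations xs) split ⟩
      ∑ₗ (permutations xs) (λ σ → g (x ∷ σ) + later σ)
        ≡⟨ ∑ₗ-distrib-+ (permutations xs) (λ σ → g (x ∷ σ)) later ⟩
      ∑ₗ (permutations xs) (λ σ → g (x ∷ σ)) + ∑ₗ (permutations xs) later
        ≡⟨ cong (∑ₗ (permutations xs) (λ σ → g (x ∷ σ)) +_) (∑later xs) ⟩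
      ∑ₗ (permutations xs) (λ σ → g (x ∷ σ)) +
        ∑ₗ (picks xs) (λ (z , zs) → ∑ₗ (permutations (x ∷ zs)) (λ σ → g (z ∷ σ)))
        ≡⟨ cong (∑ₗ (permutations xs) (λ σ → g (x ∷ σ)) +_) (∑ₗ-map (λ (y , ys) → y , x ∷ ys) (picks xs) _) ⟨
      ∑ₗ (picks (x ∷ xs)) (λ (z , zs) → ∑ₗ (permutations zs) (λ σ → g (z ∷ σ))) ∎
      where
      open ≡-Reasoning
      later : List A → ℚ
      later []      = 0ℚ
      later (z ∷ σ) = ∑ₗ (insertions x σ) (λ ρ → g (z ∷ ρ))
      split : ∀ σ → ∑ₗ (insertions x σ) g ≡ g (x ∷ σ) + later σ
      split []      = refl
      split (z ∷ σ) = cong (g (x ∷ z ∷ σ) +_) (∑ₗ-map (z ∷_) (insertions x σ) g)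
      ∑later : ∀ xs → ∑ₗ (permutations xs) later ≡
               ∑ₗ (picks xs) (λ (z , zs) → ∑ₗ (permutations (x ∷ zs)) (λ σ → g (z ∷ σ)))
      ∑later []       = refl
      -- The induction uses the test function `later`, which inserts x behind the first element and
      -- so keeps that element first.
      ∑later (y ∷ ys) = trans (∑ₗ-permutations y ys later)
        (∑ₗ-cong (picks (y ∷ ys)) λ (z , zs) → sym (∑ₗ-concatMap (insertions x) (permutations zs) (λ σ → g (z ∷ σ))))

    ∑ₗ-permutations-const : ∀ m (xs : List A) → length xs ≡ m → ∀ c → ∑ₗ (permutations xs) (λ _ → c) ≡ fromℕ (m !) * c
    ∑ₗ-permutations-const zero    []       _    c = alg c
      where
      alg : ∀ c → c + 0ℚ ≡ (1ℚ + 0ℚ) * c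
      alg = solve-∀ ringℚ
    ∑ₗ-permutations-const (suc m) (x ∷ xs) len c = ≤-antisym
        (≤-trans (≤-reflexive (∑ₗ-permutations x xs (λ _ → c)))
          (≤-trans (∑ₗ-mono (picks (x ∷ xs)) (λ p → ≤-reflexive (same p))) (≤-reflexive total)))
        (≤-trans (≤-reflexive (sym total)) (≤-trans (∑ₗ-mono (picks (x ∷ xs)) (λ p → ≤-reflexive (sym (same p))))
          (≤-reflexive (sym (∑ₗ-permutations x xs (λ _ → c))))))
      where
      same : ∀ {p} → p ∈ picks (x ∷ xs) → ∑ₗ (permutations (proj₂ p)) (λ _ → c) ≡ fromℕ (m !) * c
      same {z , zs} p = ∑ₗ-permutations-const m zs
        (ℕ.suc-injective (trans (sym (↭-length (picks-↭ (x ∷ xs) p))) len)) c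
      total : ∑ₗ (picks (x ∷ xs)) (λ _ → fromℕ (m !) * c) ≡ fromℕ (suc m !) * c
      total = begin
        ∑ₗ (picks (x ∷ xs)) (λ _ → fromℕ (m !) * c)   ≡⟨ ∑ₗ-picks (x ∷ xs) (λ _ → fromℕ (m !) * c) ⟩
        ∑ₗ (x ∷ xs) (λ _ → fromℕ (m !) * c)           ≡⟨ ∑ₗ-const (x ∷ xs) (fromℕ (m !) * c) ⟩
        fromℕ (suc (length xs)) * (fromℕ (m !) * c)   ≡⟨ cong (λ l → fromℕ l * (fromℕ (m !) * c)) len ⟩
        fromℕ (suc m) * (fromℕ (m !) * c)             ≡⟨ *-assoc (fromℕ (suc m)) (fromℕ (m !)) c ⟨
        fromℕ (suc m) * fromℕ (m !) * c               ≡⟨ cong (_* c) (fromℕ-* (suc m) (m !)) ⟨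
        fromℕ (suc m !) * c                           ∎
        where open ≡-Reasoning

  find-skip : ∀ {a p} {A : Set a} {P : Pred A p} (P? : Decidable P) xs {ys} → All (¬_ ∘ P) xs →
              find P? (xs ++ ys) ≡ find P? ys
  find-skip P? []       []         = refl
  find-skip P? (x ∷ xs) (¬p ∷ ¬ps) with P? x
  ... | yes p = contradiction p ¬p
  ... | no  _ = find-skip P? xs ¬ps

  find-head : ∀ {a p} {A : Set a} {P : Pred A p} (P? : Decidable P) x {xs} → P x → find P? (x ∷ xs) ≡ just x
  find-head P? x p with P? x
  ... | yes _ = refl
  ... | no ¬p = contradiction p ¬p

  -- The greedy loop as a single pass, and the supermartingale argument

  module Greedy {v : ℕ} (t k : ℕ) (t≤k : t ℕ.≤ k) where

    sel : List (Subset v) → Subset v → ℚ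
    sel 𝓑 B = ⟦ selectable? t 𝓑 B ⟧

    -- A set that is not selectable never becomes so again, hence restarting the search at the front
    -- of the ordering never finds anything before the current position. A single pass uses up the
    -- ordering, which makes conditioning on its first element possible.
    pass : List (Subset v) → List (Subset v) → List (Subset v)
    pass []      𝓑 = 𝓑
    pass (B ∷ σ) 𝓑 with selectable? t 𝓑 B
    ... | yes _ = pass σ (B ∷ 𝓑)
    ... | no  _ = pass σ 𝓑

    private
      Skipped : List (Subset v) → Subset v → Set
      Skipped 𝓑 B = ¬ Selectable t 𝓑 B

    -- `ρ` is the part of the ordering already read. It collects rejected and chosen sets alike: a
    -- chosen set is unselectable from then on because it contains a t-set, now covered by itself.
    greedyLoop-pass : ∀ m ρ σ 𝓑 → All (Skipped 𝓑) ρ → All (λ B → ∣ B ∣ ≡ k) σ → length σ ℕ.≤ m →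
                      greedyLoop t m (ρ ++ σ) 𝓑 ≡ pass σ 𝓑
    greedyLoop-pass zero    ρ []      𝓑 sk sz _ = refl
    greedyLoop-pass (suc m) ρ []      𝓑 sk sz _
      with find (selectable? t 𝓑) (ρ ++ []) | find-skip (selectable? t 𝓑) ρ {[]} sk
    ... | nothing | _ = refl
    ... | just _  | ()
    greedyLoop-pass (suc m) ρ (B ∷ σ) 𝓑 sk (szB ∷ sz) (s≤s l) with selectable? t 𝓑 B
    ... | no ¬s = trans (cong (λ τ → greedyLoop t (suc m) τ 𝓑) (sym (++-assoc ρ (B ∷ []) σ)))
                    (greedyLoop-pass (suc m) (ρ ++ B ∷ []) σ 𝓑 (++⁺ sk (¬s ∷ [])) sz (ℕ.m≤n⇒m≤1+n l))
    ... | yes s = chosen found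
      where
      found : find (selectable? t 𝓑) (ρ ++ B ∷ σ) ≡ just B
      found = trans (find-skip (selectable? t 𝓑) ρ {B ∷ σ} sk) (find-head (selectable? t 𝓑) B {σ} s)
      chosen : find (selectable? t 𝓑) (ρ ++ B ∷ σ) ≡ just B →
               greedyLoop t (suc m) (ρ ++ B ∷ σ) 𝓑 ≡ pass σ (B ∷ 𝓑)
      chosen found rewrite found = trans (cong (λ τ → greedyLoop t m τ (B ∷ 𝓑)) (sym (++-assoc ρ (B ∷ []) σ)))
        (greedyLoop-pass m (ρ ++ B ∷ []) σ (B ∷ 𝓑)
          (++⁺ (All.map (_∘ selectable-∷ t≤k) sk) (chosen-unselectable t≤k {𝓑 = 𝓑} szB ∷ [])) sz l)

    greedy-pass : ∀ {σ} → σ ∈ orderings v k → greedy t σ ≡ pass σ []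
    greedy-pass {σ} σ∈ = greedyLoop-pass (length σ) [] σ [] [] (ordering-size σ∈) ℕ.≤-refl

    E : List (Subset v)
    E = subsetsOfSize v k

    -- The unread sets include every selectable k-set with the right multiplicity. Testing against
    -- all weights `g` expresses this in exactly the form in which the averages need it.
    Remaining : List (Subset v) → List (Subset v) → Set
    Remaining xs 𝓑 = ∀ (g : Subset v → ℚ) → ∑ₗ xs (λ B → sel 𝓑 B * g B) ≡ ∑ₗ E (λ B → sel 𝓑 B * g B)

    private
      drop-unselected : ∀ {xs 𝓑 z zs} → Remaining xs 𝓑 → xs ↭ z ∷ zs → ¬ Selectable t 𝓑 z → Remaining zs 𝓑
      drop-unselected {xs} {𝓑} {z} {zs} rem p ¬s g = begin
        ∑ₗ zs s                ≡⟨ +-identityˡ (∑ₗ zs s) ⟨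
        0ℚ + ∑ₗ zs s           ≡⟨ cong (_+ ∑ₗ zs s) (trans (sym (*-zeroˡ (g z))) (cong (_* g z) (sym (⟦⟧-false (selectable? t 𝓑 z) ¬s)))) ⟩
        s z + ∑ₗ zs s          ≡⟨ ∑ₗ-↭ s p ⟨
        ∑ₗ xs s                ≡⟨ rem g ⟩
        ∑ₗ E s                 ∎
        where
        open ≡-Reasoning
        s = λ B → sel 𝓑 B * g B

      drop-selected : ∀ {xs 𝓑 z zs} → Remaining xs 𝓑 → xs ↭ z ∷ zs → ∣ z ∣ ≡ k → Remaining zs (z ∷ 𝓑)
      drop-selected {xs} {𝓑} {z} {zs} rem p ∣z∣ g = begin
        ∑ₗ zs s′                                ≡⟨ +-identityˡ (∑ₗ zs s′) ⟨
        0ℚ + ∑ₗ zs s′                           ≡⟨ cong (_+ ∑ₗ zs s′) (trans (sym (*-zeroˡ (g z)))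
                                                     (cong (_* g z) (sym (⟦⟧-false (selectable? t (z ∷ 𝓑) z) (chosen-unselectable t≤k {𝓑 = 𝓑} ∣z∣))))) ⟩
        s′ z + ∑ₗ zs s′                         ≡⟨ ∑ₗ-↭ s′ p ⟨
        ∑ₗ xs s′                                ≡⟨ ∑ₗ-cong xs restrict ⟩
        ∑ₗ xs (λ B → sel 𝓑 B * s′ B)            ≡⟨ rem s′ ⟩
        ∑ₗ E (λ B → sel 𝓑 B * s′ B)             ≡⟨ ∑ₗ-cong E restrict ⟨
        ∑ₗ E s′                                 ∎
        where
        open ≡-Reasoning
        s′ = λ B → sel (z ∷ 𝓑) B * g B
        restrict : ∀ B → s′ B ≡ sel 𝓑 B * s′ B
        restrict B = trans (cong (_* g B) (sym (⟦⟧-* (selectable? t 𝓑 B) (selectable? t (z ∷ 𝓑) B) (selectable? t (z ∷ 𝓑) B)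
          (λ _ s → s) (λ s → selectable-∷ t≤k {𝓑 = 𝓑} s , s)))) (*-assoc (sel 𝓑 B) (sel (z ∷ 𝓑) B) (g B))

    module _ (value : List (Subset v) → ℚ) (value-∷ : ∀ B 𝓑 → value (B ∷ 𝓑) ≤ value 𝓑) where

      value-pass : ∀ σ 𝓑 → value (pass σ 𝓑) ≤ value 𝓑
      value-pass []      𝓑 = ≤-refl
      value-pass (B ∷ σ) 𝓑 with selectable? t 𝓑 B
      ... | yes _ = ≤-trans (value-pass σ (B ∷ 𝓑)) (value-∷ B 𝓑)
      ... | no  _ = value-pass σ 𝓑

      -- `Bound` relates a family to admissible values of the potential; it is a relation because
      -- the potential also depends on the target. Either the value is already at most c, and stays
      -- so by monotonicity, or choosing a uniform selectable set does not raise c on average.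
      module _ (Bound : List (Subset v) → ℚ → Set)
        (step : ∀ 𝓑 c → Bound 𝓑 c → value 𝓑 ≤ c ⊎ Σ[ c′ ∈ (Subset v → ℚ) ]
          (0ℚ < ∑ₗ E (sel 𝓑)) ×
          (∀ B → ∣ B ∣ ≡ k → Selectable t 𝓑 B → Bound (B ∷ 𝓑) (c′ B)) ×
          (∑ₗ E (λ B → sel 𝓑 B * c′ B) ≤ ∑ₗ E (sel 𝓑) * c))
        where

        -- A supermartingale bound: conditioning on the first element z of the ordering, either z is
        -- skipped or it is uniformly distributed over the selectable sets.
        expected-value : ∀ m xs 𝓑 c → length xs ≡ m → All (λ B → ∣ B ∣ ≡ k) xs → Remaining xs 𝓑 → Bound 𝓑 c →
                         ∑ₗ (permutations xs) (λ σ → value (pass σ 𝓑)) ≤ fromℕ (m !) * c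
        expected-value m xs 𝓑 c len sz rem bd with step 𝓑 c bd
        ... | inj₁ v≤c = ≤-trans (∑ₗ-mono (permutations xs) λ {σ} _ → ≤-trans (value-pass σ 𝓑) v≤c)
                                 (≤-reflexive (∑ₗ-permutations-const m xs len c))
        expected-value zero [] 𝓑 c len sz rem bd | inj₂ (_ , 0<A , _) =
          contradiction (subst (0ℚ <_) A≡0 0<A) (<-irrefl refl)
          where
          A≡0 : ∑ₗ E (sel 𝓑) ≡ 0ℚ
          A≡0 = trans (∑ₗ-cong E λ B → sym (*-identityʳ (sel 𝓑 B))) (sym (rem λ _ → 1ℚ))
        expected-value (suc m) (x ∷ xs) 𝓑 c len sz rem bd | inj₂ (c′ , _ , next , avg) = begin
          ∑ₗ (permutations (x ∷ xs)) (λ σ → value (pass σ 𝓑))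
            ≡⟨ ∑ₗ-permutations x xs (λ σ → value (pass σ 𝓑)) ⟩
          ∑ₗ (picks (x ∷ xs)) (λ (z , zs) → ∑ₗ (permutations zs) (λ σ → value (pass (z ∷ σ) 𝓑)))
            ≤⟨ ∑ₗ-mono (picks (x ∷ xs)) (λ {(z , zs)} p → first (picks-↭ (x ∷ xs) p)) ⟩
          ∑ₗ (picks (x ∷ xs)) (λ (z , zs) → fromℕ (m !) * (sel 𝓑 z * c′ z + (1ℚ - sel 𝓑 z) * c))
            ≡⟨ ∑ₗ-picks (x ∷ xs) (λ z → fromℕ (m !) * (sel 𝓑 z * c′ z + (1ℚ - sel 𝓑 z) * c)) ⟩
          ∑ₗ (x ∷ xs) (λ z → fromℕ (m !) * (sel 𝓑 z * c′ z + (1ℚ - sel 𝓑 z) * c))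
            ≡⟨ ∑ₗ-*ˡ (x ∷ xs) (fromℕ (m !)) (λ z → sel 𝓑 z * c′ z + (1ℚ - sel 𝓑 z) * c) ⟩
          fromℕ (m !) * ∑ₗ (x ∷ xs) (λ z → sel 𝓑 z * c′ z + (1ℚ - sel 𝓑 z) * c)
            ≡⟨ cong (fromℕ (m !) *_) (trans (∑ₗ-cong (x ∷ xs) λ z → alg₁ (sel 𝓑 z) (c′ z) c)
                 (∑ₗ-distrib-+ (x ∷ xs) (λ _ → c) (λ z → sel 𝓑 z * (c′ z - c)))) ⟩
          fromℕ (m !) * (∑ₗ (x ∷ xs) (λ _ → c) + ∑ₗ (x ∷ xs) (λ z → sel 𝓑 z * (c′ z - c)))
            -- `rem` passes from the unread sets to all k-sets, over which `avg` is stated.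
            ≡⟨ cong₂ (λ p q → fromℕ (m !) * (p + q)) (trans (∑ₗ-const (x ∷ xs) c) (cong (λ l → fromℕ l * c) len)) (rem (λ z → c′ z - c)) ⟩
          fromℕ (m !) * (fromℕ (suc m) * c + ∑ₗ E (λ z → sel 𝓑 z * (c′ z - c)))
            ≤⟨ *-monoˡ-≤ (fromℕ-nonNeg (m !)) (≤-excess _ (alg₃ (fromℕ (suc m) * c) (∑ₗ E (λ z → sel 𝓑 z * (c′ z - c)))) nonpos) ⟩
          fromℕ (m !) * (fromℕ (suc m) * c)
            ≡⟨ alg₄ (fromℕ (m !)) (fromℕ (suc m)) c ⟩
          fromℕ (suc m) * fromℕ (m !) * c
            ≡⟨ cong (_* c) (fromℕ-* (suc m) (m !)) ⟨
          fromℕ (suc m !) * c ∎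
          where
          open ≤-Reasoning
          alg₁ : ∀ s c′ c → s * c′ + (1ℚ - s) * c ≡ c + s * (c′ - c)
          alg₁ = solve-∀ ringℚ
          alg₂ : ∀ s c′ c → s * (c′ - c) ≡ s * c′ + (- c) * s
          alg₂ = solve-∀ ringℚ
          alg₃ : ∀ x y → x + y + (- y) ≡ x
          alg₃ = solve-∀ ringℚ
          alg₄ : ∀ m l c → m * (l * c) ≡ l * m * c
          alg₄ = solve-∀ ringℚ
          alg₅ : ∀ A c s → A * c - s ≡ - (s + (- c) * A)
          alg₅ = solve-∀ ringℚ
          nonpos : 0ℚ ≤ - ∑ₗ E (λ z → sel 𝓑 z * (c′ z - c))
          nonpos = subst (0ℚ ≤_) (trans (alg₅ (∑ₗ E (sel 𝓑)) c (∑ₗ E (λ z → sel 𝓑 z * c′ z)))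
            (cong -_ (sym (trans (∑ₗ-cong E λ z → alg₂ (sel 𝓑 z) (c′ z) c)
              (trans (∑ₗ-distrib-+ E (λ z → sel 𝓑 z * c′ z) (λ z → (- c) * sel 𝓑 z))
                (cong (∑ₗ E (λ z → sel 𝓑 z * c′ z) +_) (∑ₗ-*ˡ E (- c) (sel 𝓑))))))))
            (difference≥0 avg)
          first : ∀ {z zs} → x ∷ xs ↭ z ∷ zs → ∑ₗ (permutations zs) (λ σ → value (pass (z ∷ σ) 𝓑)) ≤
                  fromℕ (m !) * (sel 𝓑 z * c′ z + (1ℚ - sel 𝓑 z) * c)
          first {z} {zs} p with All-resp-↭ p sz | selectable? t 𝓑 z
          ... | ∣z∣ ∷ sz′ | yes s = ≤-trans
                (expected-value m zs (z ∷ 𝓑) (c′ z) len′ sz′ (drop-selected {𝓑 = 𝓑} rem p ∣z∣) (next z ∣z∣ s))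
                (≤-reflexive (cong (fromℕ (m !) *_) (alg (c′ z) c)))
            where
            len′ = trans (sym (ℕ.suc-injective (↭-length p))) (ℕ.suc-injective len)
            alg : ∀ c′ c → c′ ≡ 1ℚ * c′ + (1ℚ - 1ℚ) * c
            alg = solve-∀ ringℚ
          ... | ∣z∣ ∷ sz′ | no ¬s = ≤-trans
                (expected-value m zs 𝓑 c len′ sz′ (drop-unselected {𝓑 = 𝓑} rem p ¬s) bd)
                (≤-reflexive (cong (fromℕ (m !) *_) (alg (c′ z) c)))
            where
            len′ = trans (sym (ℕ.suc-injective (↭-length p))) (ℕ.suc-injective len)
            alg : ∀ c′ c → c ≡ 0ℚ * c′ + (1ℚ - 0ℚ) * c
            alg = solve-∀ ringℚ

  -- The greedy covering algorithm

  ⟦⟧-¬ : ∀ {p} {P : Set p} (P? : Dec P) → ⟦ ¬? P? ⟧ ≡ 1ℚ - ⟦ P? ⟧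
  ⟦⟧-¬ (yes _) = refl
  ⟦⟧-¬ (no  _) = refl

  ⟦⟧-*-cong : ∀ {p} {P : Set p} (P? : Dec P) {x y} → (P → x ≡ y) → ⟦ P? ⟧ * x ≡ ⟦ P? ⟧ * y
  ⟦⟧-*-cong (yes p) x≡y = cong (1ℚ *_) (x≡y p)
  ⟦⟧-*-cong (no _) {x} {y} _ = trans (*-zeroˡ x) (sym (*-zeroˡ y))

  module Process (v k t j w : ℕ) (k≡t+1+j : k ≡ t ℕ.+ suc j) (v≡t+1+w : v ≡ t ℕ.+ suc w)
    (1≤t : 1 ℕ.≤ t) (j≤w : j ℕ.≤ w) where

    open Hypergraph v k t j w k≡t+1+j v≡t+1+w public

    t≤k : t ℕ.≤ k
    t≤k = subst (t ℕ.≤_) (sym k≡t+1+j) (ℕ.m≤m+n t (suc j))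

    open Greedy {v} t k t≤k

    u : List (Subset v) → Fin n → ℚ
    u 𝓑 T = ⟦ ¬? (covered? 𝓑 (vertex T)) ⟧

    a : List (Subset v) → Fin M → ℚ
    a 𝓑 e = sel 𝓑 (edge e)

    Meet : Subset v → Subset v → Set
    Meet B B′ = Any (λ T → T ⊆ B × T ⊆ B′) (subsetsOfSize v t)

    meet? : ∀ B B′ → Dec (Meet B B′)
    meet? B B′ = any? (λ T → T ⊆? B ×-dec T ⊆? B′) (subsetsOfSize v t)

    m : Fin M → Fin M → ℚ
    m f e = ⟦ meet? (edge f) (edge e) ⟧

    u-∷ : ∀ B 𝓑 T → u (B ∷ 𝓑) T ≡ u 𝓑 T * (1ℚ - ⟦ vertex T ⊆? B ⟧)
    u-∷ B 𝓑 T = trans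
      (sym (⟦⟧-* (¬? (covered? 𝓑 (vertex T))) (¬? (vertex T ⊆? B)) (¬? (covered? (B ∷ 𝓑) (vertex T)))
        (λ { ¬cov ¬⊆ (here ⊆B) → ¬⊆ ⊆B ; ¬cov ¬⊆ (there cov) → ¬cov cov })
        (λ ¬cov → ¬cov ∘ there , (λ ⊆B → ¬cov (here ⊆B)))))
      (cong (u 𝓑 T *_) (⟦⟧-¬ (vertex T ⊆? B)))

    sel-∷ : ∀ B 𝓑 B′ → sel (B ∷ 𝓑) B′ ≡ sel 𝓑 B′ * (1ℚ - ⟦ meet? B′ B ⟧)
    sel-∷ B 𝓑 B′ = trans
      (sym (⟦⟧-* (selectable? t 𝓑 B′) (¬? (meet? B′ B)) (selectable? t (B ∷ 𝓑) B′)
        (λ s ¬meet bad → split s ¬meet bad)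
        (λ s → selectable-∷ t≤k {𝓑 = 𝓑} s , λ meet → s (shared meet))))
      (cong (sel 𝓑 B′ *_) (⟦⟧-¬ (meet? B′ B)))
      where
      shared : Meet B′ B → Any (λ T → T ⊆ B′ × Covered (B ∷ 𝓑) T) (subsetsOfSize v t)
      shared = Any.map λ (T⊆B′ , T⊆B) → T⊆B′ , here T⊆B
      split : Selectable t 𝓑 B′ → ¬ Meet B′ B → ¬ Any (λ T → T ⊆ B′ × Covered (B ∷ 𝓑) T) (subsetsOfSize v t)
      split s ¬meet bad with lookup-index bad
      ... | T⊆B′ , here T⊆B  = ¬meet (lose (∈-lookup (Any.index bad)) (T⊆B′ , T⊆B))
      ... | T⊆B′ , there cov = s (lose (∈-lookup (Any.index bad)) (T⊆B′ , cov))

    sel⇒u : ∀ {B} 𝓑 T → sel 𝓑 B * ⟦ vertex T ⊆? B ⟧ ≡ sel 𝓑 B * ⟦ vertex T ⊆? B ⟧ * u 𝓑 T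
    sel⇒u {B} 𝓑 T with selectable? t 𝓑 B | vertex T ⊆? B
    ... | no _  | ⊆?       = sym (trans (cong (_* u 𝓑 T) (*-zeroˡ ⟦ ⊆? ⟧)) (trans (*-zeroˡ (u 𝓑 T)) (sym (*-zeroˡ ⟦ ⊆? ⟧))))
    ... | yes _ | no _     = sym (*-zeroˡ (u 𝓑 T))
    ... | yes s | yes T⊆B  = sym (trans (*-identityˡ (u 𝓑 T)) (⟦⟧-true (¬? (covered? 𝓑 (vertex T)))
                               λ cov → s (lose (∈-lookup T) (T⊆B , cov))))

    a⇒u : ∀ 𝓑 T f → a 𝓑 f * b T f ≡ a 𝓑 f * b T f * u 𝓑 T
    a⇒u 𝓑 T f = sel⇒u {edge f} 𝓑 T

    apart : ∀ f e → m f e ≡ 0ℚ → ∀ T → b T f * b T e ≡ 0ℚ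
    apart f e m≡0 T = trans (⟦⟧-* (vertex T ⊆? edge f) (vertex T ⊆? edge e) (vertex T ⊆? edge f ×-dec vertex T ⊆? edge e)
        _,_ (λ p → p))
      (⟦⟧-false (vertex T ⊆? edge f ×-dec vertex T ⊆? edge e)
        (λ p → ⟦⟧≡0⇒ (meet? (edge f) (edge e)) m≡0 (lose (∈-lookup T) p)))

    meet : ∀ f e → m f e ≡ 1ℚ → ∃[ T ] b T f * b T e ≡ 1ℚ
    meet f e m≡1 = T , cong₂ _*_ (⟦⟧-true (vertex T ⊆? edge f) (proj₁ both)) (⟦⟧-true (vertex T ⊆? edge e) (proj₂ both))
      where
      common = ⟦⟧≡1⇒ (meet? (edge f) (edge e)) m≡1
      T = Any.index common
      both = lookup-index common

    vertex-exists : Fin n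
    vertex-exists with shrink t (⊤ {v}) (subst (t ℕ.≤_) (trans (sym v≡t+1+w) (sym (∣⊤∣≡n v))) (ℕ.m≤m+n t (suc w)))
    ... | T , _ , ∣T∣ = Any.index (∈-subsetsOfSize T ∣T∣)

    N : ℚ
    N = ∑[ T < n ] 1ℚ

    -- This uses 1 ≤ t < k. With Q - 1 ≥ 1, the bound `N-large` yields ν ≤ ρ.
    2≤Q : 2ℚ ≤ Q
    2≤Q = fromℕ-mono (2≤C 1≤t (subst (t ℕ.<_) (sym k≡t+1+j) (ℕ.m<m+n t (s≤s z≤n))))
      where
      2≤C : ∀ {t k} → 1 ℕ.≤ t → t ℕ.< k → 2 ℕ.≤ k C t
      2≤C {suc t} {suc k} _ (s≤s t<k) = subst (2 ℕ.≤_) (nCk+nC[k+1]≡[n+1]C[k+1] k t)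
        (ℕ.+-mono-≤ (C-pos (ℕ.<⇒≤ t<k)) (C-pos t<k))

    1≤Q : 1ℚ ≤ Q
    1≤Q = ≤-trans (≤-excess 1ℚ refl 0≤1) 2≤Q

    0<D : 0ℚ < D
    0<D = <-≤-trans (positive⁻¹ 1ℚ) (1≤D j≤w)

    0<N : 0ℚ < N
    0<N = <-≤-trans (positive⁻¹ 1ℚ) (term≤∑ {n} {λ _ → 1ℚ} (λ _ → 0≤1) vertex-exists)

    instance
      N-nonZero : NonZero N
      N-nonZero = pos⇒nonZero N {{positive 0<N}}
      D-nonZero : NonZero D
      D-nonZero = pos⇒nonZero D {{positive 0<D}}

    ν ∂ : ℚ
    ν = 1/ N
    ∂ = 1/ D

    0≤ν : 0ℚ ≤ ν
    0≤ν = <⇒≤ (positive⁻¹ ν {{1/pos⇒pos N {{positive 0<N}}}})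

    0≤∂ : 0ℚ ≤ ∂
    0≤∂ = <⇒≤ (positive⁻¹ ∂ {{1/pos⇒pos D {{positive 0<D}}}})

    U : List (Subset v) → ℚ
    U 𝓑 = sum (u 𝓑)

    d : List (Subset v) → Fin n → ℚ
    d 𝓑 T = ∑[ f < M ] (b T f * a 𝓑 f)

    W : List (Subset v) → ℚ → ℚ
    W 𝓑 τ = ∑[ T < n ] (u 𝓑 T * ((d 𝓑 T - τ) * (d 𝓑 T - τ)))

    u-bit : ∀ 𝓑 T → Bit (u 𝓑 T)
    u-bit 𝓑 T = ⟦⟧-bit (¬? (covered? 𝓑 (vertex T)))

    a-bit : ∀ 𝓑 e → Bit (a 𝓑 e)
    a-bit 𝓑 e = ⟦⟧-bit (selectable? t 𝓑 (edge e))

    m-bit : ∀ f e → Bit (m f e)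
    m-bit f e = ⟦⟧-bit (meet? (edge f) (edge e))

    U-nonNeg : ∀ 𝓑 → 0ℚ ≤ U 𝓑
    U-nonNeg 𝓑 = ∑-nonNeg λ T → bit-nonNeg (u-bit 𝓑 T)

    U≤N : ∀ 𝓑 → U 𝓑 ≤ N
    U≤N 𝓑 = ∑-mono λ T → bit≤1 (u-bit 𝓑 T)

    W-nonNeg : ∀ 𝓑 τ → 0ℚ ≤ W 𝓑 τ
    W-nonNeg 𝓑 τ = ∑-nonNeg λ T → *-nonNeg (bit-nonNeg (u-bit 𝓑 T)) (square-nonNeg (d 𝓑 T - τ))

    U-∷≤ : ∀ B 𝓑 → U (B ∷ 𝓑) ≤ U 𝓑
    U-∷≤ B 𝓑 = ∑-mono λ T → ⟦⟧-mono (¬? (covered? (B ∷ 𝓑) (vertex T))) (¬? (covered? 𝓑 (vertex T))) (_∘ there)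

    -- All t-sets inside a selectable block are still uncovered, so the loss is the same for every
    -- choice; this is what permits a deterministic target.
    U-∷ : ∀ B 𝓑 → ∣ B ∣ ≡ k → Selectable t 𝓑 B → U (B ∷ 𝓑) ≡ U 𝓑 - Q
    U-∷ B 𝓑 ∣B∣ s = begin
      ∑[ T < n ] u (B ∷ 𝓑) T                       ≡⟨ sum-cong-≗ pointwise ⟩
      ∑[ T < n ] (u 𝓑 T - ⟦ vertex T ⊆? B ⟧)       ≡⟨ ∑-distrib-- (u 𝓑) (λ T → ⟦ vertex T ⊆? B ⟧) ⟩
      U 𝓑 - ∑[ T < n ] ⟦ vertex T ⊆? B ⟧           ≡⟨ cong (λ x → U 𝓑 - x) (trans (∑-⊆ B) (cong (λ l → fromℕ (l C t)) ∣B∣)) ⟩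
      U 𝓑 - Q                                      ∎
      where
      open ≡-Reasoning
      alg₁ : ∀ u b → u * (1ℚ - b) ≡ u - 1ℚ * b * u
      alg₁ = solve-∀ ringℚ
      pointwise : ∀ T → u (B ∷ 𝓑) T ≡ u 𝓑 T - ⟦ vertex T ⊆? B ⟧
      pointwise T = begin
        u (B ∷ 𝓑) T                                          ≡⟨ u-∷ B 𝓑 T ⟩
        u 𝓑 T * (1ℚ - ⟦ vertex T ⊆? B ⟧)                     ≡⟨ alg₁ (u 𝓑 T) ⟦ vertex T ⊆? B ⟧ ⟩
        u 𝓑 T - 1ℚ * ⟦ vertex T ⊆? B ⟧ * u 𝓑 T               ≡⟨ cong (λ x → u 𝓑 T - x * ⟦ vertex T ⊆? B ⟧ * u 𝓑 T) (⟦⟧-true (selectable? t 𝓑 B) s) ⟨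
        u 𝓑 T - sel 𝓑 B * ⟦ vertex T ⊆? B ⟧ * u 𝓑 T          ≡⟨ cong (λ x → u 𝓑 T - x) (sel⇒u 𝓑 T) ⟨
        u 𝓑 T - sel 𝓑 B * ⟦ vertex T ⊆? B ⟧                  ≡⟨ cong (λ x → u 𝓑 T - x * ⟦ vertex T ⊆? B ⟧) (⟦⟧-true (selectable? t 𝓑 B) s) ⟩
        u 𝓑 T - 1ℚ * ⟦ vertex T ⊆? B ⟧                       ≡⟨ cong (λ x → u 𝓑 T - x) (*-identityˡ ⟦ vertex T ⊆? B ⟧) ⟩
        u 𝓑 T - ⟦ vertex T ⊆? B ⟧                            ∎

    -- The potential along the greedy process on t-sets and k-sets

    module Bounded (constants : Constants Q)
      (j≤ρw : fromℕ (suc j) ≤ Constants.ρ constants * fromℕ (suc w)) where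

      open Constants constants

      𝓗 : RegularHypergraph n M
      𝓗 = record
        { b = b ; Q = Q ; D = D ; κ = ρ * D ; b-bit = b-bit ; 1≤Q = 1≤Q ; 0≤D = <⇒≤ 0<D
        ; 0≤κ = *-nonNeg (<⇒≤ 0<ρ) (<⇒≤ 0<D)
        ; edge-size = edge-size ; degree = degree ; codegree = codegree ρ j≤ρw (<⇒≤ 0<ρ) }

      state : List (Subset v) → State 𝓗
      state 𝓑 = record
        { u = u 𝓑 ; a = a 𝓑 ; m = m ; u-bit = u-bit 𝓑 ; a-bit = a-bit 𝓑 ; m-bit = m-bit
        ; a⇒u = a⇒u 𝓑 ; apart = apart ; meet = meet }

      N-large : (Q - 1ℚ) * D ≤ N * (ρ * D)
      N-large = Regular.degree≤ 𝓗 vertex-exists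

      ν≤ρ : ν ≤ ρ
      ν≤ρ = *-cancelˡ-≤-pos N {{positive 0<N}} (*-cancelʳ-≤-pos D {{positive 0<D}} (begin
        N * ν * D           ≡⟨ cong (_* D) (*-inverseʳ N) ⟩
        1ℚ * D              ≤⟨ *-monoʳ-≤ (<⇒≤ 0<D) (+-monoˡ-≤ (- 1ℚ) 2≤Q) ⟩
        (Q - 1ℚ) * D        ≤⟨ N-large ⟩
        N * (ρ * D)         ≡⟨ *-assoc N ρ D ⟨
        N * ρ * D           ∎))
        where open ≤-Reasoning

      scale : Scale constants
      scale = record
        { N = N ; D = D ; ν = ν ; ∂ = ∂ ; νN≡1 = *-inverseˡ N ; ∂D≡1 = *-inverseˡ D
        ; 0≤ν = 0≤ν ; 0≤∂ = 0≤∂ ; 0<D = 0<D ; ν≤ρ = ν≤ρ }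

      open Potential 1≤Q scale using (φ; ε≤φ; target-step; φ-large; A-pos; φ-supermartingale)

      -- The target is an existential witness: its history is irrelevant once it is known to lie
      -- between D x^q and D.
      Bound : List (Subset v) → ℚ → Set
      Bound 𝓑 c = ∃[ τ ] 0ℚ ≤ τ × τ ≤ D × D * (U 𝓑 * ν) ^ q ≤ τ × c ≡ φ (U 𝓑) (W 𝓑 τ)

      Advance : List (Subset v) → ℚ → Set
      Advance 𝓑 c = Σ[ c′ ∈ (Subset v → ℚ) ]
        (0ℚ < ∑ₗ E (sel 𝓑)) ×
        (∀ B → ∣ B ∣ ≡ k → Selectable t 𝓑 B → Bound (B ∷ 𝓑) (c′ B)) ×
        (∑ₗ E (λ B → sel 𝓑 B * c′ B) ≤ ∑ₗ E (sel 𝓑) * c)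

      module _ (𝓑 : List (Subset v)) (τ : ℚ) (0≤τ : 0ℚ ≤ τ) (τ≤D : τ ≤ D)
        (τ-large : D * (U 𝓑 * ν) ^ q ≤ τ) (ε≤x : ε ≤ U 𝓑 * ν) where

        private
          0<U : 0ℚ < U 𝓑
          0<U = ≰⇒> λ U≤0 → <⇒≢ (<-≤-trans 0<ε (≤-trans ε≤x
            (≤-trans (*-monoʳ-≤ 0≤ν U≤0) (≤-reflexive (*-zeroˡ ν))))) refl

          A : ℚ
          A = sum (a 𝓑)

          H : ℚ
          H = ∑[ T < n ] (u 𝓑 T * (d 𝓑 T - τ))

          0≤A : 0ℚ ≤ A
          0≤A = Regular.Step.A-nonNeg 𝓗 (state 𝓑)

          QA≡Uτ+H : Q * A ≡ U 𝓑 * τ + H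
          QA≡Uτ+H = Regular.Step.Deviation.QA≡Uτ+H 𝓗 (state 𝓑) τ 0≤τ τ≤D 0<U

          A-list : ∑ₗ E (sel 𝓑) ≡ A
          A-list = ∑ₗ-lookup E (sel 𝓑)

          instance
            U-nonZero : NonZero (U 𝓑)
            U-nonZero = pos⇒nonZero (U 𝓑) {{positive 0<U}}

          Δ : ℚ
          Δ = Q * ((Q - 1ℚ) * τ) * (1/ U 𝓑)

          0≤Δ : 0ℚ ≤ Δ
          0≤Δ = *-nonNeg (*-nonNeg (≤-trans 0≤1 1≤Q) (*-nonNeg (difference≥0 1≤Q) 0≤τ))
            (<⇒≤ (positive⁻¹ (1/ U 𝓑) {{1/pos⇒pos (U 𝓑) {{positive 0<U}}}}))

          ΔU : Δ * U 𝓑 ≡ Q * ((Q - 1ℚ) * τ)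
          ΔU = trans (*-assoc (Q * ((Q - 1ℚ) * τ)) (1/ U 𝓑) (U 𝓑))
            (trans (cong (Q * ((Q - 1ℚ) * τ) *_) (*-inverseˡ (U 𝓑))) (*-identityʳ (Q * ((Q - 1ℚ) * τ))))

          τ′ : ℚ
          τ′ = τ - Δ

          target : D * ((U 𝓑 - Q) * ν) ^ q ≤ τ′
          target = target-step 0<U ε≤x (U≤N 𝓑) 0≤τ τ-large 0≤Δ ΔU

          c′ : Subset v → ℚ
          c′ B = φ (U (B ∷ 𝓑)) (W (B ∷ 𝓑) τ′)

          next : ∀ B → ∣ B ∣ ≡ k → Selectable t 𝓑 B → Bound (B ∷ 𝓑) (c′ B)
          next B ∣B∣ s = τ′
            -- The invariant itself keeps the new target nonnegative: it lies above D x^q for the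
            -- new fraction x, a normalised count.
            , ≤-trans (*-nonNeg (<⇒≤ 0<D) (^-nonNeg q (*-nonNeg (U-nonNeg (B ∷ 𝓑)) 0≤ν))) τ′-large
            , ≤-trans (≤-excess Δ (alg τ Δ) 0≤Δ) τ≤D , τ′-large , refl
            where
            alg : ∀ x y → x - y + y ≡ x
            alg = solve-∀ ringℚ
            τ′-large : D * (U (B ∷ 𝓑) * ν) ^ q ≤ τ′
            τ′-large = subst (λ x → D * (x * ν) ^ q ≤ τ′) (sym (U-∷ B 𝓑 ∣B∣ s)) target

          d′ : Fin n → Fin M → ℚ
          d′ T e = ∑[ f < M ] (b T f * (a 𝓑 f * (1ℚ - m f e)))

          W′ : Fin M → ℚ
          W′ e = ∑[ T < n ] (u 𝓑 T * ((1ℚ - b T e) * ((d′ T e - τ′) * (d′ T e - τ′))))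

          drift : ∑[ e < M ] (a 𝓑 e * W′ e) ≤ (A + 2ℚ * D) * W 𝓑 τ + 6ℚ * (N * (Q * (Q * (ρ * D))) * (D * D))
          drift = Regular.Step.Deviation.Drift.drift 𝓗 (state 𝓑) τ 0≤τ τ≤D 0<U Δ N 0≤Δ ΔU (U≤N 𝓑) N-large

          W-∷ : ∀ e → W (edge e ∷ 𝓑) τ′ ≡ W′ e
          W-∷ e = sum-cong-≗ λ T → trans
            (cong₂ (λ x y → x * ((y - τ′) * (y - τ′))) (u-∷ (edge e) 𝓑 T) (sum-cong-≗ λ f → cong (b T f *_) (sel-∷ (edge e) 𝓑 (edge f))))
            (*-assoc (u 𝓑 T) (1ℚ - b T e) ((d′ T e - τ′) * (d′ T e - τ′)))

          x′ s : ℚ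
          x′ = (U 𝓑 - Q) * ν
          s = ν * (∂ * ∂)

          -- The exact drop of `U` by Q holds only for selectable edges; the factor `a 𝓑 e` removes
          -- all others.
          c′-edge : ∀ e → a 𝓑 e * c′ (edge e) ≡ (ε + r * x′) * a 𝓑 e + K * (x′ ^ p * s) * (a 𝓑 e * W′ e)
          c′-edge e = trans
            (⟦⟧-*-cong (selectable? t 𝓑 (edge e)) λ sel → cong₂ φ (U-∷ (edge e) 𝓑 (∣edge∣ e) sel) (W-∷ e))
            (alg (a 𝓑 e) ε K (x′ ^ p) (W′ e) s (r * x′))
            where
            alg : ∀ a ε K x W s r → a * (ε + K * (x * (W * s)) + r) ≡ (ε + r) * a + K * (x * s) * (a * W)
            alg = solve-∀ ringℚ

          total : ∑ₗ E (λ B → sel 𝓑 B * c′ B) ≡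
                  A * ε + K * (x′ ^ p * (∑[ e < M ] (a 𝓑 e * W′ e) * s)) + A * (r * x′)
          total = begin
            ∑ₗ E (λ B → sel 𝓑 B * c′ B)
              ≡⟨ ∑ₗ-lookup E (λ B → sel 𝓑 B * c′ B) ⟩
            ∑[ e < M ] (a 𝓑 e * c′ (edge e))
              ≡⟨ sum-cong-≗ c′-edge ⟩
            ∑[ e < M ] ((ε + r * x′) * a 𝓑 e + K * (x′ ^ p * s) * (a 𝓑 e * W′ e))
              ≡⟨ ∑-linear (K * (x′ ^ p * s)) (λ e → (ε + r * x′) * a 𝓑 e) (λ e → a 𝓑 e * W′ e) ⟩
            ∑[ e < M ] ((ε + r * x′) * a 𝓑 e) + K * (x′ ^ p * s) * ∑[ e < M ] (a 𝓑 e * W′ e)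
              ≡⟨ cong (_+ K * (x′ ^ p * s) * ∑[ e < M ] (a 𝓑 e * W′ e)) (*-distribˡ-sum (ε + r * x′) (a 𝓑)) ⟨
            (ε + r * x′) * A + K * (x′ ^ p * s) * ∑[ e < M ] (a 𝓑 e * W′ e)
              ≡⟨ alg ε (r * x′) A K (x′ ^ p) s (∑[ e < M ] (a 𝓑 e * W′ e)) ⟩
            A * ε + K * (x′ ^ p * (∑[ e < M ] (a 𝓑 e * W′ e) * s)) + A * (r * x′) ∎
            where
            open ≡-Reasoning
            alg : ∀ ε r A K x s S → (ε + r) * A + K * (x * s) * S ≡ A * ε + K * (x * (S * s)) + A * r
            alg = solve-∀ ringℚ

          cauchy : H * H ≤ U 𝓑 * W 𝓑 τ
          cauchy = Regular.Step.Deviation.cauchy 𝓗 (state 𝓑) τ 0≤τ τ≤D 0<U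

          large : U 𝓑 * τ + 2ℚ * H ≤ 0ℚ → U 𝓑 * ν ≤ φ (U 𝓑) (W 𝓑 τ)
          large = φ-large {U 𝓑} {τ} 0<U ε≤x (U≤N 𝓑) 0≤τ τ-large {A} {W 𝓑 τ} {H} 0≤A (W-nonNeg 𝓑 τ) QA≡Uτ+H cauchy

          A-positive : 0ℚ ≤ U 𝓑 * τ + 2ℚ * H → 0ℚ < A
          A-positive = A-pos {U 𝓑} {τ} 0<U ε≤x (U≤N 𝓑) 0≤τ τ-large {A} {W 𝓑 τ} {H} 0≤A (W-nonNeg 𝓑 τ) QA≡Uτ+H

          decrease : 0ℚ ≤ U 𝓑 * τ + 2ℚ * H →
            A * ε + K * (x′ ^ p * (∑[ e < M ] (a 𝓑 e * W′ e) * s)) + A * (r * x′) ≤ A * φ (U 𝓑) (W 𝓑 τ)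
          decrease good = φ-supermartingale {U 𝓑} {τ} 0<U ε≤x (U≤N 𝓑) 0≤τ τ-large {A} {W 𝓑 τ} {H} 0≤A (W-nonNeg 𝓑 τ) QA≡Uτ+H good
            {∑[ e < M ] (a 𝓑 e * W′ e)} drift

          advancing : 0ℚ ≤ U 𝓑 * τ + 2ℚ * H → Advance 𝓑 (φ (U 𝓑) (W 𝓑 τ))
          advancing good = c′ , subst (0ℚ <_) (sym A-list) (A-positive good) , next
            , subst₂ _≤_ (sym total) (cong (_* φ (U 𝓑) (W 𝓑 τ)) (sym A-list)) (decrease good)

        -- The sign of U τ + 2 H decides whether 2 Q A reaches U τ: if it does, there are enough
        -- selectable edges for a step; if not, W is so large that `φ` already exceeds the uncovered
        -- fraction.
        advance : U 𝓑 * ν ≤ φ (U 𝓑) (W 𝓑 τ) ⊎ Advance 𝓑 (φ (U 𝓑) (W 𝓑 τ))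
        advance = [ inj₁ ∘ large , inj₂ ∘ advancing ]′ (≤-total (U 𝓑 * τ + 2ℚ * H) 0ℚ)

      step : ∀ 𝓑 c → Bound 𝓑 c → U 𝓑 * ν ≤ c ⊎ Advance 𝓑 c
      step 𝓑 _ (τ , 0≤τ , τ≤D , τ-large , refl) =
        [ (λ x≤ε → inj₁ (≤-trans x≤ε (ε≤φ (U-nonNeg 𝓑) (W-nonNeg 𝓑 τ)))) , advance 𝓑 τ 0≤τ τ≤D τ-large ]′
        (≤-total (U 𝓑 * ν) ε)

      u-[] : ∀ T → u [] T ≡ 1ℚ
      u-[] T = ⟦⟧-true (¬? (covered? [] (vertex T))) λ ()

      U-[] : U [] ≡ N
      U-[] = sum-cong-≗ u-[]

      d-[] : ∀ T → d [] T ≡ D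
      d-[] T = trans (sum-cong-≗ λ f → trans (cong (b T f *_) (⟦⟧-true (selectable? t [] (edge f)) (none f))) (*-identityʳ (b T f)))
                     (degree T)
        where
        none : ∀ f → Selectable t [] (edge f)
        none f bad with lookup-index bad
        ... | _ , ()

      W-[] : W [] D ≡ 0ℚ
      W-[] = trans (sum-cong-≗ λ T → trans (cong (λ x → u [] T * ((x - D) * (x - D))) (d-[] T)) (alg (u [] T) D)) (∑-zero {n} n)
        where
        alg : ∀ u D → u * ((D - D) * (D - D)) ≡ 0ℚ
        alg = solve-∀ ringℚ

      -- With the target at D every deviation is 0 initially, and x = 1, so only the terms ε and r
      -- of the potential are left.
      start : Bound [] (ε + r)
      start = D , <⇒≤ 0<D , ≤-refl
        , ≤-reflexive (trans (cong (λ x → D * x ^ q) x≡1) (trans (cong (D *_) (1^ q)) (*-identityʳ D)))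
        , sym (trans (cong₂ (λ x y → ε + K * (x ^ p * (y * (ν * (∂ * ∂)))) + r * x) x≡1 W-[]) (alg ε K (1ℚ ^ p) (ν * (∂ * ∂)) r))
        where
        x≡1 : U [] * ν ≡ 1ℚ
        x≡1 = trans (cong (_* ν) U-[]) (*-inverseʳ N)
        alg : ∀ ε K x s r → ε + K * (x * (0ℚ * s)) + r * 1ℚ ≡ ε + r
        alg = solve-∀ ringℚ

      expected-uncovered : ∑ₗ (orderings v k) (λ σ → U (greedy t σ) * ν) ≤ fromℕ (M !) * (ε + r)
      expected-uncovered = ≤-trans
        (∑ₗ-mono (orderings v k) λ σ∈ → ≤-reflexive (cong (λ 𝓑 → U 𝓑 * ν) (greedy-pass σ∈)))
        (expected-value (λ 𝓑 → U 𝓑 * ν) (λ B 𝓑 → *-monoʳ-≤ 0≤ν (U-∷≤ B 𝓑)) Bound step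
          M E [] (ε + r) refl (All.tabulate (subsetsOfSize-size v k)) (λ g → refl) start)

  -- Density

  ∑ₗ-cong-∈ : ∀ {a} {A : Set a} (xs : List A) {f g : A → ℚ} → (∀ {x} → x ∈ xs → f x ≡ g x) → ∑ₗ xs f ≡ ∑ₗ xs g
  ∑ₗ-cong-∈ []       f≡g = refl
  ∑ₗ-cong-∈ (x ∷ xs) f≡g = cong₂ _+_ (f≡g (here refl)) (∑ₗ-cong-∈ xs (f≡g ∘ there))

  ∑ₗ-comm : ∀ {a b} {A : Set a} {B : Set b} (xs : List A) (ys : List B) (f : A → B → ℚ) →
            ∑ₗ xs (λ x → ∑ₗ ys (f x)) ≡ ∑ₗ ys (λ y → ∑ₗ xs (λ x → f x y))
  ∑ₗ-comm []       ys f = sym (∑ₗ-zero ys λ _ → refl)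
  ∑ₗ-comm (x ∷ xs) ys f = trans (cong (∑ₗ ys (f x) +_) (∑ₗ-comm xs ys f))
    (sym (∑ₗ-distrib-+ ys (f x) (λ y → ∑ₗ xs (λ x → f x y))))

  length-filter≡ : ∀ {a p} {A : Set a} {P : Pred A p} (P? : Decidable P) xs →
                   fromℕ (length (filter P? xs)) ≡ ∑ₗ xs (λ x → ⟦ P? x ⟧)
  length-filter≡ P? []       = refl
  length-filter≡ P? (x ∷ xs) with P? x
  ... | yes _ = cong (1ℚ +_) (length-filter≡ P? xs)
  ... | no  _ = trans (length-filter≡ P? xs) (sym (+-identityˡ (∑ₗ xs (λ x → ⟦ P? x ⟧))))

  average-* : ∀ {a} {A : Set a} (f : A → ℚ) xs → average f xs * fromℕ (length xs) ≡ ∑ₗ xs f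
  average-* f []        = refl
  average-* f (x ∷ xs) = begin
    S * (ℤ.+ 1 ℚ./ m) * fromℕ m      ≡⟨ *-assoc S (ℤ.+ 1 ℚ./ m) (fromℕ m) ⟩
    S * ((ℤ.+ 1 ℚ./ m) * fromℕ m)    ≡⟨ cong (S *_) (trans (cong ((ℤ.+ 1 ℚ./ m) *_) (fromℕ≡/1 m)) cancel) ⟩
    S * 1ℚ                           ≡⟨ *-identityʳ S ⟩
    S                                ∎
    where
    open ≡-Reasoning
    S = ∑ₗ (x ∷ xs) f
    m = suc (length xs)
    cancel : (ℤ.+ 1 ℚ./ m) * (ℤ.+ m ℚ./ 1) ≡ 1ℚ
    cancel = toℚᵘ-injective (begin′
      toℚᵘ ((ℤ.+ 1 ℚ./ m) * (ℤ.+ m ℚ./ 1))                   ≈⟨ toℚᵘ-homo-* (ℤ.+ 1 ℚ./ m) (ℤ.+ m ℚ./ 1) ⟩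
      toℚᵘ (ℤ.+ 1 ℚ./ m) ℚᵘ.* toℚᵘ (ℤ.+ m ℚ./ 1)             ≈⟨ ℚᵘ.*-cong (toℚᵘ-fromℚᵘ (ℚᵘ.mkℚᵘ (ℤ.+ 1) (length xs))) (toℚᵘ-fromℚᵘ (ℚᵘ.mkℚᵘ (ℤ.+ m) 0)) ⟩
      ℚᵘ.mkℚᵘ (ℤ.+ 1) (length xs) ℚᵘ.* ℚᵘ.mkℚᵘ (ℤ.+ m) 0     ≈⟨ ℚᵘ.*≡* (trans (ℤ.*-identityʳ (ℤ.+ 1 ℤ.* ℤ.+ m)) (cong (ℤ.+ 1 ℤ.*_) (cong (λ l → ℤ.+ l) (sym (ℕ.*-identityʳ m))))) ⟩
      ℚᵘ.1ℚᵘ                                                 ∎′)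
      where
      open ℚᵘ.≃-Reasoning renaming (begin_ to begin′_; _∎ to _∎′)

  module Density {v k t : ℕ} (t≤k : t ℕ.≤ k) where

    Packing : List (Subset v) → Set
    Packing 𝓑 = ∀ T → ∣ T ∣ ≡ t → ∑ₗ 𝓑 (λ B → ⟦ T ⊆? B ⟧) ≡ ⟦ covered? 𝓑 T ⟧

    packing-∷ : ∀ {B 𝓑} → Selectable t 𝓑 B → Packing 𝓑 → Packing (B ∷ 𝓑)
    packing-∷ {B} {𝓑} s pack T ∣T∣ = trans (cong (⟦ T ⊆? B ⟧ +_) (pack T ∣T∣))
      (go (T ⊆? B) (covered? 𝓑 T) (covered? (B ∷ 𝓑) T)
        (λ T⊆B cov → s (lose (∈-subsetsOfSize T ∣T∣) (T⊆B , cov))) here there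
        λ { ¬⊆ ¬cov (here ⊆B) → ¬⊆ ⊆B ; ¬⊆ ¬cov (there cov) → ¬cov cov })
      where
      go : ∀ {P Q R : Set} (P? : Dec P) (Q? : Dec Q) (R? : Dec R) →
           (P → ¬ Q) → (P → R) → (Q → R) → (¬ P → ¬ Q → ¬ R) → ⟦ P? ⟧ + ⟦ Q? ⟧ ≡ ⟦ R? ⟧
      go (yes p) (yes q) R? pq pr qr pqr = contradiction q (pq p)
      go (yes p) (no _)  R? pq pr qr pqr = sym (⟦⟧-true R? (pr p))
      go (no ¬p) (yes q) R? pq pr qr pqr = sym (⟦⟧-true R? (qr q))
      go (no ¬p) (no ¬q) R? pq pr qr pqr = sym (⟦⟧-false R? (pqr ¬p ¬q))

    greedyLoop-packing : ∀ m σ 𝓑 → Packing 𝓑 → Packing (greedyLoop t m σ 𝓑)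
    greedyLoop-packing zero    σ 𝓑 pack = pack
    greedyLoop-packing (suc m) σ 𝓑 pack with find (selectable? t 𝓑) σ in eq
    ... | nothing = pack
    ... | just B  = greedyLoop-packing m σ (B ∷ 𝓑)
      (packing-∷ {𝓑 = 𝓑} (proj₂ (find-just (selectable? t 𝓑) σ eq)) pack)

    V : List (Subset v)
    V = subsetsOfSize v t

    Q N : ℚ
    Q = fromℕ (k C t)
    N = fromℕ (length V)

    Uncovered : List (Subset v) → ℚ
    Uncovered 𝓑 = ∑ₗ V (λ T → ⟦ ¬? (covered? 𝓑 T) ⟧)

    ∑-multiplicity : ∀ 𝓑 → ∑ₗ V (λ T → ℤ.+ multiplicity 𝓑 T ℚ./ 1) ≡ ∑ₗ V (λ T → ∑ₗ 𝓑 (λ B → ⟦ T ⊆? B ⟧))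
    ∑-multiplicity 𝓑 = ∑ₗ-cong V λ T → trans (sym (fromℕ≡/1 (multiplicity 𝓑 T))) (length-filter≡ (T ⊆?_) 𝓑)

    ∑-greedy : ∀ σ → ∑ₗ V (λ T → ∑ₗ (greedy t σ) (λ B → ⟦ T ⊆? B ⟧)) + Uncovered (greedy t σ) ≡ N
    ∑-greedy σ = begin
      ∑ₗ V (λ T → ∑ₗ 𝓖 (λ B → ⟦ T ⊆? B ⟧)) + Uncovered 𝓖
        ≡⟨ ∑ₗ-distrib-+ V (λ T → ∑ₗ 𝓖 (λ B → ⟦ T ⊆? B ⟧)) (λ T → ⟦ ¬? (covered? 𝓖 T) ⟧) ⟨
      ∑ₗ V (λ T → ∑ₗ 𝓖 (λ B → ⟦ T ⊆? B ⟧) + ⟦ ¬? (covered? 𝓖 T) ⟧)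
        ≡⟨ ∑ₗ-cong-∈ V (λ {T} T∈ → trans (cong (_+ ⟦ ¬? (covered? 𝓖 T) ⟧)
             (greedyLoop-packing (length σ) σ [] (λ _ _ → refl) T (subsetsOfSize-size v t T∈))) (one (covered? 𝓖 T))) ⟩
      ∑ₗ V (λ _ → 1ℚ)
        ≡⟨ ∑ₗ-const V 1ℚ ⟩
      N * 1ℚ
        ≡⟨ *-identityʳ N ⟩
      N ∎
      where
      open ≡-Reasoning
      𝓖 = greedy t σ
      one : ∀ {P : Set} (P? : Dec P) → ⟦ P? ⟧ + ⟦ ¬? P? ⟧ ≡ 1ℚ
      one (yes _) = refl
      one (no  _) = refl

    -- The greedy blocks cover each of their t-sets exactly once, and each of the u uncovered t-sets
    -- receives a block with Q incidences; the total is (N - u) + Q u. Blocks added in the last step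
    -- may overlap or repeat, as incidences are counted with multiplicity.
    density-greedyCovering : ∀ (c : Completion v k t) σ →
      density t (greedyCovering c σ) * N ≡ N + (Q - 1ℚ) * Uncovered (greedy t σ)
    density-greedyCovering c σ = begin
      density t (𝓖 ++ R) * N
        ≡⟨ average-* (λ T → ℤ.+ multiplicity (𝓖 ++ R) T ℚ./ 1) V ⟩
      ∑ₗ V (λ T → ℤ.+ multiplicity (𝓖 ++ R) T ℚ./ 1)
        ≡⟨ ∑-multiplicity (𝓖 ++ R) ⟩
      ∑ₗ V (λ T → ∑ₗ (𝓖 ++ R) (λ B → ⟦ T ⊆? B ⟧))
        ≡⟨ ∑ₗ-cong V (λ T → ∑ₗ-++ 𝓖 R (λ B → ⟦ T ⊆? B ⟧)) ⟩
      ∑ₗ V (λ T → ∑ₗ 𝓖 (λ B → ⟦ T ⊆? B ⟧) + ∑ₗ R (λ B → ⟦ T ⊆? B ⟧))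
        ≡⟨ ∑ₗ-distrib-+ V (λ T → ∑ₗ 𝓖 (λ B → ⟦ T ⊆? B ⟧)) (λ T → ∑ₗ R (λ B → ⟦ T ⊆? B ⟧)) ⟩
      G + ∑ₗ V (λ T → ∑ₗ R (λ B → ⟦ T ⊆? B ⟧))
        ≡⟨ cong (G +_) added ⟩
      G + Uncovered 𝓖 * Q
        ≡⟨ alg G (Uncovered 𝓖) Q ⟩
      G + Uncovered 𝓖 + (Q - 1ℚ) * Uncovered 𝓖
        ≡⟨ cong (_+ (Q - 1ℚ) * Uncovered 𝓖) (∑-greedy σ) ⟩
      N + (Q - 1ℚ) * Uncovered 𝓖 ∎
      where
      open ≡-Reasoning
      open Completion c
      𝓖 = greedy t σ
      R = map (block σ) (uncovered t 𝓖)
      G = ∑ₗ V (λ T → ∑ₗ 𝓖 (λ B → ⟦ T ⊆? B ⟧))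
      alg : ∀ G u Q → G + u * Q ≡ G + u + (Q - 1ℚ) * u
      alg = solve-∀ ringℚ
      size-uncovered : ∀ {T} → T ∈ uncovered t 𝓖 → ∣ T ∣ ≡ t
      size-uncovered T∈ = subsetsOfSize-size v t (proj₁ (∈-filter⁻ (¬? ∘ covered? 𝓖) {xs = V} T∈))
      added : ∑ₗ V (λ T → ∑ₗ R (λ B → ⟦ T ⊆? B ⟧)) ≡ Uncovered 𝓖 * Q
      added = begin
        ∑ₗ V (λ T → ∑ₗ R (λ B → ⟦ T ⊆? B ⟧))
          ≡⟨ ∑ₗ-comm V R (λ T B → ⟦ T ⊆? B ⟧) ⟩
        ∑ₗ R (λ B → ∑ₗ V (λ T → ⟦ T ⊆? B ⟧))
          ≡⟨ ∑ₗ-map (block σ) (uncovered t 𝓖) (λ B → ∑ₗ V (λ T → ⟦ T ⊆? B ⟧)) ⟩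
        ∑ₗ (uncovered t 𝓖) (λ S → ∑ₗ V (λ T → ⟦ T ⊆? block σ S ⟧))
          ≡⟨ ∑ₗ-cong-∈ (uncovered t 𝓖) (λ {S} S∈ → trans (∑ₗ-subsetsOf (block σ S) t)
               (cong (λ l → fromℕ (l C t)) (size σ S (size-uncovered S∈)))) ⟩
        ∑ₗ (uncovered t 𝓖) (λ _ → Q)
          ≡⟨ ∑ₗ-const (uncovered t 𝓖) Q ⟩
        fromℕ (length (uncovered t 𝓖)) * Q
          ≡⟨ cong (_* Q) (length-filter≡ (¬? ∘ covered? 𝓖) V) ⟩
        Uncovered 𝓖 * Q ∎

    module _ (c : Completion v k t) (ν : ℚ) (νN≡1 : ν * N ≡ 1ℚ) (0≤ν : 0ℚ ≤ ν) (1≤Q : 1ℚ ≤ Q) where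

      private
        L : ℚ
        L = fromℕ (length (subsetsOfSize v k) !)

        0<L : 0ℚ < L
        0<L = <-≤-trans (positive⁻¹ 1ℚ) (fromℕ-mono (ℕ.1≤n! (length (subsetsOfSize v k))))

        ∑-const : ∀ c → ∑ₗ (orderings v k) (λ _ → c) ≡ L * c
        ∑-const = ∑ₗ-permutations-const (length (subsetsOfSize v k)) (subsetsOfSize v k) refl

        length-orderings : fromℕ (length (orderings v k)) ≡ L
        length-orderings = trans (trans (sym (*-identityʳ _)) (sym (∑ₗ-const (orderings v k) 1ℚ)))
          (trans (∑-const 1ℚ) (*-identityʳ L))

        𝔼 : ℚ
        𝔼 = expectedDensity c

        density≡ : ∀ σ → density t (greedyCovering c σ) ≡ 1ℚ + (Q - 1ℚ) * (Uncovered (greedy t σ) * ν)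
        density≡ σ = begin
          x                                        ≡⟨ *-identityʳ x ⟨
          x * 1ℚ                                   ≡⟨ cong (x *_) νN≡1 ⟨
          x * (ν * N)                              ≡⟨ alg₁ x ν N ⟩
          x * N * ν                                ≡⟨ cong (_* ν) (density-greedyCovering c σ) ⟩
          (N + (Q - 1ℚ) * u) * ν                   ≡⟨ alg₂ N Q u ν ⟩
          ν * N + (Q - 1ℚ) * (u * ν)               ≡⟨ cong (_+ (Q - 1ℚ) * (u * ν)) νN≡1 ⟩
          1ℚ + (Q - 1ℚ) * (u * ν)                  ∎
          where
          open ≡-Reasoning
          x = density t (greedyCovering c σ)
          u = Uncovered (greedy t σ)
          alg₁ : ∀ x ν N → x * (ν * N) ≡ x * N * ν
          alg₁ = solve-∀ ringℚ
          alg₂ : ∀ N Q u ν → (N + (Q - 1ℚ) * u) * ν ≡ ν * N + (Q - 1ℚ) * (u * ν)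
          alg₂ = solve-∀ ringℚ

        ∑density : 𝔼 * L ≡ L * 1ℚ + (Q - 1ℚ) * ∑ₗ (orderings v k) (λ σ → Uncovered (greedy t σ) * ν)
        ∑density = begin
          𝔼 * L
            ≡⟨ cong (𝔼 *_) length-orderings ⟨
          𝔼 * fromℕ (length (orderings v k))
            ≡⟨ average-* (λ σ → density t (greedyCovering c σ)) (orderings v k) ⟩
          ∑ₗ (orderings v k) (λ σ → density t (greedyCovering c σ))
            ≡⟨ ∑ₗ-cong (orderings v k) density≡ ⟩
          ∑ₗ (orderings v k) (λ σ → 1ℚ + (Q - 1ℚ) * (Uncovered (greedy t σ) * ν))
            ≡⟨ ∑ₗ-distrib-+ (orderings v k) (λ _ → 1ℚ) (λ σ → (Q - 1ℚ) * (Uncovered (greedy t σ) * ν)) ⟩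
          ∑ₗ (orderings v k) (λ _ → 1ℚ) + ∑ₗ (orderings v k) (λ σ → (Q - 1ℚ) * (Uncovered (greedy t σ) * ν))
            ≡⟨ cong₂ _+_ (∑-const 1ℚ) (∑ₗ-*ˡ (orderings v k) (Q - 1ℚ) (λ σ → Uncovered (greedy t σ) * ν)) ⟩
          L * 1ℚ + (Q - 1ℚ) * ∑ₗ (orderings v k) (λ σ → Uncovered (greedy t σ) * ν) ∎
          where open ≡-Reasoning

        Uncovered-nonNeg : ∀ 𝓑 → 0ℚ ≤ Uncovered 𝓑
        Uncovered-nonNeg 𝓑 = subst (_≤ Uncovered 𝓑) (∑ₗ-zero V λ _ → refl)
          (∑ₗ-mono V λ {T} _ → ⟦⟧-nonNeg (¬? (covered? 𝓑 T)))

      ∣expectedDensity-1∣≤ : ∀ β → (Q - 1ℚ) * ∑ₗ (orderings v k) (λ σ → Uncovered (greedy t σ) * ν) ≤ L * β →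
                             ℚ.∣ 𝔼 - 1ℚ ∣ ≤ β
      ∣expectedDensity-1∣≤ β bound = begin
        ℚ.∣ 𝔼 - 1ℚ ∣   ≡⟨ 0≤p⇒∣p∣≡p (*-cancelˡ-≤-pos L {{positive 0<L}} lower) ⟩
        𝔼 - 1ℚ         ≤⟨ *-cancelˡ-≤-pos L {{positive 0<L}} upper ⟩
        β              ∎
        where
        open ≤-Reasoning
        Σ = ∑ₗ (orderings v k) (λ σ → Uncovered (greedy t σ) * ν)
        alg : ∀ L E S → L * (E - 1ℚ) ≡ E * L - L * 1ℚ
        alg = solve-∀ ringℚ
        alg′ : ∀ x y → x + y - x ≡ y
        alg′ = solve-∀ ringℚ
        excess : L * (𝔼 - 1ℚ) ≡ (Q - 1ℚ) * Σ
        excess = trans (alg L 𝔼 0ℚ) (trans (cong (_- L * 1ℚ) ∑density) (alg′ (L * 1ℚ) ((Q - 1ℚ) * Σ)))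
        0≤Σ : 0ℚ ≤ Σ
        0≤Σ = subst (_≤ Σ) (∑ₗ-zero (orderings v k) λ _ → refl)
          (∑ₗ-mono (orderings v k) λ {σ} _ → *-nonNeg (Uncovered-nonNeg (greedy t σ)) 0≤ν)
        lower : L * 0ℚ ≤ L * (𝔼 - 1ℚ)
        lower = subst₂ _≤_ (sym (*-zeroʳ L)) (sym excess) (*-nonNeg (difference≥0 1≤Q) 0≤Σ)
        upper : L * (𝔼 - 1ℚ) ≤ L * β
        upper = subst (_≤ L * β) (sym excess) bound

      -- If every block covers a single t-set, the greedy family is already an exact cover.
      expectedDensity-exact : Q ≡ 1ℚ → ℚ.∣ 𝔼 - 1ℚ ∣ ≤ 0ℚ
      expectedDensity-exact Q≡1 = ∣expectedDensity-1∣≤ 0ℚ (vanish Q L (∑ₗ (orderings v k) (λ σ → Uncovered (greedy t σ) * ν)) Q≡1)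
        where
        alg : ∀ s L → (1ℚ - 1ℚ) * s ≡ L * 0ℚ
        alg = solve-∀ ringℚ
        vanish : ∀ q L s → q ≡ 1ℚ → (q - 1ℚ) * s ≤ L * 0ℚ
        vanish _ L s refl = ≤-reflexive (alg s L)

  -- Choice of constants

  inverse : ∀ x → 0ℚ < x → ∃[ y ] 0ℚ < y × y * x ≡ 1ℚ
  inverse x 0<x = 1/ x , positive⁻¹ (1/ x) {{1/pos⇒pos x {{positive 0<x}}}} , *-inverseˡ x
    where instance
      x-nonZero : NonZero x
      x-nonZero = pos⇒nonZero x {{positive 0<x}}

  *-pos : ∀ {x y} → 0ℚ < x → 0ℚ < y → 0ℚ < x * y
  *-pos {x} {y} 0<x 0<y = positive⁻¹ (x * y) {{pos*pos⇒pos x {{positive 0<x}} y {{positive 0<y}}}}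

  ≤fromℕ : ∀ x → ∃[ n ] x ≤ fromℕ n
  ≤fromℕ x@(mkℚ p d c) = m , ≤-trans (*≤* le) (≤-reflexive (trans (sym (↥p/↧p≡p (mkℚ (ℤ.+ m) 0 c′))) (sym (fromℕ≡/1 m))))
    where
    m = ℤ.∣ p ∣
    c′ = ℕ.sym (ℕ.1-coprimeTo m)
    p≤∣p∣ : ∀ p → p ℤ.≤ ℤ.+ ℤ.∣ p ∣
    p≤∣p∣ (ℤ.+ n)    = ℤ.≤-refl
    p≤∣p∣ ℤ.-[1+ n ] = ℤ.-≤+
    le : p ℤ.* ℤ.+ 1 ℤ.≤ ℤ.+ m ℤ.* ℤ.+ suc d
    le = ℤ.≤-trans (ℤ.≤-reflexive (ℤ.*-identityʳ p)) (ℤ.≤-trans (p≤∣p∣ p)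
      (subst (ℤ.+ m ℤ.≤_) (ℤ.pos-* m (suc d)) (ℤ.+≤+ (ℕ.m≤m*n m (suc d)))))

  archimedean : ∀ x {e} → 0ℚ < e → ∃[ n ] x ≤ fromℕ n * e
  archimedean x {e} 0<e with inverse e 0<e
  ... | e⁻¹ , _ , e⁻¹e≡1 with ≤fromℕ (x * e⁻¹)
  ...   | n , le = n , ≤-trans (≤-reflexive (sym x≡)) (*-monoʳ-≤ (<⇒≤ 0<e) le)
    where
    x≡ : x * e⁻¹ * e ≡ x
    x≡ = trans (*-assoc x e⁻¹ e) (trans (cong (x *_) e⁻¹e≡1) (*-identityʳ x))

  below-both : ∀ {x y} → 0ℚ < x → 0ℚ < y → ∃[ z ] 0ℚ < z × z ≤ x × z ≤ y
  below-both {x} {y} 0<x 0<y with ≤-total x y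
  ... | inj₁ x≤y = x , 0<x , ≤-refl , x≤y
  ... | inj₂ y≤x = y , 0<y , y≤x , ≤-refl

  0<2 : 0ℚ < 2ℚ
  0<2 = positive⁻¹ 2ℚ

  -- The dependencies are not circular: ε = r = η / (4Q), whence Q (ε + r) = η / 2; then q depends
  -- on ε, p on ε and q, K on p and q, and finally ρ on all of them.
  constants : ∀ Q {η} → 1ℚ ≤ Q → 0ℚ < η →
              Σ[ c ∈ Constants Q ] (Q * (Constants.ε c + Constants.r c) < η)
  constants Q {η} 1≤Q 0<η = record
      { ε = ε ; K = K ; r = ε ; ρ = ρ ; p = p ; q = q
      ; 0<ε = 0<ε ; 0≤K = <⇒≤ 0<K ; 0≤r = <⇒≤ 0<ε ; 0<ρ = *-pos 0<μ 0<z
      ; p-large = proj₂ p-exists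
      ; q-large = proj₂ q-exists
      ; K-large = ≤-reflexive (sym (trans (*-assoc (2ℚ * 2ℚ) x⁻¹ X) (trans (cong (2ℚ * 2ℚ *_) x⁻¹x≡1) (*-identityʳ (2ℚ * 2ℚ)))))
      ; r-large = ≤-trans (share first≤Z) μ≤₁
      ; ρ-small = ≤-trans (share second≤Z) μ≤₂
      }
    , small
    where
    0<Q : 0ℚ < Q
    0<Q = <-≤-trans (positive⁻¹ 1ℚ) 1≤Q
    0<4Q = *-pos (*-pos 0<2 0<2) 0<Q
    4Q-inverse = inverse (2ℚ * 2ℚ * Q) 0<4Q
    i = proj₁ 4Q-inverse
    ε : ℚ
    ε = η * i
    0<ε : 0ℚ < ε
    0<ε = *-pos 0<η (proj₁ (proj₂ 4Q-inverse))
    q-exists = archimedean (2ℚ * Q) 0<ε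
    q = proj₁ q-exists
    0<E = ^-pos (suc q) 0<ε
    p-exists = archimedean (2ℚ * 2ℚ) 0<E
    p = proj₁ p-exists
    X = ε ^ p * (ε * (ε ^ q * ε ^ q))
    X-inverse = inverse X (*-pos (^-pos p 0<ε) (*-pos 0<ε (*-pos (^-pos q 0<ε) (^-pos q 0<ε))))
    x⁻¹ = proj₁ X-inverse
    x⁻¹x≡1 = proj₂ (proj₂ X-inverse)
    K : ℚ
    K = 2ℚ * 2ℚ * x⁻¹
    0<K : 0ℚ < K
    0<K = *-pos (*-pos 0<2 0<2) (proj₁ (proj₂ X-inverse))
    0<QQ = *-pos 0<Q 0<Q
    z₁ z₂ Z : ℚ
    z₁ = 2ℚ * (K * (6ℚ * (Q * Q)))
    z₂ = 2ℚ * (Q * Q)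
    Z = z₁ + z₂
    0<z₁ : 0ℚ < z₁
    0<z₁ = *-pos 0<2 (*-pos 0<K (*-pos (positive⁻¹ 6ℚ) 0<QQ))
    0<z₂ : 0ℚ < z₂
    0<z₂ = *-pos 0<2 0<QQ
    Z-inverse = inverse Z (+-mono-< 0<z₁ 0<z₂)
    0<z = proj₁ (proj₂ Z-inverse)
    -- `μ` is the smaller of the right-hand sides required by `r-large`, where r = ε, and by
    -- `ρ-small`. Dividing it by the sum of the two coefficients of ρ meets both conditions at once.
    bound = below-both (*-pos 0<ε 0<E) 0<ε
    μ = proj₁ bound
    0<μ = proj₁ (proj₂ bound)
    μ≤₁ = proj₁ (proj₂ (proj₂ bound))
    μ≤₂ = proj₂ (proj₂ (proj₂ bound))
    ρ : ℚ
    ρ = μ * proj₁ Z-inverse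
    0≤ρ : 0ℚ ≤ ρ
    0≤ρ = <⇒≤ (*-pos 0<μ 0<z)
    share : ∀ {y} → y ≤ Z * ρ → y ≤ μ
    share {y} y≤ = ≤-trans y≤ (≤-reflexive (trans (alg Z μ (proj₁ Z-inverse)) (trans (cong (μ *_) (proj₂ (proj₂ Z-inverse))) (*-identityʳ μ))))
      where
      alg : ∀ Z μ z → Z * (μ * z) ≡ μ * (z * Z)
      alg = solve-∀ ringℚ
    first≤Z : 2ℚ * (K * (6ℚ * (Q * (Q * ρ)))) ≤ Z * ρ
    first≤Z = ≤-excess (z₂ * ρ) (alg K Q ρ) (*-nonNeg (<⇒≤ 0<z₂) 0≤ρ)
      where
      alg : ∀ K Q ρ → 2ℚ * (K * (6ℚ * (Q * (Q * ρ)))) + 2ℚ * (Q * Q) * ρ ≡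
                      (2ℚ * (K * (6ℚ * (Q * Q))) + 2ℚ * (Q * Q)) * ρ
      alg = solve-∀ ringℚ
    second≤Z : 2ℚ * (Q * (Q * ρ)) ≤ Z * ρ
    second≤Z = ≤-excess (z₁ * ρ) (alg K Q ρ) (*-nonNeg (<⇒≤ 0<z₁) 0≤ρ)
      where
      alg : ∀ K Q ρ → 2ℚ * (Q * (Q * ρ)) + 2ℚ * (K * (6ℚ * (Q * Q))) * ρ ≡
                      (2ℚ * (K * (6ℚ * (Q * Q))) + 2ℚ * (Q * Q)) * ρ
      alg = solve-∀ ringℚ
    small : Q * (ε + ε) < η
    small = *-cancelˡ-<-nonNeg 2ℚ {{nonNegative 0≤2}} (begin-strict
      2ℚ * (Q * (ε + ε))              ≡⟨ alg Q η i ⟩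
      η * (i * (2ℚ * 2ℚ * Q))       ≡⟨ cong (η *_) (proj₂ (proj₂ 4Q-inverse)) ⟩
      η * 1ℚ                              <⟨ *-monoʳ-<-pos η {{positive 0<η}} 1<2 ⟩
      η * 2ℚ                              ≡⟨ *-comm η 2ℚ ⟩
      2ℚ * η                              ∎)
      where
      open ≤-Reasoning
      1<2 : 1ℚ < 2ℚ
      1<2 = subst (_< 2ℚ) (+-identityʳ 1ℚ) (+-monoʳ-< 1ℚ (positive⁻¹ 1ℚ))
      alg : ∀ Q η i → 2ℚ * (Q * (η * i + η * i)) ≡ η * (i * (2ℚ * 2ℚ * Q))
      alg = solve-∀ ringℚ

  -- The bounds on the expected density for t = k and for t < k

  expectedDensity-trivial : ∀ {v k t} → t ≡ k → k ℕ.≤ v → (c : Completion v k t) → ℚ.∣ expectedDensity c - 1ℚ ∣ ≤ 0ℚ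
  expectedDensity-trivial {v} {t} refl t≤v c =
    Density.expectedDensity-exact ℕ.≤-refl c (proj₁ N⁻¹) (proj₂ (proj₂ N⁻¹)) (<⇒≤ (proj₁ (proj₂ N⁻¹))) (≤-reflexive (sym Q≡1)) Q≡1
    where
    0<fromℕ : ∀ {n} → Fin n → 0ℚ < fromℕ n
    0<fromℕ {suc n} _ = <-≤-trans (positive⁻¹ 1ℚ) (≤-excess (fromℕ n) refl (fromℕ-nonNeg n))
    T₀ = shrink t (⊤ {v}) (subst (t ℕ.≤_) (sym (∣⊤∣≡n v)) t≤v)
    N⁻¹ = inverse (fromℕ (length (subsetsOfSize v t))) (0<fromℕ (Any.index (∈-subsetsOfSize (proj₁ T₀) (proj₂ (proj₂ T₀)))))
    Q≡1 : fromℕ (t C t) ≡ 1ℚ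
    Q≡1 = cong fromℕ (nCn≡1 t)

  expectedDensity-bound : ∀ {v k t j w} (k≡ : k ≡ t ℕ.+ suc j) (v≡ : v ≡ t ℕ.+ suc w) → 1 ℕ.≤ t → j ℕ.≤ w →
    (constants : Constants (fromℕ (k C t))) → fromℕ (suc j) ≤ Constants.ρ constants * fromℕ (suc w) →
    (c : Completion v k t) →
    ℚ.∣ expectedDensity c - 1ℚ ∣ ≤ fromℕ (k C t) * (Constants.ε constants + Constants.r constants)
  expectedDensity-bound {v} {k} {t} {j} {w} k≡ v≡ 1≤t j≤w constants j≤ρw c =
    Density.∣expectedDensity-1∣≤ t≤k c ν (trans (cong (ν *_) N≡) (*-inverseˡ N)) 0≤ν 1≤Q (Q * (ε + r)) (begin
      (Q - 1ℚ) * ∑ₗ (orderings v k) (λ σ → Density.Uncovered t≤k (greedy t σ) * ν)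
        ≡⟨ cong ((Q - 1ℚ) *_) (∑ₗ-cong (orderings v k) λ σ → cong (_* ν)
             (∑ₗ-lookup (subsetsOfSize v t) _)) ⟩
      (Q - 1ℚ) * ∑ₗ (orderings v k) (λ σ → U (greedy t σ) * ν)
        ≤⟨ *-monoˡ-≤ (difference≥0 1≤Q) expected-uncovered ⟩
      (Q - 1ℚ) * (L * (ε + r))
        ≤⟨ ≤-excess (L * (ε + r)) (alg Q L (ε + r)) (*-nonNeg (fromℕ-nonNeg (M !)) (+-nonNeg (<⇒≤ 0<ε) 0≤r)) ⟩
      L * (Q * (ε + r)) ∎)
    where
    open ≤-Reasoning
    open Process v k t j w k≡ v≡ 1≤t j≤w
    open Constants constants
    open Bounded constants j≤ρw
    L = fromℕ (M !)
    alg : ∀ Q L x → (Q - 1ℚ) * (L * x) + L * x ≡ L * (Q * x)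
    alg = solve-∀ ringℚ
    N≡ : fromℕ (length (subsetsOfSize v t)) ≡ N
    N≡ = trans (sym (*-identityʳ _)) (trans (sym (∑ₗ-const (subsetsOfSize v t) 1ℚ)) (∑ₗ-lookup (subsetsOfSize v t) (λ _ → 1ℚ)))

open RandomGreedy using (fromℕ; fromℕ-mono; C-pos; *-monoʳ-≤; constants; archimedean;
  module Constants; expectedDensity-trivial; expectedDensity-bound)
open import Data.Nat.Base using (ℕ; _≤_; suc)
open import Data.Nat.Combinatorics using (_C_)
import Data.Nat.Base as ℕ
import Data.Nat.Properties as ℕ
open import Data.Product.Base using (_,_; proj₁; proj₂; ∃-syntax)
open import Data.Rational.Base as ℚ using (ℚ; 0ℚ; 1ℚ; _-_)
import Data.Rational.Properties as ℚ
open import Data.Sum.Base using ([_,_]′)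
open import Relation.Binary.PropositionalEquality using (_≡_; sym; trans; subst₂)

theorem3 : (k t : ℕ) → 1 ≤ t → t ≤ k →
    (c : ∀ v → k ≤ v → Completion v k t) →
    ∀ (ε : ℚ) → 0ℚ ℚ.< ε →
    ∃[ N ] (∀ v (k≤v : k ≤ v) → N ≤ v →
    ℚ.∣ expectedDensity (c v k≤v) - 1ℚ ∣ ℚ.< ε)
theorem3 k t 1≤t t≤k c ε 0<ε = [ proper , trivial ]′ (ℕ.m≤n⇒m<n∨m≡n t≤k)
  where
  Conclusion : Set
  Conclusion = ∃[ N ] (∀ v (k≤v : k ≤ v) → N ≤ v → ℚ.∣ expectedDensity (c v k≤v) - 1ℚ ∣ ℚ.< ε)

  trivial : t ≡ k → Conclusion
  trivial t≡k = 0 , λ v k≤v _ → ℚ.≤-<-trans (expectedDensity-trivial t≡k k≤v (c v k≤v)) 0<ε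

  proper : t ℕ.< k → Conclusion
  -- For v = t + 1 + w beyond this threshold w is at least w₀, which gives (j + 1) ≤ ρ (w + 1), the
  -- smallness of the codegrees.
  proper t<k = suc t ℕ.+ w₀ , bound
    where
    j-exists = ℕ.m≤n⇒∃[o]m+o≡n t<k
    j = proj₁ j-exists
    k≡ : k ≡ t ℕ.+ suc j
    k≡ = trans (sym (proj₂ j-exists)) (sym (ℕ.+-suc t j))
    chosen = constants (fromℕ (k C t)) (fromℕ-mono (C-pos t≤k)) 0<ε
    open Constants (proj₁ chosen) using (ρ; 0<ρ)
    w₀-exists = archimedean (fromℕ (suc j)) 0<ρ
    w₀ = proj₁ w₀-exists

    bound : ∀ v (k≤v : k ≤ v) → suc t ℕ.+ w₀ ≤ v → ℚ.∣ expectedDensity (c v k≤v) - 1ℚ ∣ ℚ.< ε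
    bound v k≤v N≤v = ℚ.≤-<-trans
      (expectedDensity-bound k≡ v≡ 1≤t j≤w (proj₁ chosen) j≤ρw (c v k≤v)) (proj₂ chosen)
      where
      w-exists = ℕ.m≤n⇒∃[o]m+o≡n (ℕ.≤-trans (ℕ.m≤m+n (suc t) w₀) N≤v)
      w = proj₁ w-exists
      v≡ : v ≡ t ℕ.+ suc w
      v≡ = trans (sym (proj₂ w-exists)) (sym (ℕ.+-suc t w))
      j≤w : j ≤ w
      j≤w = ℕ.s≤s⁻¹ (ℕ.+-cancelˡ-≤ t (suc j) (suc w) (subst₂ _≤_ k≡ v≡ k≤v))
      w₀≤w : w₀ ≤ w
      w₀≤w = ℕ.+-cancelˡ-≤ (suc t) w₀ w (ℕ.≤-trans N≤v (ℕ.≤-reflexive (sym (proj₂ w-exists))))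
      j≤ρw : fromℕ (suc j) ℚ.≤ ρ ℚ.* fromℕ (suc w)
      j≤ρw = ℚ.≤-trans (proj₂ w₀-exists) (ℚ.≤-trans
        (*-monoʳ-≤ (ℚ.<⇒≤ 0<ρ) (fromℕ-mono (ℕ.m≤n⇒m≤1+n w₀≤w)))
        (ℚ.≤-reflexive (ℚ.*-comm (fromℕ (suc w)) ρ)))
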